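{- Let $n\ge2$ and let $w=w_1w_2\cdots w_n$ be an element of $\mathfrak{B}_n$. Then $w$ is separable if and only if it avoids the patterns $\underline{2}1$, $2\underline{1}$, $3142$, $2413$, $\underline{3}\,\underline{1}\,\underline{4}\,\underline{2}$, and $\underline{2}\,\underline{4}\,\underline{1}\,\underline{3}$.
   Context: Notation: $[n]=\{1,\dots,n\}$; an underlined number is negative, $\underline{k}=-k$. $\mathfrak{B}_n$ is the group (under composition, $(uv)(i)=u(v(i))$) of signed permutations of $[n]$, i.e. bijections $w$ of $\{\pm1,\dots,\pm n\}$ with $w(-i)=-w(i)$; one-line notation is $w=w_1\cdots w_n$ with $w_i=w(i)$, $i\in[n]$. $\mathfrak{B}_n$ is the Weyl group of type $B_n$, acting on $\mathbb{R}^n$ by $we_i=e_{w_i}$ with $e_{ -i}=-e_i$, with root system $\Phi=\{\pm e_i\mid i\in[n]\}\cup\{\pm e_i\pm e_j\mid 1\le i<j\le n\}$, positive roots $\Phi^+=\{\pm e_i+e_j\mid 1\le i<j\le n\}\cup\{e_i\mid i\in[n]\}$, and simple roots $\Delta=\{\alpha_0=e_1\}\cup\{\alpha_i=-e_i+e_{i+1}\mid i\in[n-1]\}$. Separable elements: let $\Phi$ be a crystallographic root system with simple system $\Delta$, positive system $\Phi^+$ and Weyl group $W(\Phi)$. $I_\Phi(w)=\{\alpha\in\Phi^+\mid w\alpha\in-\Phi^+\}$; on $\Phi^+$, $\alpha\le\beta$ iff $\beta-\alpha$ is a nonnegative integral combination of simple roots. For a linear subspace $V$ of $\mathrm{span}(\Phi)$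 and $\Phi'=\Phi\cap V$ (with positive system $\Phi^+\cap V$), $w|_{\Phi'}$ is the unique $w'\in W(\Phi')$ with $I_{\Phi'}(w')=I_\Phi(w)\cap V$. An element $w\in W(\Phi)$ is separable (recursively) if one of the following holds: (S1) $\Phi$ is of type $A_1$; (S2) $\Phi=\bigoplus\Phi_i$ is reducible and $w|_{\Phi_i}$ is separable for each $i$; (S3) $\Phi$ is irreducible and there exists $\alpha_i\in\Delta$ such that $w|_{\Phi_J}\in W(\Phi_J)$ is separable, where $\Phi_J$ is the subsystem generated by $J=\Delta\setminus\{\alpha_i\}$, and either $\{\beta\in\Phi^+\mid\beta\ge\alpha_i\}\subset I_\Phi(w)$ (equality allowed) or $\{\beta\in\Phi^+\mid\beta\ge\alpha_i\}\cap I_\Phi(w)=\emptyset$. (The identity of the trivial group is regarded as separable.) Patterns: for a sequence $a=a_1\cdots a_m$ of nonzero reals, the standard signed permutation $\mathrm{sts}(a)$ is the unique $v\in\mathfrak{B}_m$ with $\{i\mid v_i<0\}=\{i\mid a_i<0\}$ and, for all $1\le i<j\le m$, $|v_i|<|v_j|\Leftrightarrow|a_i|\le|a_j|$. A signed permutation $w\in\mathfrak{B}_n$ contains the pattern $u\in\mathfrak{B}_m$ ($m\le n$) if there are $1\le i_1<\cdots<i_m\le n$ with $\mathrm{sts}(w_{i_1}\cdots w_{i_m})=u$; otherwise (in particular if $m>n$) it avoids $u$. -}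

module Defs where

open import Level using (0ℓ)
open import Data.Nat using (ℕ; _≤_)
import Data.Nat as ℕ
open import Data.Integer using (ℤ; ∣_∣; _◃_)
import Data.Integer as ℤ
open import Data.Rational using (ℚ; 0ℚ; 1ℚ; ≢-nonZero; 1/_)
import Data.Rational as ℚ
import Data.Rational.Properties as ℚ
open import Data.Sign using (Sign; opposite)
import Data.Sign as Sign
import Data.Sign.Properties as Sign
open import Data.Fin using (Fin; toℕ; #_; _<_; _≟_)
open import Data.Fin.Properties using (all?)
open import Data.List using (List; foldr)
open import Data.List.Relation.Unary.All using (All)
open import Data.Vec using (Vec; []; _∷_; zipWith; map; replicate; tabulate; lookup; foldr′)
open import Data.Product using (_×_; _,_; ∃; ∃₂; Σ-syntax; ∃-syntax; proj₁; proj₂)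
open import Data.Product.Properties using (≡-dec)
open import Data.Sum using (_⊎_)
open import Function using (_∘_)
open import Function.Bundles using (_⇔_; _↔_; Inverse; mk↔ₛ′)
open import Relation.Nullary using (¬_; Dec; yes; no)
open import Relation.Nullary.Decidable using (True; toWitness; ⌊_⌋)
open import Relation.Unary using (Pred; _∈_; _⊆_; _≐_; _∩_; _∪_; ｛_｝; ⋃; Satisfiable)
  renaming (Empty to IsEmpty)
open import Relation.Binary.PropositionalEquality
  using (_≡_; _≢_; refl; trans; cong; cong₂)
open import Data.Bool using (if_then_else_)

------------------------------------------------------------------------
-- The Euclidean space ℚⁿ
--
-- All roots of type B are rational vectors, and a rational vector lies in
-- the real span of a set of rational vectors iff it lies in their rational
-- span, so ℚⁿ can play the part of ℝⁿ throughout.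

V : ℕ → Set
V n = Vec ℚ n

infixl 6 _⊞_ _⊟_
infixr 7 _∙_
infix  8 ⊟_

0v : ∀ {n} → V n
0v = replicate _ 0ℚ

_⊞_ : ∀ {n} → V n → V n → V n
_⊞_ = zipWith ℚ._+_

⊟_ : ∀ {n} → V n → V n
⊟_ = map (λ x → ℚ.- x)

_⊟_ : ∀ {n} → V n → V n → V n
u ⊟ v = u ⊞ (⊟ v)

_∙_ : ∀ {n} → ℚ → V n → V n
c ∙ v = map (c ℚ.*_) v

⟪_,_⟫ : ∀ {n} → V n → V n → ℚ
⟪ u , v ⟫ = foldr′ ℚ._+_ 0ℚ (zipWith ℚ._*_ u v)

data Span {n} (S : Pred (V n) 0ℓ) : Pred (V n) 0ℓ where
  zeroˢ : ∀ {v} → v ≡ 0v → Span S v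
  addˢ  : ∀ {u s v} (c : ℚ) → S s → Span S u → v ≡ (c ∙ s) ⊞ u → Span S v

-- Nonnegative integral combinations.
data ℕSpan {n} (S : Pred (V n) 0ℓ) : Pred (V n) 0ℓ where
  zeroⁿ : ∀ {v} → v ≡ 0v → ℕSpan S v
  addⁿ  : ∀ {u s v} → S s → ℕSpan S u → v ≡ s ⊞ u → ℕSpan S v

_⟂_ : ∀ {n} → Pred (V n) 0ℓ → Pred (V n) 0ℓ → Set
A ⟂ B = ∀ {α β} → α ∈ A → β ∈ B → ⟪ α , β ⟫ ≡ 0ℚ

-- The inverse, with the junk value 0 at 0; it is only ever applied to
-- ⟪ α , α ⟫ for a root α.
recip : ℚ → ℚ
recip q with q ℚ.≟ 0ℚ
... | yes _   = 0ℚ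
... | no q≢0 = 1/_ q {{≢-nonZero q≢0}}

-- s_α (v) = v − (2⟨v,α⟩/⟨α,α⟩) α
reflection : ∀ {n} → V n → V n → V n
reflection α v = v ⊟ ((1ℚ ℚ.+ 1ℚ) ℚ.* ⟪ v , α ⟫ ℚ.* recip ⟪ α , α ⟫) ∙ α

------------------------------------------------------------------------
-- Root systems with a chosen positive and simple system
--
-- Only the data is recorded.  The root-system axioms hold for type B and are
-- inherited by every subsystem to which separability descends from there.

record RootSystem (n : ℕ) : Set₁ where
  field
    Φ  : Pred (V n) 0ℓ
    Φ⁺ : Pred (V n) 0ℓ
    Δ  : Pred (V n) 0ℓ

open RootSystem public

-- W(Φ), as a set of maps of the ambient space: products of reflections.
W : ∀ {n} → RootSystem n → Pred (V n → V n) 0ℓ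
W R f = ∃[ αs ] (All (Φ R) αs × (∀ v → f v ≡ foldr reflection v αs))

I : ∀ {n} → RootSystem n → (V n → V n) → Pred (V n) 0ℓ
I R w α = α ∈ Φ⁺ R × ⊟ (w α) ∈ Φ⁺ R

_≤[_]_ : ∀ {n} → V n → RootSystem n → V n → Set
α ≤[ R ] β = (β ⊟ α) ∈ ℕSpan (Δ R)

-- { β ∈ Φ⁺ ∣ β ≥ α }
↑ : ∀ {n} → RootSystem n → V n → Pred (V n) 0ℓ
↑ R α β = β ∈ Φ⁺ R × α ≤[ R ] β

-- Φ ∩ U with positive system Φ⁺ ∩ U; its simple system is supplied, since it
-- is in general not Δ ∩ U.
subsystem : ∀ {n} → RootSystem n → (U Δ′ : Pred (V n) 0ℓ) → RootSystem n
subsystem R U Δ′ = record { Φ = Φ R ∩ U ; Φ⁺ = Φ⁺ R ∩ U ; Δ = Δ′ }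

-- A summand C of Φ is the intersection of Φ with the span of C.
summand : ∀ {n} → RootSystem n → Pred (V n) 0ℓ → RootSystem n
summand R C = subsystem R C (Δ R ∩ C)

Δ-without : ∀ {n} → RootSystem n → V n → Pred (V n) 0ℓ
Δ-without R α δ = δ ∈ Δ R × δ ≢ α

parabolic : ∀ {n} → RootSystem n → V n → RootSystem n
parabolic R α = subsystem R (Span (Δ-without R α)) (Δ-without R α)

-- w′ = w|_{Φ′}, for a subsystem R′ of R.
IsRestriction : ∀ {n} → RootSystem n → (V n → V n) →
                RootSystem n → (V n → V n) → Set
IsRestriction R w R′ w′ = w′ ∈ W R′ × I R′ w′ ≐ (I R w ∩ Φ R′)

Irreducible : ∀ {n} → Pred (V n) 0ℓ → Set₁
Irreducible {n} S = Satisfiable S ×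
  (∀ (A B : Pred (V n) 0ℓ) → Satisfiable A → Satisfiable B →
   S ≐ (A ∪ B) → ¬ (A ⟂ B))

IsA₁ : ∀ {n} → Pred (V n) 0ℓ → Set
IsA₁ S = ∃[ α ] (α ≢ 0v × S ≐ (｛ α ｝ ∪ ｛ ⊟ α ｝))

-- C 0 , … , C (k-1) are the irreducible components of S.
record Components {n k} (S : Pred (V n) 0ℓ) (C : Fin k → Pred (V n) 0ℓ) : Set₁ where
  field
    irreducible : ∀ i → Irreducible (C i)
    orthogonal  : ∀ {i j} → i ≢ j → C i ⟂ C j
    union       : S ≐ ⋃ (Fin k) C

data Separable {n} (R : RootSystem n) (w : V n → V n) : Set₁ where

  S0 : IsEmpty (Φ R) → Separable R w

  S1 : IsA₁ (Φ R) → Separable R w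

  S2 : ∀ {k} (C : Fin k → Pred (V n) 0ℓ) → 2 ≤ k → Components (Φ R) C →
       (∀ i → ∃[ w′ ] (IsRestriction R w (summand R (C i)) w′ ×
                       Separable (summand R (C i)) w′)) →
       Separable R w

  S3 : Irreducible (Φ R) → ∀ α → α ∈ Δ R →
       ∃[ w′ ] (IsRestriction R w (parabolic R α) w′ ×
                Separable (parabolic R α) w′) →
       (↑ R α ⊆ I R w) ⊎ IsEmpty (↑ R α ∩ I R w) →
       Separable R w

------------------------------------------------------------------------
-- Signed permutations

-- {±1, …, ±n}; the letter (s , i) stands for s(i+1), as i counts from 0.
±[_] : ℕ → Set
±[ n ] = Sign × Fin n

neg : ∀ {n} → ±[ n ] → ±[ n ]
neg (s , i) = opposite s , i

toℤ : ∀ {n} → ±[ n ] → ℤ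
toℤ (s , i) = s ◃ ℕ.suc (toℕ i)

record SignedPerm (n : ℕ) : Set where
  field
    bijection : ±[ n ] ↔ ±[ n ]

  apply : ±[ n ] → ±[ n ]
  apply = Inverse.to bijection

  field
    odd : ∀ x → apply (neg x) ≡ neg (apply x)

  -- wᵢ as a letter
  entry : Fin n → ±[ n ]
  entry i = apply (Sign.+ , i)

open SignedPerm public

-- wᵢ as an integer
oneLine : ∀ {n} → SignedPerm n → Fin n → ℤ
oneLine w i = toℤ (entry w i)

------------------------------------------------------------------------
-- Type B

-- eᵢ for i ∈ {±1, …, ±n}
e : ∀ {n} → ±[ n ] → V n
e (Sign.+ , i) = tabulate λ k → if ⌊ i ≟ k ⌋ then 1ℚ else 0ℚ
e (Sign.- , i) = ⊟ e (Sign.+ , i)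

B : ∀ n → RootSystem n
B n = record
  { Φ  = λ v → (∃₂ λ s i → v ≡ e (s , i))
             ⊎ (∃₂ λ i j → i < j × ∃₂ λ s t → v ≡ e (s , i) ⊞ e (t , j))
  ; Φ⁺ = λ v → (∃ λ i → v ≡ e (Sign.+ , i))
             ⊎ (∃₂ λ i j → i < j × ∃ λ s → v ≡ e (s , i) ⊞ e (Sign.+ , j))
  ; Δ  = λ v → (∃ λ i → toℕ i ≡ 0 × v ≡ e (Sign.+ , i))
             ⊎ (∃₂ λ i j → toℕ j ≡ ℕ.suc (toℕ i) × v ≡ e (Sign.- , i) ⊞ e (Sign.+ , j))
  }

-- The linear map with eᵢ ↦ e_{wᵢ}.
act : ∀ {n} → SignedPerm n → V n → V n
act w v = foldr′ _⊞_ 0v (tabulate λ i → lookup v i ∙ e (entry w i))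

IsSeparable : ∀ {n} → SignedPerm n → Set₁
IsSeparable {n} w = Separable (B n) (act w)

------------------------------------------------------------------------
-- Patterns

-- v = sts(a₁ ⋯ aₘ)
IsSts : ∀ {m} → (Fin m → ℤ) → SignedPerm m → Set
IsSts a v =
  (∀ i → (oneLine v i ℤ.< ℤ.0ℤ) ⇔ (a i ℤ.< ℤ.0ℤ)) ×
  (∀ {i j} → i < j → (∣ oneLine v i ∣ ℕ.< ∣ oneLine v j ∣) ⇔ (∣ a i ∣ ≤ ∣ a j ∣))

_Contains_ : ∀ {n m} → SignedPerm n → SignedPerm m → Set
_Contains_ {n} {m} w u =
  Σ[ p ∈ (Fin m → Fin n) ] ((∀ {j k} → j < k → p j < p k) × IsSts (oneLine w ∘ p) u)

_Avoids_ : ∀ {n m} → SignedPerm n → SignedPerm m → Set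
w Avoids u = ¬ (w Contains u)

infix 4 _Contains_ _Avoids_

-- The odd extension of a map given on positive letters.
extend : ∀ {m} → Vec ±[ m ] m → ±[ m ] → ±[ m ]
extend f (s , i) = s Sign.* proj₁ (lookup f i) , proj₂ (lookup f i)

private
  Cancels : ∀ {m} → Vec ±[ m ] m → Vec ±[ m ] m → Set
  Cancels f g = ∀ i → extend f (lookup g i) ≡ (Sign.+ , i)

  cancels? : ∀ {m} (f g : Vec ±[ m ] m) → Dec (Cancels f g)
  cancels? f g = all? λ i → ≡-dec Sign._≟_ _≟_ (extend f (lookup g i)) (Sign.+ , i)

  extend-inverse : ∀ {m} (f g : Vec ±[ m ] m) → Cancels f g →
                   ∀ x → extend f (extend g x) ≡ x
  extend-inverse f g c (s , i) = cong₂ _,_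
    (trans (Sign.*-assoc s _ _)
      (trans (cong (s Sign.*_) (cong proj₁ (c i))) (Sign.*-identityʳ s)))
    (cong proj₂ (c i))

  extend-odd : ∀ {m} (f : Vec ±[ m ] m) → ∀ x → extend f (neg x) ≡ neg (extend f x)
  extend-odd f (Sign.+ , i) = refl
  extend-odd f (Sign.- , i) with lookup f i
  ... | Sign.+ , _ = refl
  ... | Sign.- , _ = refl

-- f is the one-line notation of the signed permutation, g that of its inverse.
fromOneLine : ∀ {m} (f g : Vec ±[ m ] m) →
              {True (cancels? f g)} → {True (cancels? g f)} → SignedPerm m
fromOneLine f g {p} {q} = record
  { bijection = mk↔ₛ′ (extend f) (extend g)
                  (extend-inverse f g (toWitness p)) (extend-inverse g f (toWitness q))
  ; odd       = extend-odd f
  }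

private
  p₁ p₂ n₁ n₂ : ∀ {m} → ±[ ℕ.suc (ℕ.suc m) ]
  p₁ = Sign.+ , Fin.zero
  p₂ = Sign.+ , Fin.suc Fin.zero
  n₁ = neg p₁
  n₂ = neg p₂

  p₃ p₄ n₃ n₄ : ±[ 4 ]
  p₃ = Sign.+ , # 2
  p₄ = Sign.+ , # 3
  n₃ = neg p₃
  n₄ = neg p₄

[-2,1] [2,-1] : SignedPerm 2
[-2,1] = fromOneLine (n₂ ∷ p₁ ∷ []) (p₂ ∷ n₁ ∷ [])
[2,-1] = fromOneLine (p₂ ∷ n₁ ∷ []) (n₂ ∷ p₁ ∷ [])

[3,1,4,2] [2,4,1,3] [-3,-1,-4,-2] [-2,-4,-1,-3] : SignedPerm 4
[3,1,4,2]     = fromOneLine (p₃ ∷ p₁ ∷ p₄ ∷ p₂ ∷ []) (p₂ ∷ p₄ ∷ p₁ ∷ p₃ ∷ [])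
[2,4,1,3]     = fromOneLine (p₂ ∷ p₄ ∷ p₁ ∷ p₃ ∷ []) (p₃ ∷ p₁ ∷ p₄ ∷ p₂ ∷ [])
[-3,-1,-4,-2] = fromOneLine (n₃ ∷ n₁ ∷ n₄ ∷ n₂ ∷ []) (n₂ ∷ n₄ ∷ n₁ ∷ n₃ ∷ [])
[-2,-4,-1,-3] = fromOneLine (n₂ ∷ n₄ ∷ n₁ ∷ n₃ ∷ []) (n₃ ∷ n₁ ∷ n₄ ∷ n₂ ∷ [])

private
  _ : tabulate (oneLine [-2,1]) ≡ ℤ.-[1+ 1 ] ∷ ℤ.+ 1 ∷ []
  _ = refl

  _ : tabulate (oneLine [2,-1]) ≡ ℤ.+ 2 ∷ ℤ.-[1+ 0 ] ∷ []
  _ = refl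

  _ : tabulate (oneLine [3,1,4,2]) ≡ ℤ.+ 3 ∷ ℤ.+ 1 ∷ ℤ.+ 4 ∷ ℤ.+ 2 ∷ []
  _ = refl

  _ : tabulate (oneLine [2,4,1,3]) ≡ ℤ.+ 2 ∷ ℤ.+ 4 ∷ ℤ.+ 1 ∷ ℤ.+ 3 ∷ []
  _ = refl

  _ : tabulate (oneLine [-3,-1,-4,-2]) ≡ ℤ.-[1+ 2 ] ∷ ℤ.-[1+ 0 ] ∷ ℤ.-[1+ 3 ] ∷ ℤ.-[1+ 1 ] ∷ []
  _ = refl

  _ : tabulate (oneLine [-2,-4,-1,-3]) ≡ ℤ.-[1+ 1 ] ∷ ℤ.-[1+ 3 ] ∷ ℤ.-[1+ 0 ] ∷ ℤ.-[1+ 2 ] ∷ []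
  _ = refl

{-# OPTIONS --safe #-}

-- A positive root β is inverted by w iff ⟪ β , (w₁ , … , wₙ) ⟫ < 0, so both sides
-- of the equivalence are statements about the signs of the wᵢ and wᵢ ± wⱼ.
--
-- Separable ⇒ avoiding: an occurrence of a pattern yields a connected set of
-- positive roots βᵢ (simple roots of a B₂ or A₃ inside B n), each below a root γᵢ
-- of their span such that exactly one of βᵢ, γᵢ is inverted.  No summand of S2
-- separates them, and a cut of S3 at α cannot lie below any βᵢ because γᵢ ≥ βᵢ,
-- so such a configuration survives every step of the recursion down to the
-- trivial and A₁ cases, which have room for none.
--
-- Avoiding ⇒ separable: the last maximal block of entries of constant sign
-- dominates everything before it in absolute value, which gives a cut of S3 that
-- leaves a shorter signed permutation and a type A word; the latter avoids 3142
-- and 2413 and hence is a direct or skew sum.  The restrictions are built by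
-- reflecting (w₁ , … , wₙ) into the dominant chamber of the subsystem.

module Submission where

open import Defs
open import Data.Nat using (ℕ; _≤_)
open import Data.Product using (_×_)
open import Function.Bundles using (_⇔_)

open import Level using (0ℓ)
open import Data.Bool using (if_then_else_)
open import Data.Empty using (⊥; ⊥-elim)
open import Data.Fin using (Fin; zero; suc; _≟_; toℕ; inject₁; _<_; fromℕ<)
open import Data.Fin.Induction using (<-weakInduction)
open import Data.Fin.Patterns using (0F; 1F; 2F; 3F)
open import Data.Fin.Properties using (any?; toℕ-injective; toℕ-inject₁; toℕ-fromℕ<; fromℕ<-toℕ; toℕ<n; <-cmp)
open import Data.Integer using (ℤ; +_; -[1+_]; ∣_∣)
import Data.Integer as ℤ
import Data.Integer.Properties as ℤₚ
open import Data.List using (List; []; _∷_; foldr; _∷ʳ_)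
open import Data.List.Properties using (foldr-∷ʳ)
open import Data.List.Relation.Unary.All using (All; []; _∷_)
import Data.List.Relation.Unary.All as All
open import Data.List.Relation.Unary.All.Properties using (∷ʳ⁺)
open import Data.Nat using (zero; suc; z≤n; s≤s)
import Data.Nat as ℕ
open import Data.Nat.Coprimality using (1-coprimeTo) renaming (sym to coprime-sym)
import Data.Nat.Properties as ℕₚ
open import Data.Product using (_,_; ∃; ∃₂; ∃-syntax; proj₁; proj₂)
open import Data.Rational using (ℚ; 0ℚ; 1ℚ; mkℚ)
import Data.Rational as ℚ
import Data.Rational.Properties as ℚₚ
open import Data.Rational.Solver using (module +-*-Solver)
open import Data.Sign using (Sign; opposite)
import Data.Sign as Sign
open import Data.Sum using (_⊎_; inj₁; inj₂; [_,_]′; swap)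
open import Data.Vec using (Vec; []; _∷_; lookup; tabulate; foldr′)
open import Data.Vec.Properties using (≡-dec; lookup∘tabulate; tabulate∘lookup; tabulate-cong; lookup-map; lookup-zipWith)
open import Data.Vec.Relation.Unary.Linked using (Linked; []; [-]; _∷_)
import Data.Vec.Relation.Unary.Linked.Properties as Linked
open import Function using (_∘_; flip; _on_)
open import Function.Bundles using (Inverse; mk⇔; Equivalence)
open import Relation.Binary.Definitions using (tri<; tri≈; tri>)
open import Relation.Binary.PropositionalEquality
open import Relation.Nullary using (¬_; Dec; yes; no)
open import Relation.Nullary.Decidable using (⌊_⌋; _×-dec_; ¬?)
open import Relation.Unary using (Pred; Decidable; Satisfiable; _∈_; _⊆_; _≐_; _∩_; _∪_; ⋃) renaming (Empty to IsEmpty)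

open +-*-Solver using (solve; _:+_; _:*_; :-_; _:=_; con)

-- The two directions handle subsystems differently. A derivation of separability makes choices that
-- cannot be foreseen, so the forward direction works in an arbitrary `Good` system and consults
-- nothing but inversion sets. The converse makes the choices itself and meets only systems whose
-- simple roots have indices in an interval, or in an interval with one index deleted.
--
-- The obstacle in the converse is that S2 and S3 ask for an actual product of reflections of the
-- subsystem with a prescribed inversion set. One vector, `values w`, governs all of them: at every
-- stage the current map inverts exactly the positive roots that pair negatively with this vector.
-- That condition reads the same in every subsystem, so two maps that satisfy it are automatically
-- related by restriction, and only existence remains, by walking to the dominant chamber. The walk
-- terminates because `values w` pairs with a root `β` to the height of `act w β`, a nonzero
-- integer: each reflection brings the vector closer to `ρᴮ` by at least 1 in squared distance, and
-- a natural number above the initial squared distance serves as fuel.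

-- Rational inner products and vector algebra

neg-neg : ∀ q → ℚ.- (ℚ.- q) ≡ q
neg-neg q = solve 1 (λ q → :- (:- q) := q) refl q

0≤p² : ∀ p → 0ℚ ℚ.≤ p ℚ.* p
0≤p² p with ℚₚ.≤-total 0ℚ p
... | inj₁ 0≤p = subst (ℚ._≤ p ℚ.* p) (ℚₚ.*-zeroˡ p) (ℚₚ.*-monoʳ-≤-nonNeg p {{ℚ.nonNegative 0≤p}} 0≤p)
... | inj₂ p≤0 = subst (ℚ._≤ p ℚ.* p) (ℚₚ.*-zeroˡ p) (ℚₚ.*-monoʳ-≤-nonPos p {{ℚ.nonPositive p≤0}} p≤0)

p²≡0⇒p≡0 : ∀ p → p ℚ.* p ≡ 0ℚ → p ≡ 0ℚ
p²≡0⇒p≡0 p eq with ℚₚ.<-cmp p 0ℚ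
... | tri≈ _ p≡0 _ = p≡0
... | tri< p<0 _ _ = ⊥-elim (ℚₚ.<⇒≢ (ℚₚ.positive⁻¹ _ {{ℚₚ.neg*neg⇒pos p {{ℚ.negative p<0}} p {{ℚ.negative p<0}}}}) (sym eq))
... | tri> _ _ 0<p = ⊥-elim (ℚₚ.<⇒≢ (ℚₚ.positive⁻¹ _ {{ℚₚ.pos*pos⇒pos p {{ℚ.positive 0<p}} p {{ℚ.positive 0<p}}}}) (sym eq))

⟪⟫-comm : ∀ {n} (u v : V n) → ⟪ u , v ⟫ ≡ ⟪ v , u ⟫
⟪⟫-comm []      []      = refl
⟪⟫-comm (x ∷ u) (y ∷ v) = cong₂ ℚ._+_ (ℚₚ.*-comm x y) (⟪⟫-comm u v)

⟪⟫-⊞ˡ : ∀ {n} (u v w : V n) → ⟪ u ⊞ v , w ⟫ ≡ ⟪ u , w ⟫ ℚ.+ ⟪ v , w ⟫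
⟪⟫-⊞ˡ []      []      []      = refl
⟪⟫-⊞ˡ (x ∷ u) (y ∷ v) (z ∷ w) = trans (cong ((x ℚ.+ y) ℚ.* z ℚ.+_) (⟪⟫-⊞ˡ u v w))
  (solve 5 (λ x y z p q → (x :+ y) :* z :+ (p :+ q) := (x :* z :+ p) :+ (y :* z :+ q)) refl x y z ⟪ u , w ⟫ ⟪ v , w ⟫)

⟪⟫-∙ˡ : ∀ {n} c (u v : V n) → ⟪ c ∙ u , v ⟫ ≡ c ℚ.* ⟪ u , v ⟫
⟪⟫-∙ˡ c []      []      = sym (ℚₚ.*-zeroʳ c)
⟪⟫-∙ˡ c (x ∷ u) (y ∷ v) = trans (cong ((c ℚ.* x) ℚ.* y ℚ.+_) (⟪⟫-∙ˡ c u v))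
  (solve 4 (λ c x y p → (c :* x) :* y :+ c :* p := c :* (x :* y :+ p)) refl c x y ⟪ u , v ⟫)

⟪⟫-⊟ˡ : ∀ {n} (u v : V n) → ⟪ ⊟ u , v ⟫ ≡ ℚ.- ⟪ u , v ⟫
⟪⟫-⊟ˡ []      []      = refl
⟪⟫-⊟ˡ (x ∷ u) (y ∷ v) = trans (cong ((ℚ.- x) ℚ.* y ℚ.+_) (⟪⟫-⊟ˡ u v))
  (solve 3 (λ x y p → (:- x) :* y :+ (:- p) := :- (x :* y :+ p)) refl x y ⟪ u , v ⟫)

⟪⟫-0ˡ : ∀ {n} (v : V n) → ⟪ 0v , v ⟫ ≡ 0ℚ
⟪⟫-0ˡ []      = refl
⟪⟫-0ˡ (y ∷ v) = trans (cong₂ ℚ._+_ (ℚₚ.*-zeroˡ y) (⟪⟫-0ˡ v)) refl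

⟪⟫-⊞ʳ : ∀ {n} (w u v : V n) → ⟪ w , u ⊞ v ⟫ ≡ ⟪ w , u ⟫ ℚ.+ ⟪ w , v ⟫
⟪⟫-⊞ʳ w u v = trans (⟪⟫-comm w (u ⊞ v)) (trans (⟪⟫-⊞ˡ u v w) (cong₂ ℚ._+_ (⟪⟫-comm u w) (⟪⟫-comm v w)))

⟪⟫-⊟ʳ : ∀ {n} (v u : V n) → ⟪ v , ⊟ u ⟫ ≡ ℚ.- ⟪ v , u ⟫
⟪⟫-⊟ʳ v u = trans (⟪⟫-comm v (⊟ u)) (trans (⟪⟫-⊟ˡ u v) (cong ℚ.-_ (⟪⟫-comm u v)))

⟪⟫-nonneg : ∀ {n} (u : V n) → 0ℚ ℚ.≤ ⟪ u , u ⟫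
⟪⟫-nonneg []      = ℚₚ.≤-refl
⟪⟫-nonneg (x ∷ u) = ℚₚ.+-mono-≤ (0≤p² x) (⟪⟫-nonneg u)

+-zero-split : ∀ {p q} → 0ℚ ℚ.≤ p → 0ℚ ℚ.≤ q → p ℚ.+ q ≡ 0ℚ → p ≡ 0ℚ × q ≡ 0ℚ
+-zero-split {p} {q} 0≤p 0≤q eq =
  ℚₚ.≤-antisym (subst₂ ℚ._≤_ (ℚₚ.+-identityʳ p) eq (ℚₚ.+-monoʳ-≤ p 0≤q)) 0≤p ,
  ℚₚ.≤-antisym (subst₂ ℚ._≤_ (ℚₚ.+-identityˡ q) eq (ℚₚ.+-monoˡ-≤ q 0≤p)) 0≤q

⟪⟫-definite : ∀ {n} (u : V n) → ⟪ u , u ⟫ ≡ 0ℚ → u ≡ 0v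
⟪⟫-definite []      _  = refl
⟪⟫-definite (x ∷ u) eq with +-zero-split (0≤p² x) (⟪⟫-nonneg u) eq
... | x²≡0 , u²≡0 = cong₂ _∷_ (p²≡0⇒p≡0 x x²≡0) (⟪⟫-definite u u²≡0)

⊞-assoc : ∀ {n} (u v w : V n) → (u ⊞ v) ⊞ w ≡ u ⊞ (v ⊞ w)
⊞-assoc []      []      []      = refl
⊞-assoc (x ∷ u) (y ∷ v) (z ∷ w) = cong₂ _∷_ (ℚₚ.+-assoc x y z) (⊞-assoc u v w)

⊞-comm : ∀ {n} (u v : V n) → u ⊞ v ≡ v ⊞ u
⊞-comm []      []      = refl
⊞-comm (x ∷ u) (y ∷ v) = cong₂ _∷_ (ℚₚ.+-comm x y) (⊞-comm u v)

⊞-identityˡ : ∀ {n} (v : V n) → 0v ⊞ v ≡ v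
⊞-identityˡ []      = refl
⊞-identityˡ (x ∷ v) = cong₂ _∷_ (ℚₚ.+-identityˡ x) (⊞-identityˡ v)

⊞-identityʳ : ∀ {n} (v : V n) → v ⊞ 0v ≡ v
⊞-identityʳ v = trans (⊞-comm v 0v) (⊞-identityˡ v)

⊞-inverseʳ : ∀ {n} (v : V n) → v ⊞ (⊟ v) ≡ 0v
⊞-inverseʳ []      = refl
⊞-inverseʳ (x ∷ v) = cong₂ _∷_ (ℚₚ.+-inverseʳ x) (⊞-inverseʳ v)

⊟-involutive : ∀ {n} (v : V n) → ⊟ (⊟ v) ≡ v
⊟-involutive []      = refl
⊟-involutive (x ∷ v) = cong₂ _∷_ (solve 1 (λ x → :- (:- x) := x) refl x) (⊟-involutive v)

⊟-⊞ : ∀ {n} (u v : V n) → ⊟ (u ⊞ v) ≡ (⊟ u) ⊞ (⊟ v)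
⊟-⊞ []      []      = refl
⊟-⊞ (x ∷ u) (y ∷ v) = cong₂ _∷_ (ℚₚ.neg-distrib-+ x y) (⊟-⊞ u v)

∙-⊞ : ∀ {n} c (u v : V n) → c ∙ (u ⊞ v) ≡ (c ∙ u) ⊞ (c ∙ v)
∙-⊞ c []      []      = refl
∙-⊞ c (x ∷ u) (y ∷ v) = cong₂ _∷_ (ℚₚ.*-distribˡ-+ c x y) (∙-⊞ c u v)

∙-assoc : ∀ {n} c d (u : V n) → c ∙ (d ∙ u) ≡ (c ℚ.* d) ∙ u
∙-assoc c d []      = refl
∙-assoc c d (x ∷ u) = cong₂ _∷_ (sym (ℚₚ.*-assoc c d x)) (∙-assoc c d u)

1∙ : ∀ {n} (u : V n) → 1ℚ ∙ u ≡ u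
1∙ []      = refl
1∙ (x ∷ u) = cong₂ _∷_ (ℚₚ.*-identityˡ x) (1∙ u)

0∙ : ∀ {n} (u : V n) → 0ℚ ∙ u ≡ 0v
0∙ []      = refl
0∙ (x ∷ u) = cong₂ _∷_ (ℚₚ.*-zeroˡ x) (0∙ u)

-1∙ : ∀ {n} (u : V n) → (ℚ.- 1ℚ) ∙ u ≡ ⊟ u
-1∙ []      = refl
-1∙ (x ∷ u) = cong₂ _∷_ (solve 1 (λ x → con (ℚ.- 1ℚ) :* x := :- x) refl x) (-1∙ u)

⟦_⟧ : Sign → ℚ
⟦ Sign.+ ⟧ = 1ℚ
⟦ Sign.- ⟧ = ℚ.- 1ℚ

⟪e+,⟫ : ∀ {n} (i : Fin n) (v : V n) → ⟪ e (Sign.+ , i) , v ⟫ ≡ lookup v i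
⟪e+,⟫ {suc n} zero (x ∷ v) =
  trans (cong₂ ℚ._+_ (ℚₚ.*-identityˡ x) (zeros v)) (ℚₚ.+-identityʳ x)
  where
  zeros : ∀ {m} (v : V m) → ⟪ tabulate (λ _ → 0ℚ) , v ⟫ ≡ 0ℚ
  zeros []      = refl
  zeros (y ∷ v) = trans (cong₂ ℚ._+_ (ℚₚ.*-zeroˡ y) (zeros v)) refl
⟪e+,⟫ {suc n} (suc i) (x ∷ v) =
  trans (cong₂ ℚ._+_ (ℚₚ.*-zeroˡ x)
          (trans (cong (λ u → ⟪ u , v ⟫) (tabulate-cong shift)) (⟪e+,⟫ i v)))
        (ℚₚ.+-identityˡ _)
  where
  shift : ∀ k → (if ⌊ suc i ≟ suc k ⌋ then 1ℚ else 0ℚ) ≡ (if ⌊ i ≟ k ⌋ then 1ℚ else 0ℚ)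
  shift k with i ≟ k
  ... | yes _ = refl
  ... | no  _ = refl

⟪e,⟫ : ∀ {n} s (i : Fin n) (v : V n) → ⟪ e (s , i) , v ⟫ ≡ ⟦ s ⟧ ℚ.* lookup v i
⟪e,⟫ Sign.+ i v = trans (⟪e+,⟫ i v) (sym (ℚₚ.*-identityˡ _))
⟪e,⟫ Sign.- i v = trans (⟪⟫-⊟ˡ (e (Sign.+ , i)) v) (trans (cong ℚ.-_ (⟪e+,⟫ i v))
  (solve 1 (λ x → :- x := con (ℚ.- 1ℚ) :* x) refl (lookup v i)))

lookup-e-same : ∀ {n} (i : Fin n) → lookup (e (Sign.+ , i)) i ≡ 1ℚ
lookup-e-same i rewrite lookup∘tabulate (λ k → if ⌊ i ≟ k ⌋ then 1ℚ else 0ℚ) i with i ≟ i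
... | yes _ = refl
... | no i≢i = ⊥-elim (i≢i refl)

lookup-e-other : ∀ {n} {i k : Fin n} → i ≢ k → lookup (e (Sign.+ , i)) k ≡ 0ℚ
lookup-e-other {i = i} {k} i≢k rewrite lookup∘tabulate (λ k → if ⌊ i ≟ k ⌋ then 1ℚ else 0ℚ) k with i ≟ k
... | yes i≡k = ⊥-elim (i≢k i≡k)
... | no _ = refl

-- Linear spans and nonnegative integral spans

ℕSpan-⊞ : ∀ {n} {S : Pred (V n) 0ℓ} {u v} → ℕSpan S u → ℕSpan S v → ℕSpan S (u ⊞ v)
ℕSpan-⊞ {v = v} (zeroⁿ refl)        v∈ = subst (ℕSpan _) (sym (⊞-identityˡ v)) v∈
ℕSpan-⊞ {v = v} (addⁿ {u} {s} s∈ u∈ refl) v∈ = addⁿ s∈ (ℕSpan-⊞ u∈ v∈) (⊞-assoc s u v)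

ℕSpan-generator : ∀ {n} {S : Pred (V n) 0ℓ} {s} → S s → ℕSpan S s
ℕSpan-generator {s = s} s∈ = addⁿ s∈ (zeroⁿ refl) (sym (⊞-identityʳ s))

ℕSpan-bind : ∀ {n} {S T : Pred (V n) 0ℓ} → S ⊆ ℕSpan T → ℕSpan S ⊆ ℕSpan T
ℕSpan-bind f (zeroⁿ v≡0)      = zeroⁿ v≡0
ℕSpan-bind f (addⁿ s∈ u∈ refl) = ℕSpan-⊞ (f s∈) (ℕSpan-bind f u∈)

ℕSpan⇒Span : ∀ {n} {S : Pred (V n) 0ℓ} → ℕSpan S ⊆ Span S
ℕSpan⇒Span (zeroⁿ v≡0)            = zeroˢ v≡0
ℕSpan⇒Span (addⁿ {u} {s} s∈ u∈ v≡) = addˢ 1ℚ s∈ (ℕSpan⇒Span u∈) (trans v≡ (cong (_⊞ u) (sym (1∙ s))))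

Span-⊟ : ∀ {n} {S : Pred (V n) 0ℓ} {v} → Span S v → Span S (⊟ v)
Span-⊟ (zeroˢ refl) = zeroˢ (trans (sym (⊞-identityˡ _)) (⊞-inverseʳ _))
Span-⊟ (addˢ {u} {s} c s∈ u∈ refl) =
  addˢ (ℚ.- 1ℚ ℚ.* c) s∈ (Span-⊟ u∈)
    (trans (⊟-⊞ _ _) (cong (_⊞ (⊟ u)) (trans (sym (-1∙ (c ∙ s))) (∙-assoc (ℚ.- 1ℚ) c s))))

Span-⊥ : ∀ {n} {S : Pred (V n) 0ℓ} o → (∀ {s} → S s → ⟪ s , o ⟫ ≡ 0ℚ) →
         ∀ {v} → Span S v → ⟪ v , o ⟫ ≡ 0ℚ
Span-⊥ o S⊥o (zeroˢ refl) = ⟪⟫-0ˡ o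
Span-⊥ o S⊥o (addˢ {u} {s} c s∈ u∈ refl) = begin
  ⟪ (c ∙ s) ⊞ u , o ⟫               ≡⟨ ⟪⟫-⊞ˡ (c ∙ s) u o ⟩
  ⟪ c ∙ s , o ⟫ ℚ.+ ⟪ u , o ⟫       ≡⟨ cong₂ ℚ._+_ (⟪⟫-∙ˡ c s o) (Span-⊥ o S⊥o u∈) ⟩
  c ℚ.* ⟪ s , o ⟫ ℚ.+ 0ℚ            ≡⟨ ℚₚ.+-identityʳ _ ⟩
  c ℚ.* ⟪ s , o ⟫                   ≡⟨ cong (c ℚ.*_) (S⊥o s∈) ⟩
  c ℚ.* 0ℚ                          ≡⟨ ℚₚ.*-zeroʳ c ⟩
  0ℚ                                ∎
  where open ≡-Reasoning

ℕSpan-⊥ : ∀ {n} {S : Pred (V n) 0ℓ} o → (∀ {s} → S s → ⟪ s , o ⟫ ≡ 0ℚ) →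
          ∀ {v} → ℕSpan S v → ⟪ v , o ⟫ ≡ 0ℚ
ℕSpan-⊥ o S⊥o v∈ = Span-⊥ o S⊥o (ℕSpan⇒Span v∈)

ℕSpan-nonneg : ∀ {n} {S : Pred (V n) 0ℓ} o → (∀ {s} → S s → 0ℚ ℚ.≤ ⟪ s , o ⟫) →
               ∀ {v} → ℕSpan S v → 0ℚ ℚ.≤ ⟪ v , o ⟫
ℕSpan-nonneg o S≥0 (zeroⁿ refl) = ℚₚ.≤-reflexive (sym (⟪⟫-0ˡ o))
ℕSpan-nonneg o S≥0 (addⁿ {u} {s} s∈ u∈ refl) =
  subst (0ℚ ℚ.≤_) (sym (⟪⟫-⊞ˡ s u o)) (ℚₚ.+-mono-≤ (S≥0 s∈) (ℕSpan-nonneg o S≥0 u∈))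

⊞-⊟-cancel : ∀ {n} (u v : V n) → (u ⊞ v) ⊟ u ≡ v
⊞-⊟-cancel u v = trans (cong (_⊟ u) (⊞-comm u v))
  (trans (⊞-assoc v u (⊟ u)) (trans (cong (v ⊞_) (⊞-inverseʳ u)) (⊞-identityʳ v)))

⊟-⊞-cancel : ∀ {n} (u v : V n) → (u ⊟ v) ⊞ v ≡ u
⊟-⊞-cancel u v = trans (⊞-assoc u (⊟ v) v)
  (trans (cong (u ⊞_) (trans (⊞-comm (⊟ v) v) (⊞-inverseʳ v))) (⊞-identityʳ u))

-- The part of the root system axioms that separability needs; unlike the
-- axioms it is evidently inherited by the subsystems of S2 and S3.
record Good {n} (R : RootSystem n) : Set where
  field
    Φ⁺⊆Φ  : Φ⁺ R ⊆ Φ R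
    Δ⊆Φ   : Δ R ⊆ Φ R
    Φ⁺⊆ℕΔ : Φ⁺ R ⊆ ℕSpan (Δ R)
    height : ∃ λ ρ → ∀ {β} → β ∈ Φ⁺ R → 0ℚ ℚ.< ⟪ β , ρ ⟫
    dual   : ∀ {α} → α ∈ Δ R → ∃ λ o → 0ℚ ℚ.< ⟪ α , o ⟫ ×
             (∀ {δ} → δ ∈ Δ-without R α → ⟪ δ , o ⟫ ≡ 0ℚ)

open Good

-- Inheritance of `Good` by parabolic subsystems and summands

_≟ᵛ_ : ∀ {n} (u v : V n) → Dec (u ≡ v)
_≟ᵛ_ = ≡-dec ℚₚ._≟_

-- An expansion of `β` into simple roots either uses `α`, and dropping one copy of it leaves an
-- expansion of `β ⊟ α`, or it is already an expansion over the other simple roots. So a positive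
-- root belongs to the cut set of S3 at `α` or to the parabolic subsystem.
above-or-without : ∀ {n} (R : RootSystem n) α {β} → ℕSpan (Δ R) β →
                   α ≤[ R ] β ⊎ ℕSpan (Δ-without R α) β
above-or-without R α (zeroⁿ β≡0) = inj₂ (zeroⁿ β≡0)
above-or-without R α (addⁿ {u} {s} s∈ u∈ refl) with s ≟ᵛ α
... | yes refl = inj₁ (subst (ℕSpan (Δ R)) (sym (⊞-⊟-cancel s u)) u∈)
... | no s≢α with above-or-without R α u∈
...   | inj₁ α≤u = inj₁ (addⁿ s∈ α≤u (⊞-assoc s u (⊟ α)))
...   | inj₂ u∈′ = inj₂ (addⁿ (s∈ , s≢α) u∈′ refl)

module _ {n} {R : RootSystem n} (good : Good R) where

  dual-nonneg : ∀ {α} (α∈ : α ∈ Δ R) → ∀ {v} → ℕSpan (Δ R) v → 0ℚ ℚ.≤ ⟪ v , proj₁ (dual good α∈) ⟫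
  dual-nonneg {α} α∈ with dual good α∈
  ... | o , 0<α , rest = ℕSpan-nonneg o λ {s} s∈ → case s s∈
    where
    case : ∀ s → s ∈ Δ R → 0ℚ ℚ.≤ ⟪ s , o ⟫
    case s s∈ with s ≟ᵛ α
    ... | yes refl = ℚₚ.<⇒≤ 0<α
    ... | no s≢α   = ℚₚ.≤-reflexive (sym (rest (s∈ , s≢α)))

  -- Makes the two cases of `above-or-without` exclusive: the functional dual to `α` vanishes on the
  -- span of the other simple roots and is positive on everything above `α`.
  not-above : ∀ {α β} → α ∈ Δ R → Span (Δ-without R α) β → ¬ (α ≤[ R ] β)
  not-above {α} {β} α∈ β∈ α≤β = ℚₚ.<⇒≢ 0<β (sym (Span-⊥ o rest β∈))
    where
    o = proj₁ (dual good α∈)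
    0<α = proj₁ (proj₂ (dual good α∈))
    rest : ∀ {δ} → δ ∈ Δ-without R α → ⟪ δ , o ⟫ ≡ 0ℚ
    rest = proj₂ (proj₂ (dual good α∈))
    0<β : 0ℚ ℚ.< ⟪ β , o ⟫
    0<β = subst (λ v → 0ℚ ℚ.< ⟪ v , o ⟫) (⊟-⊞-cancel β α)
      (subst (0ℚ ℚ.<_) (sym (⟪⟫-⊞ˡ (β ⊟ α) α o)) (ℚₚ.+-mono-≤-< (dual-nonneg α∈ α≤β) 0<α))

  Good-parabolic : ∀ {α} → α ∈ Δ R → Good (parabolic R α)
  Good-parabolic {α} α∈ = record
    { Φ⁺⊆Φ   = λ (β∈ , β∈S) → Φ⁺⊆Φ good β∈ , β∈S
    ; Δ⊆Φ    = λ δ∈ → Δ⊆Φ good (proj₁ δ∈) , ℕSpan⇒Span (ℕSpan-generator δ∈)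
    ; Φ⁺⊆ℕΔ  = λ (β∈ , β∈S) → [ ⊥-elim ∘ not-above α∈ β∈S , (λ β∈ℕ → β∈ℕ) ]′
                                (above-or-without R α (Φ⁺⊆ℕΔ good β∈))
    ; height = proj₁ (height good) , λ (β∈ , _) → proj₂ (height good) β∈
    ; dual   = λ (δ∈ , _) → let (o , 0<δ , rest) = dual good δ∈ in
               o , 0<δ , λ ((ε∈ , _) , ε≢δ) → rest (ε∈ , ε≢δ)
    }

  module _ {k} {C : Fin k → Pred (V n) 0ℓ} (comps : Components (Φ R) C) where
    open Components comps

    -- Each simple root is a root and so lies in some component. The summands of an expansion can
    -- therefore be sorted into those in `C i` and those in other components, which are orthogonal
    -- to `C i`.
    split : ∀ i {v} → ℕSpan (Δ R) v → ∃₂ λ p q → ℕSpan (Δ R ∩ C i) p × v ≡ p ⊞ q ×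
            (∀ {c} → c ∈ C i → ⟪ c , q ⟫ ≡ 0ℚ)
    split i (zeroⁿ refl) = 0v , 0v , zeroⁿ refl , sym (⊞-identityˡ 0v) ,
                           λ {c} _ → trans (⟪⟫-comm c 0v) (⟪⟫-0ˡ c)
    split i (addⁿ {s = s} s∈ u∈ refl) with split i u∈ | proj₁ union (Δ⊆Φ good s∈)
    ... | p , q , p∈ , refl , q⊥ | j , s∈Cj with j ≟ i
    ...   | yes refl = s ⊞ p , q , addⁿ (s∈ , s∈Cj) p∈ refl , sym (⊞-assoc s p q) , q⊥
    ...   | no j≢i   = p , s ⊞ q , p∈ ,
                       trans (sym (⊞-assoc s p q)) (trans (cong (_⊞ q) (⊞-comm s p)) (⊞-assoc p s q)) ,
                       λ {c} c∈ → trans (⟪⟫-⊞ʳ c s q)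
                         (trans (cong₂ ℚ._+_ (orthogonal (j≢i ∘ sym) c∈ s∈Cj) (q⊥ c∈)) refl)

    -- The part q of β outside C i is orthogonal to both β and β ⊟ q, so it vanishes.
    summand-ℕSpan : ∀ i {β} → ℕSpan (Δ R) β → β ∈ C i → ℕSpan (Δ R ∩ C i) β
    summand-ℕSpan i β∈ β∈C with split i β∈
    ... | p , q , p∈ , refl , q⊥ = subst (ℕSpan (Δ R ∩ C i)) (sym p⊞q≡p) p∈
      where
      q≡0 : q ≡ 0v
      q≡0 = ⟪⟫-definite q (begin
        ⟪ q , q ⟫                  ≡⟨ ℚₚ.+-identityˡ _ ⟨
        0ℚ ℚ.+ ⟪ q , q ⟫           ≡⟨ cong (ℚ._+ ⟪ q , q ⟫) (ℕSpan-⊥ q (λ (_ , s∈C) → q⊥ s∈C) p∈) ⟨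
        ⟪ p , q ⟫ ℚ.+ ⟪ q , q ⟫    ≡⟨ ⟪⟫-⊞ˡ p q q ⟨
        ⟪ p ⊞ q , q ⟫              ≡⟨ q⊥ β∈C ⟩
        0ℚ                         ∎)
        where open ≡-Reasoning
      p⊞q≡p : p ⊞ q ≡ p
      p⊞q≡p = trans (cong (p ⊞_) q≡0) (⊞-identityʳ p)

    Good-summand : ∀ i → Good (summand R (C i))
    Good-summand i = record
      { Φ⁺⊆Φ   = λ (β∈ , β∈C) → Φ⁺⊆Φ good β∈ , β∈C
      ; Δ⊆Φ    = λ (δ∈ , δ∈C) → Δ⊆Φ good δ∈ , δ∈C
      ; Φ⁺⊆ℕΔ  = λ (β∈ , β∈C) → summand-ℕSpan i (Φ⁺⊆ℕΔ good β∈) β∈C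
      ; height = proj₁ (height good) , λ (β∈ , _) → proj₂ (height good) β∈
      ; dual   = λ (δ∈ , _) → let (o , 0<δ , rest) = dual good δ∈ in
                 o , 0<δ , λ ((ε∈ , _) , ε≢δ) → rest (ε∈ , ε≢δ)
      }

-- Obstructions and their survival through the recursion

Mixed : ∀ {n} → Pred (V n) 0ℓ → V n → V n → Set
Mixed S β γ = (S β × ¬ S γ) ⊎ (¬ S β × S γ)

-- Positive roots βᵢ forming a connected graph under non-orthogonality, such
-- that each βᵢ lies below a root γᵢ of their span that w treats differently.
-- A cut at α must leave all βᵢ and γᵢ in the parabolic subsystem, since
-- βᵢ ≥ α entails γᵢ ≥ α.
record Obstruction {n} (R : RootSystem n) (w : V n → V n) : Set where
  field
    size      : ℕ
    β γ δ     : Fin (suc size) → V n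
    β∈        : ∀ i → β i ∈ Φ⁺ R
    γ∈        : ∀ i → γ i ∈ Φ⁺ R
    γ≡        : ∀ i → γ i ≡ β i ⊞ δ i
    δ∈        : ∀ i → δ i ∈ ℕSpan (λ v → ∃ λ j → v ≡ β j)
    mixed     : ∀ i → Mixed (I R w) (β i) (γ i)
    connected : ∀ {k} (c : Fin (suc size) → Fin k) →
                (∀ i j → ⟪ β i , β j ⟫ ≢ 0ℚ → c i ≡ c j) → ∀ i j → c i ≡ c j

module _ {n} {R : RootSystem n} {w : V n → V n} (good : Good R) (obs : Obstruction R w) where
  open Obstruction obs

  descend : ∀ {U Δ′ w′} → IsRestriction R w (subsystem R U Δ′) w′ →
            (∀ i → β i ∈ U) → (∀ i → γ i ∈ U) → Obstruction (subsystem R U Δ′) w′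
  descend (_ , I⊆ , I⊇) β∈U γ∈U = record
    { size = size ; β = β ; γ = γ ; δ = δ
    ; β∈ = λ i → β∈ i , β∈U i ; γ∈ = λ i → γ∈ i , γ∈U i ; γ≡ = γ≡ ; δ∈ = δ∈
    ; mixed = λ i → [ (λ (b , ¬c) → inj₁ (to (β∈ i) (β∈U i) b , λ c → ¬c (proj₁ (I⊆ c))))
                    , (λ (¬b , c) → inj₂ ((λ b → ¬b (proj₁ (I⊆ b))) , to (γ∈ i) (γ∈U i) c)) ]′ (mixed i)
    ; connected = connected
    }
    where
    to : ∀ {α} → α ∈ Φ⁺ R → _ → α ∈ I R w → _
    to α∈ α∈U α∈I = I⊇ (α∈I , Φ⁺⊆Φ good α∈ , α∈U)

  ¬cut-above : ∀ {α} → (↑ R α ⊆ I R w) ⊎ IsEmpty (↑ R α ∩ I R w) → ∀ i → ¬ (α ≤[ R ] β i)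
  ¬cut-above {α} cut i α≤β = [ (λ all → [ (λ (_ , ¬c) → ¬c (all γ↑)) , (λ (¬b , _) → ¬b (all β↑)) ]′ (mixed i))
                             , (λ none → [ (λ (b , _) → none _ (β↑ , b)) , (λ (_ , c) → none _ (γ↑ , c)) ]′ (mixed i)) ]′ cut
    where
    β↑ : ↑ R α (β i)
    β↑ = β∈ i , α≤β
    α≤γ : α ≤[ R ] γ i
    α≤γ = subst (ℕSpan (Δ R))
      (trans (⊞-assoc (β i) (⊟ α) (δ i)) (trans (cong (β i ⊞_) (⊞-comm (⊟ α) (δ i)))
        (trans (sym (⊞-assoc (β i) (δ i) (⊟ α))) (cong (_⊟ α) (sym (γ≡ i))))))
      (ℕSpan-⊞ α≤β (ℕSpan-bind (λ { (j , refl) → Φ⁺⊆ℕΔ good (β∈ j) }) (δ∈ i)))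
    γ↑ : ↑ R α (γ i)
    γ↑ = γ∈ i , α≤γ

  all-in-parabolic : ∀ {α} → (↑ R α ⊆ I R w) ⊎ IsEmpty (↑ R α ∩ I R w) →
                     (∀ i → Span (Δ-without R α) (β i)) × (∀ i → Span (Δ-without R α) (γ i))
  all-in-parabolic {α} cut = (ℕSpan⇒Span ∘ β∈S) ,
      λ i → ℕSpan⇒Span (subst (ℕSpan _) (sym (γ≡ i)) (ℕSpan-⊞ (β∈S i) (ℕSpan-bind (λ { (j , refl) → β∈S j }) (δ∈ i))))
    where
    β∈S : ∀ i → ℕSpan (Δ-without R α) (β i)
    β∈S i = [ ⊥-elim ∘ ¬cut-above cut i , (λ b → b) ]′ (above-or-without R α (Φ⁺⊆ℕΔ good (β∈ i)))

  γ≢0 : ∀ i → γ i ≢ 0v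
  γ≢0 i γ≡0 = ℚₚ.<⇒≢ (proj₂ (height good) (γ∈ i))
    (sym (trans (cong (λ v → ⟪ v , proj₁ (height good) ⟫) γ≡0) (⟪⟫-0ˡ (proj₁ (height good)))))

  -- Connectedness puts all `β i` into one component. A `γ i` in a different component would be
  -- orthogonal to every `β j`; being a combination of them, it would be orthogonal to itself, hence
  -- zero.
  all-in-summand : ∀ {k} {C : Fin k → Pred (V n) 0ℓ} → Components (Φ R) C →
                   ∃ λ j → (∀ i → β i ∈ C j) × (∀ i → γ i ∈ C j)
  all-in-summand {C = C} comps = c zero , β∈C , γ∈C
    where
    open Components comps
    component : ∀ {α} → α ∈ Φ⁺ R → ∃ λ j → α ∈ C j
    component α∈ = proj₁ union (Φ⁺⊆Φ good α∈)
    c : Fin (suc size) → Fin _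
    c i = proj₁ (component (β∈ i))
    same : ∀ i j → ⟪ β i , β j ⟫ ≢ 0ℚ → c i ≡ c j
    same i j ≢0 with c i ≟ c j
    ... | yes eq = eq
    ... | no neq = ⊥-elim (≢0 (orthogonal neq (proj₂ (component (β∈ i))) (proj₂ (component (β∈ j)))))
    β∈C : ∀ i → β i ∈ C (c zero)
    β∈C i = subst (λ j → β i ∈ C j) (connected c same i zero) (proj₂ (component (β∈ i)))
    γ∈C : ∀ i → γ i ∈ C (c zero)
    γ∈C i with component (γ∈ i)
    ... | j , γ∈Cj with c zero ≟ j
    ...   | yes refl = γ∈Cj
    ...   | no neq   = ⊥-elim (γ≢0 i (⟪⟫-definite (γ i) (ℕSpan-⊥ (γ i) (λ { (l , refl) → orthogonal neq (β∈C l) γ∈Cj })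
                         (subst (ℕSpan _) (sym (γ≡ i)) (addⁿ (i , refl) (δ∈ i) refl)))))

  -- `mixed` forces `β zero` and `γ zero` to differ, whereas a system of type A₁ has a single
  -- positive root: a root and its negative cannot both have positive height.
  ¬A₁ : ¬ IsA₁ (Φ R)
  ¬A₁ (α , _ , Φ⊆ , _) = [ (λ (b , ¬c) → differ λ β≡γ → ¬c (subst (I R w) β≡γ b))
                         , (λ (¬b , c) → differ λ β≡γ → ¬b (subst (I R w) (sym β≡γ) c)) ]′ (mixed zero)
    where
    ρ = proj₁ (height good)
    opposite-⊥ : ∀ {u v} → u ∈ Φ⁺ R → v ∈ Φ⁺ R → v ≡ ⊟ u → ⊥
    opposite-⊥ {u} u∈ v∈ refl = ℚₚ.<-asym (proj₂ (height good) u∈)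
      (subst (ℚ._< 0ℚ) (trans (cong ℚ.-_ (⟪⟫-⊟ˡ u ρ)) (neg-neg ⟪ u , ρ ⟫)) (ℚₚ.neg-antimono-< (proj₂ (height good) v∈)))
    differ : β zero ≢ γ zero → ⊥
    differ β≢γ with Φ⊆ (Φ⁺⊆Φ good (β∈ zero)) | Φ⊆ (Φ⁺⊆Φ good (γ∈ zero))
    ... | inj₁ p | inj₁ q = β≢γ (trans (sym p) q)
    ... | inj₁ p | inj₂ q = opposite-⊥ (β∈ zero) (γ∈ zero) (trans (sym q) (cong ⊟_ p))
    ... | inj₂ p | inj₁ q = opposite-⊥ (γ∈ zero) (β∈ zero) (trans (sym p) (cong ⊟_ q))
    ... | inj₂ p | inj₂ q = β≢γ (trans (sym p) q)

mutual
  separable⇒unobstructed : ∀ {n} {R : RootSystem n} {w} → Good R → Separable R w → ¬ Obstruction R w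
  separable⇒unobstructed good (S0 empty) obs =
    empty _ (Φ⁺⊆Φ good (Obstruction.β∈ obs zero))
  separable⇒unobstructed good (S1 a₁) obs = ¬A₁ good obs a₁
  separable⇒unobstructed good (S2 C _ comps parts) obs with all-in-summand good obs comps
  ... | j , β∈C , γ∈C = restriction-⊥ good (Good-summand good comps j) (parts j) obs β∈C γ∈C
  separable⇒unobstructed good (S3 _ α α∈ part cut) obs =
    let (β∈S , γ∈S) = all-in-parabolic good obs cut in
    restriction-⊥ good (Good-parabolic good α∈) part obs β∈S γ∈S

  -- The common tail of S2 and S3. Opening the pair here exposes `sep` as a smaller derivation for
  -- the recursion.
  restriction-⊥ : ∀ {n} {R : RootSystem n} {w U Δ′} → Good R → Good (subsystem R U Δ′) →
    ∃[ w′ ] (IsRestriction R w (subsystem R U Δ′) w′ × Separable (subsystem R U Δ′) w′) →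
    (obs : Obstruction R w) → (∀ i → Obstruction.β obs i ∈ U) → (∀ i → Obstruction.γ obs i ∈ U) → ⊥
  restriction-⊥ good good′ (w′ , restr , sep) obs β∈U γ∈U =
    separable⇒unobstructed good′ sep (descend good obs restr β∈U γ∈U)

-- Integers among the rationals

-- Built with denominator 1 instead of by division, so that it computes: `ι (+ 0)` and `ι (+ 1)` are
-- `0ℚ` and `1ℚ` by definition.
ι : ℤ → ℚ
ι i = mkℚ i 0 (coprime-sym (1-coprimeTo ℤ.∣ i ∣))

ι-+ : ∀ i j → ι (i ℤ.+ j) ≡ ι i ℚ.+ ι j
ι-+ i j = sym (trans (cong₂ (λ a b → (a ℤ.+ b) ℚ./ 1) (ℤₚ.*-identityʳ i) (ℤₚ.*-identityʳ j))
                     (ℚₚ.↥p/↧p≡p (ι (i ℤ.+ j))))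

ι-mono-< : ∀ {i j} → i ℤ.< j → ι i ℚ.< ι j
ι-mono-< {i} {j} i<j = ℚ.*<* (subst₂ ℤ._<_ (sym (ℤₚ.*-identityʳ i)) (sym (ℤₚ.*-identityʳ j)) i<j)

ι-mono-≤ : ∀ {i j} → i ℤ.≤ j → ι i ℚ.≤ ι j
ι-mono-≤ {i} {j} i≤j = ℚ.*≤* (subst₂ ℤ._≤_ (sym (ℤₚ.*-identityʳ i)) (sym (ℤₚ.*-identityʳ j)) i≤j)

ι-cancel-< : ∀ {i j} → ι i ℚ.< ι j → i ℤ.< j
ι-cancel-< {i} {j} (ℚ.*<* p) = subst₂ ℤ._<_ (ℤₚ.*-identityʳ i) (ℤₚ.*-identityʳ j) p

-- Nondegeneracy of the form. Identities between linear maps are checked by pairing with a test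
-- vector, which turns them into identities in ℚ that the ring solver can settle.
⟪⟫-ext : ∀ {n} (a b : V n) → (∀ u → ⟪ a , u ⟫ ≡ ⟪ b , u ⟫) → a ≡ b
⟪⟫-ext a b eq = trans (sym (⊟-⊞-cancel a b)) (trans (cong (_⊞ b) a⊟b≡0) (⊞-identityˡ b))
  where
  a⊟b≡0 : a ⊟ b ≡ 0v
  a⊟b≡0 = ⟪⟫-definite (a ⊟ b)
    (trans (⟪⟫-⊞ˡ a (⊟ b) _) (trans (cong₂ ℚ._+_ (eq _) (⟪⟫-⊟ˡ b _)) (ℚₚ.+-inverseʳ ⟪ b , a ⊟ b ⟫)))

⟪e⊞e,⟫ : ∀ {n} s (i : Fin n) t j v →
         ⟪ e (s , i) ⊞ e (t , j) , v ⟫ ≡ ⟦ s ⟧ ℚ.* lookup v i ℚ.+ ⟦ t ⟧ ℚ.* lookup v j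
⟪e⊞e,⟫ s i t j v = trans (⟪⟫-⊞ˡ (e (s , i)) (e (t , j)) v) (cong₂ ℚ._+_ (⟪e,⟫ s i v) (⟪e,⟫ t j v))

⊟e : ∀ {n} (x : ±[ n ]) → ⊟ e x ≡ e (neg x)
⊟e (Sign.+ , i) = refl
⊟e (Sign.- , i) = ⊟-involutive (e (Sign.+ , i))

-- Roots of type B

-- The vector (1, ..., n), half the sum of the positive coroots. Every simple root pairs with it to
-- 1, so pairing with it is the height; and since `e x` pairs with it to `toℤ x`, it also reads off
-- the entries of a signed permutation.
ρᴮ : ∀ {n} → V n
ρᴮ = tabulate λ i → ι (+ suc (toℕ i))

⟪e,ρᴮ⟫ : ∀ {n} (x : ±[ n ]) → ⟪ e x , ρᴮ ⟫ ≡ ι (toℤ x)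
⟪e,ρᴮ⟫ (Sign.+ , i) = trans (⟪e+,⟫ i ρᴮ) (lookup∘tabulate _ i)
⟪e,ρᴮ⟫ (Sign.- , i) = trans (⟪⟫-⊟ˡ (e (Sign.+ , i)) ρᴮ) (cong ℚ.-_ (⟪e,ρᴮ⟫ (Sign.+ , i)))

1≤height : ∀ {n} {β : V n} → β ∈ Φ⁺ (B n) → 1ℚ ℚ.≤ ⟪ β , ρᴮ ⟫
1≤height (inj₁ (i , refl)) = subst (1ℚ ℚ.≤_) (sym (⟪e,ρᴮ⟫ (Sign.+ , i))) (ι-mono-≤ (ℤ.+≤+ (s≤s z≤n)))
1≤height (inj₂ (i , j , i<j , s , refl)) =
  subst (1ℚ ℚ.≤_)
    (trans (ι-+ (toℤ (s , i)) (toℤ (Sign.+ , j)))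
      (sym (trans (⟪⟫-⊞ˡ (e (s , i)) (e (Sign.+ , j)) ρᴮ) (cong₂ ℚ._+_ (⟪e,ρᴮ⟫ (s , i)) (⟪e,ρᴮ⟫ (Sign.+ , j))))))
    (ι-mono-≤ (1≤ s))
  where
  1≤ : ∀ s → + 1 ℤ.≤ toℤ (s , i) ℤ.+ toℤ (Sign.+ , j)
  1≤ Sign.+ = ℤ.+≤+ (s≤s z≤n)
  1≤ Sign.- = subst (+ 1 ℤ.≤_) (sym (ℤₚ.⊖-≥ (s≤s (ℕₚ.<⇒≤ i<j)))) (ℤ.+≤+ (ℕₚ.m<n⇒0<n∸m i<j))

0<height : ∀ {n} {β : V n} → β ∈ Φ⁺ (B n) → 0ℚ ℚ.< ⟪ β , ρᴮ ⟫
0<height β∈ = ℚₚ.<-≤-trans (ι-mono-< {+ 0} {+ 1} (ℤ.+<+ (s≤s z≤n))) (1≤height β∈)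

Φ-e : ∀ {n} (x : ±[ n ]) → e x ∈ Φ (B n)
Φ-e (s , i) = inj₁ (s , i , refl)

Φ-e⊞e : ∀ {n} (x y : ±[ n ]) → proj₂ x ≢ proj₂ y → e x ⊞ e y ∈ Φ (B n)
Φ-e⊞e (s , i) (t , j) i≢j with <-cmp i j
... | tri< i<j _ _ = inj₂ (i , j , i<j , s , t , refl)
... | tri≈ _ i≡j _ = ⊥-elim (i≢j i≡j)
... | tri> _ _ j<i = inj₂ (j , i , j<i , t , s , ⊞-comm (e (s , i)) (e (t , j)))

Φ⁺ᴮ⊆Φ : ∀ {n} → Φ⁺ (B n) ⊆ Φ (B n)
Φ⁺ᴮ⊆Φ (inj₁ (i , refl)) = inj₁ (Sign.+ , i , refl)
Φ⁺ᴮ⊆Φ (inj₂ (i , j , i<j , s , refl)) = inj₂ (i , j , i<j , s , Sign.+ , refl)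

Φᴮ-± : ∀ {n} {β : V n} → β ∈ Φ (B n) → β ∈ Φ⁺ (B n) ⊎ (⊟ β) ∈ Φ⁺ (B n)
Φᴮ-± (inj₁ (Sign.+ , i , refl)) = inj₁ (inj₁ (i , refl))
Φᴮ-± (inj₁ (Sign.- , i , refl)) = inj₂ (inj₁ (i , ⊟-involutive _))
Φᴮ-± (inj₂ (i , j , i<j , s , Sign.+ , refl)) = inj₁ (inj₂ (i , j , i<j , s , refl))
Φᴮ-± (inj₂ (i , j , i<j , s , Sign.- , refl)) =
  inj₂ (inj₂ (i , j , i<j , opposite s , trans (⊟-⊞ (e (s , i)) (e (Sign.- , j))) (cong₂ _⊞_ (⊟e (s , i)) (⊟e (Sign.- , j)))))

simple : ∀ {n} → Fin n → V n
simple zero    = e (Sign.+ , zero)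
simple (suc i) = e (Sign.- , inject₁ i) ⊞ e (Sign.+ , suc i)

inject₁<suc : ∀ {n} (i : Fin n) → inject₁ i < suc i
inject₁<suc i = s≤s (ℕₚ.≤-reflexive (toℕ-inject₁ i))

simple∈Φ⁺ : ∀ {n} (k : Fin n) → simple k ∈ Φ⁺ (B n)
simple∈Φ⁺ zero    = inj₁ (zero , refl)
simple∈Φ⁺ (suc i) = inj₂ (inject₁ i , suc i , inject₁<suc i , Sign.- , refl)

simple∈Δ : ∀ {n} (k : Fin n) → simple k ∈ Δ (B n)
simple∈Δ zero    = inj₁ (zero , refl , refl)
simple∈Δ (suc i) = inj₂ (inject₁ i , suc i , cong suc (sym (toℕ-inject₁ i)) , refl)

Δ⇒simple : ∀ {n} {α : V n} → α ∈ Δ (B n) → ∃ λ k → α ≡ simple k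
Δ⇒simple (inj₁ (zero , _ , refl)) = zero , refl
Δ⇒simple (inj₂ (i , suc j , j≡i , refl)) =
  suc j , cong (λ a → e (Sign.- , a) ⊞ e (Sign.+ , suc j))
            (toℕ-injective (trans (sym (ℕₚ.suc-injective j≡i)) (sym (toℕ-inject₁ j))))

⊟⊞-telescope : ∀ {n} (u v w : V n) → ((⊟ u) ⊞ v) ⊞ ((⊟ w) ⊞ u) ≡ (⊟ w) ⊞ v
⊟⊞-telescope []      []      []      = refl
⊟⊞-telescope (x ∷ u) (y ∷ v) (z ∷ w) = cong₂ _∷_
  (solve 3 (λ x y z → ((:- x) :+ y) :+ ((:- z) :+ x) := (:- z) :+ y) refl x y z) (⊟⊞-telescope u v w)

⊟⊞-cancel : ∀ {n} (u v : V n) → ((⊟ u) ⊞ v) ⊞ u ≡ v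
⊟⊞-cancel []      []      = refl
⊟⊞-cancel (x ∷ u) (y ∷ v) = cong₂ _∷_ (solve 2 (λ x y → ((:- x) :+ y) :+ x := y) refl x y) (⊟⊞-cancel u v)

-- The roots `eᵢ` and `eⱼ − eᵢ` are telescoping sums of consecutive simple roots, and
-- `eᵢ + eⱼ = (eⱼ − eᵢ) + eᵢ + eᵢ` accounts for the coefficients 2 of type B.
Φ⁺ᴮ⊆ℕΔ : ∀ {n} → Φ⁺ (B n) ⊆ ℕSpan (Δ (B n))
Φ⁺ᴮ⊆ℕΔ {n} (inj₁ (i , refl)) = positive i
  where
  positive : ∀ {n} (i : Fin n) → ℕSpan (Δ (B n)) (e (Sign.+ , i))
  positive {suc n} = <-weakInduction _ (ℕSpan-generator (simple∈Δ zero))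
    λ i ih → addⁿ (simple∈Δ (suc i)) ih (sym (⊟⊞-cancel (e (Sign.+ , inject₁ i)) (e (Sign.+ , suc i))))
Φ⁺ᴮ⊆ℕΔ {suc n} (inj₂ (i , j , i<j , Sign.- , refl)) = difference j i<j
  where
  difference : ∀ j → i < j → ℕSpan (Δ (B (suc n))) (e (Sign.- , i) ⊞ e (Sign.+ , j))
  difference = <-weakInduction _ (λ ()) step
    where
    step : ∀ j → (i < inject₁ j → ℕSpan _ (e (Sign.- , i) ⊞ e (Sign.+ , inject₁ j))) →
           i < suc j → ℕSpan _ (e (Sign.- , i) ⊞ e (Sign.+ , suc j))
    step j ih (s≤s i≤j) with ℕₚ.m≤n⇒m<n∨m≡n i≤j
    ... | inj₁ i<j = addⁿ (simple∈Δ (suc j)) (ih (subst (toℕ i ℕ.<_) (sym (toℕ-inject₁ j)) i<j))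
                       (sym (⊟⊞-telescope (e (Sign.+ , inject₁ j)) (e (Sign.+ , suc j)) (e (Sign.+ , i))))
    ... | inj₂ i≡j = ℕSpan-generator (subst (λ a → Δ (B (suc n)) (e (Sign.- , a) ⊞ e (Sign.+ , suc j)))
                       (toℕ-injective (trans (toℕ-inject₁ j) (sym i≡j))) (simple∈Δ (suc j)))
Φ⁺ᴮ⊆ℕΔ {suc n} (inj₂ (i , j , i<j , Sign.+ , refl)) =
  subst (ℕSpan _) (sum≡ (e (Sign.+ , i)) (e (Sign.+ , j)))
    (ℕSpan-⊞ (ℕSpan-⊞ (Φ⁺ᴮ⊆ℕΔ (inj₂ (i , j , i<j , Sign.- , refl))) eᵢ∈) eᵢ∈)
  where
  eᵢ∈ = Φ⁺ᴮ⊆ℕΔ (inj₁ (i , refl))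
  sum≡ : ∀ {n} (u v : V n) → (((⊟ u) ⊞ v) ⊞ u) ⊞ u ≡ u ⊞ v
  sum≡ u v = trans (cong (_⊞ u) (⊟⊞-cancel u v)) (⊞-comm v u)

-- The indicator of `k ≤ i`; it makes `coweight k` the fundamental coweight dual to the simple root
-- with index `k`.
step : ℕ → ℕ → ℚ
step zero    _       = 1ℚ
step (suc k) zero    = 0ℚ
step (suc k) (suc i) = step k i

step-≤ : ∀ {k i} → k ≤ i → step k i ≡ 1ℚ
step-≤ z≤n       = refl
step-≤ (s≤s k≤i) = step-≤ k≤i

step-> : ∀ {k i} → i ℕ.< k → step k i ≡ 0ℚ
step-> {suc k} {zero}  _         = refl
step-> {suc k} {suc i} (s≤s i<k) = step-> i<k

-- ⟪ β , coweight k ⟫ is the coefficient of simple k in β.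
coweight : ∀ {n} → ℕ → V n
coweight k = tabulate λ i → step k (toℕ i)

lookup-coweight : ∀ {n} k (i : Fin n) → lookup (coweight k) i ≡ step k (toℕ i)
lookup-coweight k = lookup∘tabulate _

⟪e⊞e,coweight⟫ : ∀ {n} s (i : Fin n) t j k → ⟪ e (s , i) ⊞ e (t , j) , coweight k ⟫ ≡
                 ⟦ s ⟧ ℚ.* step k (toℕ i) ℚ.+ ⟦ t ⟧ ℚ.* step k (toℕ j)
⟪e⊞e,coweight⟫ s i t j k = trans (⟪e⊞e,⟫ s i t j (coweight k))
  (cong₂ (λ a b → ⟦ s ⟧ ℚ.* a ℚ.+ ⟦ t ⟧ ℚ.* b) (lookup-coweight k i) (lookup-coweight k j))

⟪e,coweight⟫ : ∀ {n} s (i : Fin n) k → ⟪ e (s , i) , coweight k ⟫ ≡ ⟦ s ⟧ ℚ.* step k (toℕ i)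
⟪e,coweight⟫ s i k = trans (⟪e,⟫ s i (coweight k)) (cong (⟦ s ⟧ ℚ.*_) (lookup-coweight k i))

simple-coweight-same : ∀ {n} (j : Fin n) → ⟪ simple j , coweight (toℕ j) ⟫ ≡ 1ℚ
simple-coweight-same {suc n} zero = trans (⟪e,coweight⟫ {suc n} Sign.+ zero 0) refl
simple-coweight-same (suc i) = trans (⟪e⊞e,coweight⟫ Sign.- (inject₁ i) Sign.+ (suc i) (suc (toℕ i)))
  (cong₂ (λ a b → ⟦ Sign.- ⟧ ℚ.* a ℚ.+ ⟦ Sign.+ ⟧ ℚ.* b)
    (step-> {suc (toℕ i)} (inject₁<suc i)) (step-≤ {toℕ i} ℕₚ.≤-refl))

simple-coweight-other : ∀ {n} (j : Fin n) {k} → toℕ j ≢ k → ⟪ simple j , coweight k ⟫ ≡ 0ℚ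
simple-coweight-other {suc n} zero {zero}  j≢k = ⊥-elim (j≢k refl)
simple-coweight-other {suc n} zero {suc k} j≢k = trans (⟪e,coweight⟫ {suc n} Sign.+ zero (suc k)) refl
simple-coweight-other (suc i) {k} j≢k =
  trans (⟪e⊞e,coweight⟫ Sign.- (inject₁ i) Sign.+ (suc i) k)
    (trans (cong (λ a → ⟦ Sign.- ⟧ ℚ.* step k a ℚ.+ ⟦ Sign.+ ⟧ ℚ.* step k (suc (toℕ i))) (toℕ-inject₁ i)) cancel)
  where
  cancel : ⟦ Sign.- ⟧ ℚ.* step k (toℕ i) ℚ.+ ⟦ Sign.+ ⟧ ℚ.* step k (suc (toℕ i)) ≡ 0ℚ
  cancel with ℕₚ.<-cmp (suc (toℕ i)) k
  ... | tri< a _ _ = cong₂ (λ a b → ⟦ Sign.- ⟧ ℚ.* a ℚ.+ ⟦ Sign.+ ⟧ ℚ.* b) (step-> (ℕₚ.<-trans (ℕₚ.n<1+n _) a)) (step-> a)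
  ... | tri≈ _ b _ = ⊥-elim (j≢k b)
  ... | tri> _ _ (s≤s c) = cong₂ (λ a b → ⟦ Sign.- ⟧ ℚ.* a ℚ.+ ⟦ Sign.+ ⟧ ℚ.* b) (step-≤ c) (step-≤ (ℕₚ.≤-trans c (ℕₚ.n≤1+n _)))

0<1 : 0ℚ ℚ.< 1ℚ
0<1 = ι-mono-< {+ 0} {+ 1} (ℤ.+<+ (s≤s z≤n))

simple-coweight-nonneg : ∀ {n} (j : Fin n) k → 0ℚ ℚ.≤ ⟪ simple j , coweight k ⟫
simple-coweight-nonneg j k with toℕ j ℕ.≟ k
... | yes refl = subst (0ℚ ℚ.≤_) (sym (simple-coweight-same j)) (ℚₚ.<⇒≤ 0<1)
... | no j≢k   = ℚₚ.≤-reflexive (sym (simple-coweight-other j j≢k))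

Good-B : ∀ n → Good (B n)
Good-B n = record
  { Φ⁺⊆Φ   = Φ⁺ᴮ⊆Φ
  ; Δ⊆Φ    = λ α∈ → let (k , α≡) = Δ⇒simple α∈ in subst (Φ (B n)) (sym α≡) (Φ⁺ᴮ⊆Φ (simple∈Φ⁺ k))
  ; Φ⁺⊆ℕΔ  = Φ⁺ᴮ⊆ℕΔ
  ; height = ρᴮ , 0<height
  ; dual   = λ α∈ → dual′ (Δ⇒simple α∈)
  }
  where
  dual′ : ∀ {α} → (∃ λ k → α ≡ simple k) → ∃ λ o → 0ℚ ℚ.< ⟪ α , o ⟫ ×
          (∀ {δ} → δ ∈ Δ-without (B n) α → ⟪ δ , o ⟫ ≡ 0ℚ)
  dual′ (k , refl) = coweight (toℕ k) , subst (0ℚ ℚ.<_) (sym (simple-coweight-same k)) 0<1 ,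
    λ (δ∈ , δ≢α) → other (Δ⇒simple δ∈) δ≢α
    where
    other : ∀ {δ} → (∃ λ j → δ ≡ simple j) → δ ≢ simple k → ⟪ δ , coweight (toℕ k) ⟫ ≡ 0ℚ
    other (j , refl) δ≢ = simple-coweight-other j λ j≡k → δ≢ (cong simple (toℕ-injective {i = j} {j = k} j≡k))

-- Maps permuting the letters up to sign

record Signed {n} (f : V n → V n) : Set where
  field
    additive  : ∀ u v → f (u ⊞ v) ≡ f u ⊞ f v
    negation  : ∀ v → f (⊟ v) ≡ ⊟ f v
    image     : Fin n → ±[ n ]
    on-e      : ∀ i → f (e (Sign.+ , i)) ≡ e (image i)
    injective : ∀ {i j} → proj₂ (image i) ≡ proj₂ (image j) → i ≡ j

  letter : ±[ n ] → ±[ n ]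
  letter (Sign.+ , i) = image i
  letter (Sign.- , i) = neg (image i)

  proj₂-letter : ∀ s i → proj₂ (letter (s , i)) ≡ proj₂ (image i)
  proj₂-letter Sign.+ i = refl
  proj₂-letter Sign.- i = refl

  on-letter : ∀ x → f (e x) ≡ e (letter x)
  on-letter (Sign.+ , i) = on-e i
  on-letter (Sign.- , i) = trans (negation _) (trans (cong ⊟_ (on-e i)) (⊟e (image i)))

  preserves-Φ : ∀ {β} → β ∈ Φ (B n) → f β ∈ Φ (B n)
  preserves-Φ (inj₁ (s , i , refl)) = subst (Φ (B n)) (sym (on-letter (s , i))) (Φ-e (letter (s , i)))
  preserves-Φ (inj₂ (i , j , i<j , s , t , refl)) =
    subst (Φ (B n)) (sym (trans (additive _ _) (cong₂ _⊞_ (on-letter (s , i)) (on-letter (t , j)))))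
      (Φ-e⊞e (letter (s , i)) (letter (t , j)) λ eq →
        ℕₚ.<-irrefl (cong toℕ (injective (trans (sym (proj₂-letter s i)) (trans eq (proj₂-letter t j))))) i<j)

-- Describes `act w` by its adjoint. Together with `⟪⟫-ext` this gives linearity and the values on
-- the basis, and for `u = ρᴮ` the adjoint produces `values w`.
act-adjoint : ∀ {n} (w : SignedPerm n) v u →
              ⟪ act w v , u ⟫ ≡ ⟪ v , tabulate (λ i → ⟪ e (entry w i) , u ⟫) ⟫
act-adjoint w v u = trans (fold (lookup v) (e ∘ entry w))
  (cong (λ a → ⟪ a , tabulate (λ i → ⟪ e (entry w i) , u ⟫) ⟫) (tabulate∘lookup v))
  where
  fold : ∀ {m} (c : Fin m → ℚ) (b : Fin m → V _) → ⟪ foldr′ _⊞_ 0v (tabulate λ i → c i ∙ b i) , u ⟫ ≡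
         ⟪ tabulate c , tabulate (λ i → ⟪ b i , u ⟫) ⟫
  fold {zero}  c b = ⟪⟫-0ˡ u
  fold {suc m} c b = trans (⟪⟫-⊞ˡ (c zero ∙ b zero) _ u)
    (cong₂ ℚ._+_ (⟪⟫-∙ˡ (c zero) (b zero) u) (fold (c ∘ suc) (b ∘ suc)))

neg-proj₁ : ∀ {n} {x y : ±[ n ]} → proj₂ x ≡ proj₂ y → x ≡ y ⊎ x ≡ neg y
neg-proj₁ {x = Sign.+ , _} {Sign.+ , _} refl = inj₁ refl
neg-proj₁ {x = Sign.+ , _} {Sign.- , _} refl = inj₂ refl
neg-proj₁ {x = Sign.- , _} {Sign.+ , _} refl = inj₂ refl
neg-proj₁ {x = Sign.- , _} {Sign.- , _} refl = inj₁ refl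

apply-injective : ∀ {n} (w : SignedPerm n) {x y} → apply w x ≡ apply w y → x ≡ y
apply-injective w {x} {y} eq = trans (sym (strictlyInverseʳ x)) (trans (cong from eq) (strictlyInverseʳ y))
  where open Inverse (bijection w)

entry-injective : ∀ {n} (w : SignedPerm n) {i j} → proj₂ (entry w i) ≡ proj₂ (entry w j) → i ≡ j
entry-injective w {i} {j} eq with neg-proj₁ eq
... | inj₁ same = cong proj₂ (apply-injective w same)
... | inj₂ opp  = cong proj₂ (apply-injective w (trans opp (sym (odd w (Sign.+ , j)))))

Signed-act : ∀ {n} (w : SignedPerm n) → Signed (act w)
Signed-act {n} w = record
  { additive  = λ a b → ⟪⟫-ext _ _ λ u → trans (act-adjoint w (a ⊞ b) u) (trans (⟪⟫-⊞ˡ a b _)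
                  (sym (trans (⟪⟫-⊞ˡ (act w a) (act w b) u) (cong₂ ℚ._+_ (act-adjoint w a u) (act-adjoint w b u)))))
  ; negation  = λ a → ⟪⟫-ext _ _ λ u → trans (act-adjoint w (⊟ a) u) (trans (⟪⟫-⊟ˡ a _)
                  (sym (trans (⟪⟫-⊟ˡ (act w a) u) (cong ℚ.-_ (act-adjoint w a u)))))
  ; image     = entry w
  ; on-e      = λ i → ⟪⟫-ext _ _ λ u → trans (act-adjoint w (e (Sign.+ , i)) u)
                  (trans (⟪e+,⟫ i _) (lookup∘tabulate _ i))
  ; injective = entry-injective w
  }

-- Simple reflections

-- The scalar that turns `α` into its coroot: 2 for the short simple root, 1 for the long ones.
coefficient : ∀ {n} → V n → ℚ
coefficient α = (1ℚ ℚ.+ 1ℚ) ℚ.* recip ⟪ α , α ⟫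

⟪reflection,⟫ : ∀ {n} (α v u : V n) →
  ⟪ reflection α v , u ⟫ ≡ ⟪ v , u ⟫ ℚ.+ ℚ.- (coefficient α ℚ.* ⟪ v , α ⟫ ℚ.* ⟪ α , u ⟫)
⟪reflection,⟫ α v u = trans (⟪⟫-⊞ˡ v _ u) (cong (⟪ v , u ⟫ ℚ.+_) (trans (⟪⟫-⊟ˡ (k ∙ α) u) (cong ℚ.-_
  (trans (⟪⟫-∙ˡ k α u) (cong (ℚ._* ⟪ α , u ⟫)
    (solve 3 (λ t x r → t :* x :* r := t :* r :* x) refl (1ℚ ℚ.+ 1ℚ) ⟪ v , α ⟫ (recip ⟪ α , α ⟫)))))))
  where k = (1ℚ ℚ.+ 1ℚ) ℚ.* ⟪ v , α ⟫ ℚ.* recip ⟪ α , α ⟫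

module _ {n} (α : V n) where

  reflection-⊞ : ∀ u v → reflection α (u ⊞ v) ≡ reflection α u ⊞ reflection α v
  reflection-⊞ u v = ⟪⟫-ext _ _ λ z → begin
    ⟪ reflection α (u ⊞ v) , z ⟫ ≡⟨ ⟪reflection,⟫ α (u ⊞ v) z ⟩
    ⟪ u ⊞ v , z ⟫ ℚ.+ ℚ.- (coefficient α ℚ.* ⟪ u ⊞ v , α ⟫ ℚ.* ⟪ α , z ⟫)
      ≡⟨ cong₂ (λ a b → a ℚ.+ ℚ.- (coefficient α ℚ.* b ℚ.* ⟪ α , z ⟫)) (⟪⟫-⊞ˡ u v z) (⟪⟫-⊞ˡ u v α) ⟩
    (⟪ u , z ⟫ ℚ.+ ⟪ v , z ⟫) ℚ.+ ℚ.- (coefficient α ℚ.* (⟪ u , α ⟫ ℚ.+ ⟪ v , α ⟫) ℚ.* ⟪ α , z ⟫)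
      ≡⟨ solve 6 (λ p q c a b d → (p :+ q) :+ :- (c :* (a :+ b) :* d) :=
                   (p :+ :- (c :* a :* d)) :+ (q :+ :- (c :* b :* d))) refl
           ⟪ u , z ⟫ ⟪ v , z ⟫ (coefficient α) ⟪ u , α ⟫ ⟪ v , α ⟫ ⟪ α , z ⟫ ⟩
    _ ≡⟨ cong₂ ℚ._+_ (⟪reflection,⟫ α u z) (⟪reflection,⟫ α v z) ⟨
    ⟪ reflection α u , z ⟫ ℚ.+ ⟪ reflection α v , z ⟫ ≡⟨ ⟪⟫-⊞ˡ (reflection α u) (reflection α v) z ⟨
    ⟪ reflection α u ⊞ reflection α v , z ⟫ ∎
    where open ≡-Reasoning

  reflection-⊟ : ∀ v → reflection α (⊟ v) ≡ ⊟ reflection α v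
  reflection-⊟ v = ⟪⟫-ext _ _ λ z → begin
    ⟪ reflection α (⊟ v) , z ⟫ ≡⟨ ⟪reflection,⟫ α (⊟ v) z ⟩
    ⟪ ⊟ v , z ⟫ ℚ.+ ℚ.- (coefficient α ℚ.* ⟪ ⊟ v , α ⟫ ℚ.* ⟪ α , z ⟫)
      ≡⟨ cong₂ (λ a b → a ℚ.+ ℚ.- (coefficient α ℚ.* b ℚ.* ⟪ α , z ⟫)) (⟪⟫-⊟ˡ v z) (⟪⟫-⊟ˡ v α) ⟩
    (ℚ.- ⟪ v , z ⟫) ℚ.+ ℚ.- (coefficient α ℚ.* (ℚ.- ⟪ v , α ⟫) ℚ.* ⟪ α , z ⟫)
      ≡⟨ solve 4 (λ p c a d → (:- p) :+ :- (c :* (:- a) :* d) := :- (p :+ :- (c :* a :* d))) refl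
           ⟪ v , z ⟫ (coefficient α) ⟪ v , α ⟫ ⟪ α , z ⟫ ⟩
    _ ≡⟨ cong ℚ.-_ (⟪reflection,⟫ α v z) ⟨
    ℚ.- ⟪ reflection α v , z ⟫ ≡⟨ ⟪⟫-⊟ˡ (reflection α v) z ⟨
    ⟪ ⊟ reflection α v , z ⟫ ∎
    where open ≡-Reasoning

lookup-simple-suc : ∀ {n} (k : Fin n) i → lookup (simple (suc k)) i ≡
  ℚ.- lookup (e (Sign.+ , inject₁ k)) i ℚ.+ lookup (e (Sign.+ , suc k)) i
lookup-simple-suc k i = trans (lookup-zipWith ℚ._+_ i (e (Sign.- , inject₁ k)) (e (Sign.+ , suc k)))
  (cong (ℚ._+ lookup (e (Sign.+ , suc k)) i) (lookup-map i (λ x → ℚ.- x) (e (Sign.+ , inject₁ k))))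

inject₁≢suc : ∀ {n} (k : Fin n) → inject₁ k ≢ suc k
inject₁≢suc k eq = ℕₚ.<-irrefl (cong toℕ eq) (inject₁<suc k)

lookup-simple-lower : ∀ {n} (k : Fin n) → lookup (simple (suc k)) (inject₁ k) ≡ ℚ.- 1ℚ
lookup-simple-lower k = trans (lookup-simple-suc k (inject₁ k))
  (cong₂ (λ a b → ℚ.- a ℚ.+ b) (lookup-e-same (inject₁ k)) (lookup-e-other (inject₁≢suc k ∘ sym)))

lookup-simple-upper : ∀ {n} (k : Fin n) → lookup (simple (suc k)) (suc k) ≡ 1ℚ
lookup-simple-upper k = trans (lookup-simple-suc k (suc k))
  (cong₂ (λ a b → ℚ.- a ℚ.+ b) (lookup-e-other (inject₁≢suc k)) (lookup-e-same (suc k)))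

lookup-simple-other : ∀ {n} (k : Fin n) {i} → inject₁ k ≢ i → suc k ≢ i → lookup (simple (suc k)) i ≡ 0ℚ
lookup-simple-other k {i} ≢₁ ≢₂ = trans (lookup-simple-suc k i)
  (cong₂ (λ a b → ℚ.- a ℚ.+ b) (lookup-e-other ≢₁) (lookup-e-other ≢₂))

simple²-zero : ∀ {n} → ⟪ simple {suc n} zero , simple zero ⟫ ≡ 1ℚ
simple²-zero {n} = trans (⟪e+,⟫ zero (simple {suc n} zero)) (lookup-e-same {suc n} zero)

simple²-suc : ∀ {n} (k : Fin n) → ⟪ simple (suc k) , simple (suc k) ⟫ ≡ 1ℚ ℚ.+ 1ℚ
simple²-suc k = trans (⟪e⊞e,⟫ Sign.- (inject₁ k) Sign.+ (suc k) _)
  (cong₂ (λ a b → ⟦ Sign.- ⟧ ℚ.* a ℚ.+ ⟦ Sign.+ ⟧ ℚ.* b) (lookup-simple-lower k) (lookup-simple-upper k))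

coefficient-zero : ∀ {n} → coefficient (simple {suc n} zero) ≡ 1ℚ ℚ.+ 1ℚ
coefficient-zero {n} = cong (λ q → (1ℚ ℚ.+ 1ℚ) ℚ.* recip q) (simple²-zero {n})

coefficient-suc : ∀ {n} (k : Fin n) → coefficient (simple (suc k)) ≡ 1ℚ
coefficient-suc k = cong (λ q → (1ℚ ℚ.+ 1ℚ) ℚ.* recip q) (simple²-suc k)

coefficient-norm : ∀ {n} (k : Fin n) → coefficient (simple k) ℚ.* ⟪ simple k , simple k ⟫ ≡ 1ℚ ℚ.+ 1ℚ
coefficient-norm {suc n} zero = cong₂ ℚ._*_ (coefficient-zero {n}) (simple²-zero {n})
coefficient-norm (suc k) = cong₂ ℚ._*_ (coefficient-suc k) (simple²-suc k)

1≤coefficient : ∀ {n} (k : Fin n) → 1ℚ ℚ.≤ coefficient (simple k)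
1≤coefficient {suc n} zero = subst (1ℚ ℚ.≤_) (sym (coefficient-zero {n})) (ι-mono-≤ {+ 1} {+ 2} (ℤ.+≤+ (s≤s z≤n)))
1≤coefficient (suc k) = ℚₚ.≤-reflexive (sym (coefficient-suc k))

-- In coordinates, the short simple reflection changes the sign of the first basis vector (`σ`), and
-- a long one swaps two neighbouring basis vectors (`τ`).
Signed-reflection : ∀ {n} (k : Fin n) → Signed (reflection (simple k))
Signed-reflection {suc n} zero = record
  { additive = reflection-⊞ (simple zero) ; negation = reflection-⊟ (simple zero)
  ; image = σ
  ; on-e = λ i → ⟪⟫-ext _ _ λ z → trans (⟪reflection,⟫ α (e (Sign.+ , i)) z) (trans
      (cong (λ p → ⟪ e (Sign.+ , i) , z ⟫ ℚ.+ ℚ.- (p ℚ.* ⟪ α , z ⟫))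
        (cong₂ ℚ._*_ (coefficient-zero {n}) (⟪e+,⟫ i α)))
      (go i z))
  ; injective = inj
  }
  where
  α = simple {suc n} zero
  σ : Fin (suc n) → ±[ suc n ]
  σ zero    = Sign.- , zero
  σ (suc i) = Sign.+ , suc i
  inj : ∀ {i j} → proj₂ (σ i) ≡ proj₂ (σ j) → i ≡ j
  inj {zero}  {zero}  _  = refl
  inj {suc _} {suc _} eq = eq
  go : ∀ i z → ⟪ e (Sign.+ , i) , z ⟫ ℚ.+ ℚ.- ((1ℚ ℚ.+ 1ℚ) ℚ.* lookup α i ℚ.* ⟪ α , z ⟫) ≡ ⟪ e (σ i) , z ⟫
  go zero z = trans (cong (λ p → ⟪ α , z ⟫ ℚ.+ ℚ.- ((1ℚ ℚ.+ 1ℚ) ℚ.* p ℚ.* ⟪ α , z ⟫)) (lookup-e-same {suc n} zero))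
    (trans (solve 1 (λ x → x :+ :- ((con 1ℚ :+ con 1ℚ) :* con 1ℚ :* x) := :- x) refl ⟪ α , z ⟫) (sym (⟪⟫-⊟ˡ α z)))
  go (suc i) z = trans (cong (λ p → ⟪ e (Sign.+ , suc i) , z ⟫ ℚ.+ ℚ.- ((1ℚ ℚ.+ 1ℚ) ℚ.* p ℚ.* ⟪ α , z ⟫)) (lookup-e-other {suc n} {zero} {suc i} λ ()))
    (solve 2 (λ y x → y :+ :- ((con 1ℚ :+ con 1ℚ) :* con 0ℚ :* x) := y) refl ⟪ e (Sign.+ , suc i) , z ⟫ ⟪ α , z ⟫)
Signed-reflection {suc n} (suc k) = record
  { additive = reflection-⊞ α ; negation = reflection-⊟ α
  ; image = λ i → Sign.+ , τ i
  ; on-e = λ i → ⟪⟫-ext _ _ λ z → trans (⟪reflection,⟫ α (e (Sign.+ , i)) z) (trans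
      (cong₂ (λ p q → ⟪ e (Sign.+ , i) , z ⟫ ℚ.+ ℚ.- (p ℚ.* q))
        (cong₂ ℚ._*_ (coefficient-suc k) (⟪e+,⟫ i α)) (αz z))
      (go i z))
  ; injective = inj
  }
  where
  α = simple (suc k)
  a = inject₁ k
  b = Fin.suc k
  αz : ∀ z → ⟪ α , z ⟫ ≡ ℚ.- ⟪ e (Sign.+ , a) , z ⟫ ℚ.+ ⟪ e (Sign.+ , b) , z ⟫
  αz z = trans (⟪⟫-⊞ˡ (e (Sign.- , a)) (e (Sign.+ , b)) z) (cong (ℚ._+ ⟪ e (Sign.+ , b) , z ⟫) (⟪⟫-⊟ˡ (e (Sign.+ , a)) z))
  τ : Fin (suc n) → Fin (suc n)
  τ i with a ≟ i | b ≟ i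
  ... | yes _ | _     = b
  ... | no _  | yes _ = a
  ... | no _  | no _  = i
  inj : ∀ {i j} → τ i ≡ τ j → i ≡ j
  inj {i} {j} eq with a ≟ i | b ≟ i | a ≟ j | b ≟ j
  ... | yes refl | _        | yes refl | _        = refl
  ... | yes refl | _        | no _     | yes refl = ⊥-elim (inject₁≢suc k (sym eq))
  ... | yes refl | _        | no _     | no b≢j   = ⊥-elim (b≢j eq)
  ... | no _     | yes refl | yes refl | _        = ⊥-elim (inject₁≢suc k eq)
  ... | no _     | yes refl | no _     | yes refl = refl
  ... | no _     | yes refl | no a≢j   | no _     = ⊥-elim (a≢j eq)
  ... | no _     | no b≢i   | yes refl | _        = ⊥-elim (b≢i (sym eq))
  ... | no a≢i   | no _     | no _     | yes refl = ⊥-elim (a≢i (sym eq))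
  ... | no _     | no _     | no _     | no _     = eq
  go : ∀ i z → ⟪ e (Sign.+ , i) , z ⟫ ℚ.+
       ℚ.- (1ℚ ℚ.* lookup α i ℚ.* (ℚ.- ⟪ e (Sign.+ , a) , z ⟫ ℚ.+ ⟪ e (Sign.+ , b) , z ⟫)) ≡ ⟪ e (Sign.+ , τ i) , z ⟫
  go i z with a ≟ i | b ≟ i
  ... | yes refl | _ rewrite lookup-simple-lower k =
    solve 2 (λ x y → x :+ :- (con 1ℚ :* con (ℚ.- 1ℚ) :* ((:- x) :+ y)) := y) refl ⟪ e (Sign.+ , a) , z ⟫ ⟪ e (Sign.+ , b) , z ⟫
  ... | no _ | yes refl rewrite lookup-simple-upper k =
    solve 2 (λ x y → y :+ :- (con 1ℚ :* con 1ℚ :* ((:- x) :+ y)) := x) refl ⟪ e (Sign.+ , a) , z ⟫ ⟪ e (Sign.+ , b) , z ⟫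
  ... | no a≢i | no b≢i rewrite lookup-simple-other k a≢i b≢i =
    solve 3 (λ w x y → w :+ :- (con 1ℚ :* con 0ℚ :* ((:- x) :+ y)) := w) refl ⟪ e (Sign.+ , i) , z ⟫ ⟪ e (Sign.+ , a) , z ⟫ ⟪ e (Sign.+ , b) , z ⟫

-- Standard parabolic subsystems of type B

-- Indices are natural numbers, so that intervals need no bound in their type; for `k ≥ n` the
-- coweight is the zero vector and the condition is void.
Supported : ∀ {n} → Pred ℕ 0ℓ → Pred (V n) 0ℓ
Supported J v = ∀ k → ¬ J k → ⟪ v , coweight k ⟫ ≡ 0ℚ

Simple : ∀ {n} → Pred ℕ 0ℓ → Pred (V n) 0ℓ
Simple J v = ∃ λ k → J (toℕ k) × v ≡ simple k

-- R is the standard parabolic subsystem of B n on the simple roots indexed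
-- by J: a root lies in it iff its coefficients outside J vanish.
record _≅_ {n} (R : RootSystem n) (J : Pred ℕ 0ℓ) : Set where
  field
    Φ≐  : Φ R ≐ (Φ (B n) ∩ Supported J)
    Φ⁺≐ : Φ⁺ R ≐ (Φ⁺ (B n) ∩ Supported J)
    Δ≐  : Δ R ≐ Simple J

open _≅_

coweight-nonneg : ∀ {n} {v : V n} k → ℕSpan (Δ (B n)) v → 0ℚ ℚ.≤ ⟪ v , coweight k ⟫
coweight-nonneg k = ℕSpan-nonneg (coweight k) λ s∈ → let (j , s≡) = Δ⇒simple s∈ in
  subst (λ s → 0ℚ ℚ.≤ ⟪ s , coweight k ⟫) (sym s≡) (simple-coweight-nonneg j k)

module _ {J : Pred ℕ 0ℓ} (J? : Decidable J) where

  -- Nonnegative coefficients cannot cancel: if the total coefficient at `k` vanishes, then it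
  -- vanishes in every summand, so no simple root outside `J` can occur in the expansion.
  supported-ℕSpan : ∀ {n} {v : V n} → ℕSpan (Δ (B n)) v → Supported J v → ℕSpan (Simple J) v
  supported-ℕSpan (zeroⁿ v≡0) _ = zeroⁿ v≡0
  supported-ℕSpan (addⁿ {u} s∈ u∈ refl) supp with Δ⇒simple s∈
  ... | j , refl = addⁿ (j , J∋j , refl) (supported-ℕSpan u∈ λ k k∉J → proj₂ (parts k k∉J)) refl
    where
    parts : ∀ k → ¬ J k → ⟪ simple j , coweight k ⟫ ≡ 0ℚ × ⟪ u , coweight k ⟫ ≡ 0ℚ
    parts k k∉J = +-zero-split (simple-coweight-nonneg j k) (coweight-nonneg k u∈)
      (trans (sym (⟪⟫-⊞ˡ (simple j) u (coweight k))) (supp k k∉J))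
    J∋j : J (toℕ j)
    J∋j with J? (toℕ j)
    ... | yes j∈J = j∈J
    ... | no j∉J  = ⊥-elim (ℚₚ.1≢0 (trans (sym (simple-coweight-same j)) (proj₁ (parts _ j∉J))))

  Φ⁺⊆ℕSimple : ∀ {n} {R : RootSystem n} → R ≅ J → Φ⁺ R ⊆ ℕSpan (Simple J)
  Φ⁺⊆ℕSimple R≅J β∈ = let (β∈B , supp) = proj₁ (Φ⁺≐ R≅J) β∈ in supported-ℕSpan (Φ⁺ᴮ⊆ℕΔ β∈B) supp

Supported-⊟ : ∀ {n J} {v : V n} → Supported J v → Supported J (⊟ v)
Supported-⊟ {v = v} supp k k∉J = trans (⟪⟫-⊟ˡ v (coweight k)) (cong ℚ.-_ (supp k k∉J))

≅-± : ∀ {n J} {R : RootSystem n} → R ≅ J → ∀ {β} → β ∈ Φ R → β ∈ Φ⁺ R ⊎ (⊟ β) ∈ Φ⁺ R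
≅-± R≅J {β} β∈ with proj₁ (Φ≐ R≅J) β∈
... | β∈B , supp with Φᴮ-± β∈B
...   | inj₁ β∈⁺ = inj₁ (proj₂ (Φ⁺≐ R≅J) (β∈⁺ , supp))
...   | inj₂ β∈⁻ = inj₂ (proj₂ (Φ⁺≐ R≅J) (β∈⁻ , Supported-⊟ {v = β} supp))

≅-Φ⁺⊆Φ : ∀ {n J} {R : RootSystem n} → R ≅ J → Φ⁺ R ⊆ Φ R
≅-Φ⁺⊆Φ R≅J β∈ = let (β∈B , supp) = proj₁ (Φ⁺≐ R≅J) β∈ in proj₂ (Φ≐ R≅J) (Φ⁺ᴮ⊆Φ β∈B , supp)

Supported-simple : ∀ {n} {J : Pred ℕ 0ℓ} {k : Fin n} → J (toℕ k) → Supported J (simple k)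
Supported-simple {J = J} {k} k∈J l l∉J = simple-coweight-other k λ k≡l → l∉J (subst J k≡l k∈J)

≅-Δ⊆Φ : ∀ {n J} {R : RootSystem n} → R ≅ J → Δ R ⊆ Φ R
≅-Δ⊆Φ R≅J δ∈ with proj₁ (Δ≐ R≅J) δ∈
... | k , k∈J , refl = proj₂ (Φ≐ R≅J) (Φ⁺ᴮ⊆Φ (simple∈Φ⁺ k) , Supported-simple k∈J)

-- Weyl group elements with prescribed inversions

reflection-adjoint : ∀ {n} (α u v : V n) → ⟪ reflection α u , v ⟫ ≡ ⟪ u , reflection α v ⟫
reflection-adjoint α u v = trans (⟪reflection,⟫ α u v) (sym (trans (⟪⟫-comm u (reflection α v))
  (trans (⟪reflection,⟫ α v u) (trans
    (cong₂ (λ p q → p ℚ.+ ℚ.- (coefficient α ℚ.* ⟪ v , α ⟫ ℚ.* q)) (⟪⟫-comm v u) (⟪⟫-comm α u))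
    (trans (cong (λ p → ⟪ u , v ⟫ ℚ.+ ℚ.- (coefficient α ℚ.* p ℚ.* ⟪ u , α ⟫)) (⟪⟫-comm v α))
      (solve 4 (λ d c a b → d :+ :- (c :* a :* b) := d :+ :- (c :* b :* a)) refl
        ⟪ u , v ⟫ (coefficient α) ⟪ α , v ⟫ ⟪ u , α ⟫))))))

reflection-isometry : ∀ {n} (k : Fin n) u v → ⟪ reflection (simple k) u , reflection (simple k) v ⟫ ≡ ⟪ u , v ⟫
reflection-isometry k u v = begin
  ⟪ reflection α u , reflection α v ⟫
    ≡⟨ ⟪reflection,⟫ α u (reflection α v) ⟩
  ⟪ u , reflection α v ⟫ ℚ.+ ℚ.- (c ℚ.* ⟪ u , α ⟫ ℚ.* ⟪ α , reflection α v ⟫)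
    ≡⟨ cong₂ (λ p q → p ℚ.+ ℚ.- (c ℚ.* ⟪ u , α ⟫ ℚ.* q)) (expand u) (expand α) ⟩
  (⟪ v , u ⟫ ℚ.+ ℚ.- (c ℚ.* ⟪ v , α ⟫ ℚ.* ⟪ α , u ⟫)) ℚ.+
    ℚ.- (c ℚ.* ⟪ u , α ⟫ ℚ.* (⟪ v , α ⟫ ℚ.+ ℚ.- (c ℚ.* ⟪ v , α ⟫ ℚ.* ⟪ α , α ⟫)))
    ≡⟨ solve 6 (λ d c x y z a → (d :+ :- (c :* x :* y)) :+ :- (c :* z :* (x :+ :- (c :* x :* a))) :=
                  d :+ :- (c :* x :* y) :+ :- (c :* z :* x) :+ c :* z :* x :* (c :* a)) refl
         ⟪ v , u ⟫ c ⟪ v , α ⟫ ⟪ α , u ⟫ ⟪ u , α ⟫ ⟪ α , α ⟫ ⟩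
  ⟪ v , u ⟫ ℚ.+ ℚ.- (c ℚ.* ⟪ v , α ⟫ ℚ.* ⟪ α , u ⟫) ℚ.+ ℚ.- (c ℚ.* ⟪ u , α ⟫ ℚ.* ⟪ v , α ⟫)
    ℚ.+ c ℚ.* ⟪ u , α ⟫ ℚ.* ⟪ v , α ⟫ ℚ.* (c ℚ.* ⟪ α , α ⟫)
    ≡⟨ cong₂ (λ p q → ⟪ v , u ⟫ ℚ.+ ℚ.- (c ℚ.* ⟪ v , α ⟫ ℚ.* p) ℚ.+ ℚ.- (c ℚ.* ⟪ u , α ⟫ ℚ.* ⟪ v , α ⟫)
         ℚ.+ c ℚ.* ⟪ u , α ⟫ ℚ.* ⟪ v , α ⟫ ℚ.* q) (⟪⟫-comm α u) (coefficient-norm k) ⟩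
  ⟪ v , u ⟫ ℚ.+ ℚ.- (c ℚ.* ⟪ v , α ⟫ ℚ.* ⟪ u , α ⟫) ℚ.+ ℚ.- (c ℚ.* ⟪ u , α ⟫ ℚ.* ⟪ v , α ⟫)
    ℚ.+ c ℚ.* ⟪ u , α ⟫ ℚ.* ⟪ v , α ⟫ ℚ.* (1ℚ ℚ.+ 1ℚ)
    ≡⟨ solve 4 (λ d c x z → d :+ :- (c :* x :* z) :+ :- (c :* z :* x) :+ c :* z :* x :* (con 1ℚ :+ con 1ℚ) := d) refl
         ⟪ v , u ⟫ c ⟪ v , α ⟫ ⟪ u , α ⟫ ⟩
  ⟪ v , u ⟫ ≡⟨ ⟪⟫-comm v u ⟩
  ⟪ u , v ⟫ ∎
  where
  open ≡-Reasoning
  α = simple k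
  c = coefficient α
  expand : ∀ z → ⟪ z , reflection α v ⟫ ≡ ⟪ v , z ⟫ ℚ.+ ℚ.- (c ℚ.* ⟪ v , α ⟫ ℚ.* ⟪ α , z ⟫)
  expand z = trans (⟪⟫-comm z (reflection α v)) (⟪reflection,⟫ α v z)

-- Stronger than lying off all root hyperplanes: the gap of 1 around 0 gives each step towards the
-- dominant chamber a minimal length.
Generic : ∀ {n} → Pred (V n) 0ℓ
Generic x = ∀ {β} → β ∈ Φ (B _) → ⟪ β , x ⟫ ℚ.≤ ℚ.- 1ℚ ⊎ 1ℚ ℚ.≤ ⟪ β , x ⟫

-1<0 : ℚ.- 1ℚ ℚ.< 0ℚ
-1<0 = ι-mono-< { -[1+ 0 ]} {+ 0} ℤ.-<+

Generic-reflection : ∀ {n} {x : V n} (k : Fin n) → Generic x → Generic (reflection (simple k) x)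
Generic-reflection {x = x} k gen {β} β∈ =
  subst (λ q → q ℚ.≤ ℚ.- 1ℚ ⊎ 1ℚ ℚ.≤ q) (reflection-adjoint (simple k) β x)
    (gen (Signed.preserves-Φ (Signed-reflection k) β∈))

archimedean : ∀ q → ∃ λ N → q ℚ.< ι (+ N)
archimedean (mkℚ i d c) = suc ℤ.∣ i ∣ , ℚ.*<* (begin-strict
  i ℤ.* + 1                      ≡⟨ ℤₚ.*-identityʳ i ⟩
  i                              ≤⟨ i≤∣i∣ i ⟩
  + ℤ.∣ i ∣                      <⟨ ℤ.+<+ (ℕₚ.≤-trans (ℕₚ.n<1+n _) (ℕₚ.m≤m*n (suc ℤ.∣ i ∣) (suc d))) ⟩
  + (suc ℤ.∣ i ∣ ℕ.* suc d)      ≡⟨ ℤₚ.pos-* (suc ℤ.∣ i ∣) (suc d) ⟩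
  + suc ℤ.∣ i ∣ ℤ.* + suc d      ∎)
  where
  open ℤₚ.≤-Reasoning
  i≤∣i∣ : ∀ i → i ℤ.≤ + ℤ.∣ i ∣
  i≤∣i∣ (+ _)    = ℤₚ.≤-refl
  i≤∣i∣ -[1+ _ ] = ℤ.-≤+

dist² : ∀ {n} (a b : V n) → ⟪ a ⊟ b , a ⊟ b ⟫ ≡ ⟪ a , a ⟫ ℚ.+ ℚ.- (⟪ b , a ⟫ ℚ.+ ⟪ b , a ⟫) ℚ.+ ⟪ b , b ⟫
dist² a b = trans (⟪⟫-⊞ˡ a (⊟ b) (a ⊟ b)) (trans (cong₂ ℚ._+_ (expand a) (trans (⟪⟫-⊟ˡ b (a ⊟ b)) (cong ℚ.-_ (expand b))))
  (trans (cong (λ p → (⟪ a , a ⟫ ℚ.+ ℚ.- p) ℚ.+ ℚ.- (⟪ b , a ⟫ ℚ.+ ℚ.- ⟪ b , b ⟫)) (⟪⟫-comm a b))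
    (solve 3 (λ p q r → (p :+ :- q) :+ :- (q :+ :- r) := p :+ :- (q :+ q) :+ r) refl ⟪ a , a ⟫ ⟪ b , a ⟫ ⟪ b , b ⟫)))
  where
  expand : ∀ z → ⟪ z , a ⊟ b ⟫ ≡ ⟪ z , a ⟫ ℚ.+ ℚ.- ⟪ z , b ⟫
  expand z = trans (⟪⟫-⊞ʳ z a (⊟ b)) (cong (⟪ z , a ⟫ ℚ.+_) (⟪⟫-⊟ʳ z b))

dist²-shift : ∀ {n} (a x y : V n) t → ⟪ y , y ⟫ ≡ ⟪ x , x ⟫ → ⟪ y , a ⟫ ≡ ⟪ x , a ⟫ ℚ.+ ℚ.- t →
              ⟪ a ⊟ y , a ⊟ y ⟫ ≡ ⟪ a ⊟ x , a ⊟ x ⟫ ℚ.+ (t ℚ.+ t)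
dist²-shift a x y t y²≡x² ya≡ = begin
  ⟪ a ⊟ y , a ⊟ y ⟫
    ≡⟨ dist² a y ⟩
  ⟪ a , a ⟫ ℚ.+ ℚ.- (⟪ y , a ⟫ ℚ.+ ⟪ y , a ⟫) ℚ.+ ⟪ y , y ⟫
    ≡⟨ cong₂ (λ p q → ⟪ a , a ⟫ ℚ.+ ℚ.- (p ℚ.+ p) ℚ.+ q) ya≡ y²≡x² ⟩
  ⟪ a , a ⟫ ℚ.+ ℚ.- ((⟪ x , a ⟫ ℚ.+ ℚ.- t) ℚ.+ (⟪ x , a ⟫ ℚ.+ ℚ.- t)) ℚ.+ ⟪ x , x ⟫
    ≡⟨ solve 4 (λ r p t q → r :+ :- ((p :+ :- t) :+ (p :+ :- t)) :+ q := (r :+ :- (p :+ p) :+ q) :+ (t :+ t)) refl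
         ⟪ a , a ⟫ ⟪ x , a ⟫ t ⟪ x , x ⟫ ⟩
  (⟪ a , a ⟫ ℚ.+ ℚ.- (⟪ x , a ⟫ ℚ.+ ⟪ x , a ⟫) ℚ.+ ⟪ x , x ⟫) ℚ.+ (t ℚ.+ t)
    ≡⟨ cong (ℚ._+ (t ℚ.+ t)) (dist² a x) ⟨
  ⟪ a ⊟ x , a ⊟ x ⟫ ℚ.+ (t ℚ.+ t) ∎
  where open ≡-Reasoning

product≤-1 : ∀ {c p q} → 1ℚ ℚ.≤ c → p ℚ.≤ ℚ.- 1ℚ → 1ℚ ℚ.≤ q → c ℚ.* p ℚ.* q ℚ.≤ ℚ.- 1ℚ
product≤-1 {c} {p} {q} 1≤c p≤-1 1≤q =
  ℚₚ.≤-trans (ℚₚ.*-monoˡ-≤-nonPos (c ℚ.* p) {{nonpos cp≤-1}} 1≤q)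
    (subst (ℚ._≤ ℚ.- 1ℚ) (sym (ℚₚ.*-identityʳ (c ℚ.* p))) cp≤-1)
  where
  nonpos : ∀ {r} → r ℚ.≤ ℚ.- 1ℚ → ℚ.NonPositive r
  nonpos r≤ = ℚ.nonPositive (ℚₚ.≤-trans r≤ (ℚₚ.<⇒≤ -1<0))
  cp≤-1 : c ℚ.* p ℚ.≤ ℚ.- 1ℚ
  cp≤-1 = ℚₚ.≤-trans (ℚₚ.*-monoʳ-≤-nonPos p {{nonpos p≤-1}} 1≤c)
    (subst (ℚ._≤ ℚ.- 1ℚ) (sym (ℚₚ.*-identityˡ p)) p≤-1)

-- Since `x` and its reflection have equal norm, the squared distance to `a` changes by exactly
-- `t + t` with `t = coefficient α * ⟪ x , α ⟫ * ⟪ α , a ⟫`. The outer factors are at least 1 and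
-- the middle one is at most -1, so `t ≤ -1`.
closer : ∀ {n} {a α x : V n} → ⟪ reflection α x , reflection α x ⟫ ≡ ⟪ x , x ⟫ →
  1ℚ ℚ.≤ coefficient α → 1ℚ ℚ.≤ ⟪ α , a ⟫ → ⟪ α , x ⟫ ℚ.≤ ℚ.- 1ℚ →
  ⟪ a ⊟ reflection α x , a ⊟ reflection α x ⟫ ℚ.≤ ⟪ a ⊟ x , a ⊟ x ⟫ ℚ.+ ℚ.- 1ℚ
closer {a = a} {α} {x} isometry 1≤c 1≤αa αx≤-1 =
  subst (ℚ._≤ ⟪ a ⊟ x , a ⊟ x ⟫ ℚ.+ ℚ.- 1ℚ)
    (sym (dist²-shift a x (reflection α x) _ isometry (⟪reflection,⟫ α x a)))
    (ℚₚ.+-monoʳ-≤ ⟪ a ⊟ x , a ⊟ x ⟫ (ℚₚ.+-mono-≤ t≤-1 (ℚₚ.≤-trans t≤-1 (ℚₚ.<⇒≤ -1<0))))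
  where
  t≤-1 : coefficient α ℚ.* ⟪ x , α ⟫ ℚ.* ⟪ α , a ⟫ ℚ.≤ ℚ.- 1ℚ
  t≤-1 = product≤-1 1≤c (subst (ℚ._≤ ℚ.- 1ℚ) (⟪⟫-comm α x) αx≤-1) 1≤αa

dist²-reflection : ∀ {n} (k : Fin n) {x : V n} → ⟪ simple k , x ⟫ ℚ.≤ ℚ.- 1ℚ →
  ⟪ ρᴮ ⊟ reflection (simple k) x , ρᴮ ⊟ reflection (simple k) x ⟫ ℚ.≤ ⟪ ρᴮ ⊟ x , ρᴮ ⊟ x ⟫ ℚ.+ ℚ.- 1ℚ
dist²-reflection k {x} αx≤-1 =
  closer {a = ρᴮ} {simple k} {x} (reflection-isometry k x x) (1≤coefficient k) (1≤height (simple∈Φ⁺ k)) αx≤-1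

module _ {J : Pred ℕ 0ℓ} (J? : Decidable J) where

  -- Reflecting in a simple root α with ⟪ α , x ⟫ < 0 moves x closer to the
  -- dominant vector ρᴮ, by an amount bounded below since x is generic.
  make-dominant : ∀ {n} N (x : V n) → Generic x → ⟪ ρᴮ ⊟ x , ρᴮ ⊟ x ⟫ ℚ.< ι (+ N) →
    ∃ λ αs → All (Simple J) αs × (∀ {α} → Simple J α → 0ℚ ℚ.≤ ⟪ α , foldr reflection x αs ⟫)
  make-dominant zero x _ d<0 = ⊥-elim (ℚₚ.<-irrefl refl (ℚₚ.≤-<-trans (⟪⟫-nonneg (ρᴮ ⊟ x)) d<0))
  make-dominant (suc N) x gen d<N with any? (λ k → J? (toℕ k) ×-dec (⟪ simple k , x ⟫ ℚₚ.<? 0ℚ))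
  ... | no none = [] , [] , λ { (k , k∈J , refl) → ℚₚ.≮⇒≥ λ α<0 → none (k , k∈J , α<0) }
  ... | yes (k , k∈J , α<0) with gen (Φ⁺ᴮ⊆Φ (simple∈Φ⁺ k))
  ...   | inj₂ 1≤α = ⊥-elim (ℚₚ.<-irrefl refl (ℚₚ.<-trans (ℚₚ.<-≤-trans 0<1 1≤α) α<0))
  ...   | inj₁ α≤-1 = let (αs , αs∈ , dom) = make-dominant N x′ (Generic-reflection k gen) d′<N in
      -- `foldr` applies the last root of the list first, so the reflection just performed on `x`
      -- goes to the end.
      αs ∷ʳ simple k , ∷ʳ⁺ αs∈ (k , k∈J , refl) ,
      λ {α} α∈ → subst (λ v → 0ℚ ℚ.≤ ⟪ α , v ⟫) (sym (foldr-∷ʳ reflection x (simple k) αs)) (dom α∈)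
    where
    x′ = reflection (simple k) x
    d′<N : ⟪ ρᴮ ⊟ x′ , ρᴮ ⊟ x′ ⟫ ℚ.< ι (+ N)
    d′<N = ℚₚ.≤-<-trans (dist²-reflection k α≤-1)
      (subst (⟪ ρᴮ ⊟ x , ρᴮ ⊟ x ⟫ ℚ.+ ℚ.- 1ℚ ℚ.<_) (sym (ι-+ (+ suc N) -[1+ 0 ])) (ℚₚ.+-monoˡ-< (ℚ.- 1ℚ) d<N))

  word-isometry : ∀ {n} {αs : List (V n)} → All (Simple J) αs → ∀ u v →
                  ⟪ foldr reflection u αs , foldr reflection v αs ⟫ ≡ ⟪ u , v ⟫
  word-isometry [] u v = refl
  word-isometry {αs = _ ∷ αs} ((k , _ , refl) ∷ αs∈) u v =
    trans (reflection-isometry k (foldr reflection u αs) (foldr reflection v αs)) (word-isometry αs∈ u v)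

  word-Φ : ∀ {n} {αs : List (V n)} → All (Simple J) αs → ∀ {β} → β ∈ Φ (B n) → foldr reflection β αs ∈ Φ (B n)
  word-Φ [] β∈ = β∈
  word-Φ ((k , _ , refl) ∷ αs∈) β∈ = Signed.preserves-Φ (Signed-reflection k) (word-Φ αs∈ β∈)

  word-supported : ∀ {n} {αs : List (V n)} → All (Simple J) αs → ∀ {β} → Supported J β → Supported J (foldr reflection β αs)
  word-supported [] supp = supp
  word-supported {αs = _ ∷ αs} ((k , k∈J , refl) ∷ αs∈) {β} supp l l∉J = begin
    ⟪ reflection (simple k) v , coweight l ⟫ ≡⟨ ⟪reflection,⟫ (simple k) v (coweight l) ⟩
    ⟪ v , coweight l ⟫ ℚ.+ ℚ.- (q ℚ.* ⟪ simple k , coweight l ⟫)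
      ≡⟨ cong₂ (λ a b → a ℚ.+ ℚ.- (q ℚ.* b)) (word-supported αs∈ supp l l∉J) (Supported-simple {J = J} k∈J l l∉J) ⟩
    0ℚ ℚ.+ ℚ.- (q ℚ.* 0ℚ) ≡⟨ solve 1 (λ q → con 0ℚ :+ :- (q :* con 0ℚ) := con 0ℚ) refl q ⟩
    0ℚ ∎
    where
    open ≡-Reasoning
    v = foldr reflection β αs
    q = coefficient (simple k) ℚ.* ⟪ v , simple k ⟫

-- Encodes the inversion set of `f` by a vector `x`. As `R` enters only through its positive roots,
-- the same `x` serves for `R` and for its subsystems, and `f′` restricts `f` as soon as both
-- satisfy this and `f′` lies in the Weyl group of the subsystem.
InvertsAt : ∀ {n} → RootSystem n → (V n → V n) → V n → Set
InvertsAt R f x = ∀ β → β ∈ Φ⁺ R → ((⊟ f β) ∈ Φ⁺ R → ⟪ β , x ⟫ ℚ.< 0ℚ) × (⟪ β , x ⟫ ℚ.< 0ℚ → (⊟ f β) ∈ Φ⁺ R)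

Generic-≤0 : ∀ {n} {x : V n} → Generic x → ∀ {β} → β ∈ Φ (B n) → ⟪ β , x ⟫ ℚ.≤ 0ℚ → ⟪ β , x ⟫ ℚ.< 0ℚ
Generic-≤0 gen β∈ β≤0 with gen β∈
... | inj₁ β≤-1 = ℚₚ.≤-<-trans β≤-1 -1<0
... | inj₂ 1≤β  = ⊥-elim (ℚₚ.<-irrefl refl (ℚₚ.<-≤-trans 0<1 (ℚₚ.≤-trans 1≤β β≤0)))

-- As f is orthogonal and f x dominant, ⟪ β , x ⟫ = ⟪ f β , f x ⟫ has the sign of f β.
dominant-inverts : ∀ {n J} → Decidable J → {R : RootSystem n} → R ≅ J → ∀ {x} → Generic x →
  ∀ {αs} → All (Simple J) αs → (∀ {α} → Simple J α → 0ℚ ℚ.≤ ⟪ α , foldr reflection x αs ⟫) →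
  InvertsAt R (λ v → foldr reflection v αs) x
dominant-inverts {n} {J} J? {R} R≅J {x} gen {αs} αs∈ dom β β∈ = negative , positive
  where
  f : V n → V n
  f v = foldr reflection v αs
  isometry : ⟪ f β , f x ⟫ ≡ ⟪ β , x ⟫
  isometry = word-isometry J? αs∈ β x
  Φ⁺-nonneg : ∀ {γ} → γ ∈ Φ⁺ R → 0ℚ ℚ.≤ ⟪ γ , f x ⟫
  Φ⁺-nonneg γ∈ = ℕSpan-nonneg (f x) dom (Φ⁺⊆ℕSimple J? R≅J γ∈)
  negative : (⊟ f β) ∈ Φ⁺ R → ⟪ β , x ⟫ ℚ.< 0ℚ
  negative ⊟fβ∈ = Generic-≤0 gen (Φ⁺ᴮ⊆Φ (proj₁ (proj₁ (Φ⁺≐ R≅J) β∈)))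
    (subst (ℚ._≤ 0ℚ) (trans (neg-neg ⟪ f β , f x ⟫) isometry)
      (ℚₚ.neg-antimono-≤ (subst (0ℚ ℚ.≤_) (⟪⟫-⊟ˡ (f β) (f x)) (Φ⁺-nonneg ⊟fβ∈))))
  positive : ⟪ β , x ⟫ ℚ.< 0ℚ → (⊟ f β) ∈ Φ⁺ R
  positive β<0 = [ (λ fβ∈ → ⊥-elim (ℚₚ.<-irrefl refl (ℚₚ.≤-<-trans
        (subst (0ℚ ℚ.≤_) isometry (Φ⁺-nonneg fβ∈)) β<0))) , (λ ⊟fβ∈ → ⊟fβ∈) ]′ (≅-± R≅J fβ∈Φ)
    where
    fβ∈Φ : f β ∈ Φ R
    fβ∈Φ = let (β∈B , supp) = proj₁ (Φ≐ R≅J) (≅-Φ⁺⊆Φ R≅J β∈) in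
      proj₂ (Φ≐ R≅J) (word-Φ J? αs∈ β∈B , word-supported J? αs∈ supp)

weyl-element : ∀ {n J} → Decidable J → {R : RootSystem n} → R ≅ J → ∀ {x} → Generic x → ∃ λ f → W R f × InvertsAt R f x
weyl-element {n} {J} J? {R} R≅J {x} gen with archimedean ⟪ ρᴮ ⊟ x , ρᴮ ⊟ x ⟫
... | N , d<N with make-dominant J? N x gen d<N
...   | αs , αs∈ , dom = (λ v → foldr reflection v αs) ,
        (αs , All.map (λ α∈ → ≅-Δ⊆Φ R≅J (proj₂ (Δ≐ R≅J) α∈)) αs∈ , λ _ → refl) ,
        dominant-inverts J? R≅J {x} gen αs∈ dom

inversions : ∀ {n} {R : RootSystem n} {f f′ x U Δ′} → Φ⁺ R ⊆ Φ R → InvertsAt R f x →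
  InvertsAt (subsystem R U Δ′) f′ x → I (subsystem R U Δ′) f′ ≐ (I R f ∩ Φ (subsystem R U Δ′))
inversions {R = R} {f} {f′} {x} {U} {Δ′} Φ⁺⊆Φ inv inv′ = (λ {β} → to β) , (λ {β} → from β)
  where
  R′ = subsystem R U Δ′
  to : ∀ β → β ∈ I R′ f′ → β ∈ (I R f ∩ Φ R′)
  to β (β∈ , ⊟f′β∈) = (proj₁ β∈ , proj₂ (inv β (proj₁ β∈)) (proj₁ (inv′ β β∈) ⊟f′β∈)) , Φ⁺⊆Φ (proj₁ β∈) , proj₂ β∈
  from : ∀ β → β ∈ (I R f ∩ Φ R′) → β ∈ I R′ f′
  from β ((β∈R , ⊟fβ∈) , (_ , β∈U)) = (β∈R , β∈U) , proj₂ (inv′ β (β∈R , β∈U)) (proj₁ (inv β β∈R) ⊟fβ∈)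

restriction : ∀ {n J′} {R : RootSystem n} {f x U Δ′} → Decidable J′ → Φ⁺ R ⊆ Φ R → subsystem R U Δ′ ≅ J′ →
  Generic x → InvertsAt R f x →
  ∃ λ f′ → IsRestriction R f (subsystem R U Δ′) f′ × InvertsAt (subsystem R U Δ′) f′ x
restriction {n} {J′} {R} {f} {x} {U} {Δ′} J′? Φ⁺⊆Φ R′≅J′ gen inv = result (weyl-element J′? R′≅J′ {x} gen)
  where
  R′ = subsystem R U Δ′
  result : (∃ λ f′ → W R′ f′ × InvertsAt R′ f′ x) → ∃ λ f′ → IsRestriction R f R′ f′ × InvertsAt R′ f′ x
  result (f′ , f′∈W , inv′) = f′ , (f′∈W , inversions {R = R} {f} {f′} {x} {U} {Δ′} Φ⁺⊆Φ inv inv′) , inv′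

open _≅_

-- Subsystems on intervals of simple roots

Interval : ℕ → ℕ → Pred ℕ 0ℓ
Interval a b k = a ≤ k × k ℕ.< b

Without : Pred ℕ 0ℓ → ℕ → Pred ℕ 0ℓ
Without J g k = J k × k ≢ g

interval? : ∀ a b → Decidable (Interval a b)
interval? a b k = (a ℕₚ.≤? k) ×-dec (k ℕₚ.<? b)

without? : ∀ {J} → Decidable J → ∀ g → Decidable (Without J g)
without? J? g k = J? k ×-dec ¬? (k ℕ.≟ g)

Supported-⊆ : ∀ {n} {J J′ : Pred ℕ 0ℓ} → J ⊆ J′ → {v : V n} → Supported J v → Supported J′ v
Supported-⊆ J⊆J′ supp k k∉J′ = supp k λ k∈J → k∉J′ (J⊆J′ k∈J)

≅-resp-≐ : ∀ {n} {R : RootSystem n} {J J′ : Pred ℕ 0ℓ} → J ≐ J′ → R ≅ J → R ≅ J′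
≅-resp-≐ {n} {R} {J} {J′} (J⊆ , J⊇) R≅J = record
  { Φ≐  = (λ {v} v∈ → let (v∈B , supp) = proj₁ (Φ≐ R≅J) v∈ in v∈B , Supported-⊆ {J = J} {J′} J⊆ {v} supp)
        , (λ {v} (v∈B , supp) → proj₂ (Φ≐ R≅J) (v∈B , Supported-⊆ {J = J′} {J} J⊇ {v} supp))
  ; Φ⁺≐ = (λ {v} v∈ → let (v∈B , supp) = proj₁ (Φ⁺≐ R≅J) v∈ in v∈B , Supported-⊆ {J = J} {J′} J⊆ {v} supp)
        , (λ {v} (v∈B , supp) → proj₂ (Φ⁺≐ R≅J) (v∈B , Supported-⊆ {J = J′} {J} J⊇ {v} supp))
  ; Δ≐  = (λ δ∈ → let (k , k∈ , δ≡) = proj₁ (Δ≐ R≅J) δ∈ in k , J⊆ k∈ , δ≡)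
        , (λ (k , k∈ , δ≡) → proj₂ (Δ≐ R≅J) (k , J⊇ k∈ , δ≡))
  }

Φ-Span : ∀ {n J} → Decidable J → {v : V n} → v ∈ Φ (B n) → Supported J v → Span (Simple J) v
Φ-Span J? {v} v∈ supp with Φᴮ-± v∈
... | inj₁ v∈⁺ = ℕSpan⇒Span (supported-ℕSpan J? (Φ⁺ᴮ⊆ℕΔ v∈⁺) supp)
... | inj₂ v∈⁻ = subst (Span _) (⊟-involutive v)
                   (Span-⊟ (ℕSpan⇒Span (supported-ℕSpan J? (Φ⁺ᴮ⊆ℕΔ v∈⁻) (Supported-⊟ {v = v} supp))))

simple-injective : ∀ {n} {j k : Fin n} → simple j ≡ simple k → j ≡ k
simple-injective {j = j} {k} eq with j ≟ k
... | yes j≡k = j≡k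
... | no j≢k  = ⊥-elim (ℚₚ.1≢0 (trans (sym (simple-coweight-same k))
    (trans (cong (λ v → ⟪ v , coweight (toℕ k) ⟫) (sym eq)) (simple-coweight-other j (j≢k ∘ toℕ-injective)))))

parabolic-≅ : ∀ {n J} → Decidable J → {R : RootSystem n} → R ≅ J → ∀ g →
              parabolic R (simple g) ≅ Without J (toℕ g)
parabolic-≅ {n} {J} J? {R} R≅J g = record
  { Φ≐  = (λ {v} (v∈ , v∈S) → proj₁ (proj₁ (Φ≐ R≅J) v∈) , supported v∈S)
        , (λ {v} (v∈B , supp) → proj₂ (Φ≐ R≅J) (v∈B , weaken v supp) , spanned v∈B supp)
  ; Φ⁺≐ = (λ {v} (v∈ , v∈S) → proj₁ (proj₁ (Φ⁺≐ R≅J) v∈) , supported v∈S)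
        , (λ {v} (v∈B , supp) → proj₂ (Φ⁺≐ R≅J) (v∈B , weaken v supp) , spanned (Φ⁺ᴮ⊆Φ v∈B) supp)
  ; Δ≐  = Δ⇒ , ⇒Δ
  }
  where
  J′ = Without J (toℕ g)
  Δ⇒ : ∀ {δ} → Δ-without R (simple g) δ → Simple J′ δ
  Δ⇒ (δ∈ , δ≢) with proj₁ (Δ≐ R≅J) δ∈
  ... | k , k∈J , refl = k , (k∈J , λ k≡g → δ≢ (cong simple (toℕ-injective {i = k} {j = g} k≡g))) , refl
  ⇒Δ : ∀ {δ} → Simple J′ δ → Δ-without R (simple g) δ
  ⇒Δ (k , (k∈J , k≢g) , refl) = proj₂ (Δ≐ R≅J) (k , k∈J , refl) , λ eq → k≢g (cong toℕ (simple-injective {j = k} {g} eq))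
  weaken : ∀ v → Supported J′ v → Supported J v
  weaken v = Supported-⊆ {J = J′} {J} proj₁ {v}
  supported : ∀ {v} → Span (Δ-without R (simple g)) v → Supported J′ v
  supported v∈S k k∉J′ = Span-⊥ (coweight k) (λ δ∈ → vanish (Δ⇒ δ∈)) v∈S
    where
    vanish : ∀ {δ} → Simple J′ δ → ⟪ δ , coweight k ⟫ ≡ 0ℚ
    vanish (j , j∈J′ , refl) = Supported-simple {J = J′} j∈J′ k k∉J′
  map-Span : ∀ {S T : Pred (V n) 0ℓ} → S ⊆ T → Span S ⊆ Span T
  map-Span S⊆T (zeroˢ eq)         = zeroˢ eq
  map-Span S⊆T (addˢ c s∈ u∈ eq) = addˢ c (S⊆T s∈) (map-Span S⊆T u∈) eq
  spanned : ∀ {v} → v ∈ Φ (B n) → Supported J′ v → Span (Δ-without R (simple g)) v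
  spanned v∈B supp = map-Span ⇒Δ (Φ-Span (without? J? (toℕ g)) v∈B supp)

Φ⟨_⟩ : ∀ {n} → Pred ℕ 0ℓ → Pred (V n) 0ℓ
Φ⟨_⟩ {n} J = Φ (B n) ∩ Supported J

summand-≅ : ∀ {n J J′} → Decidable J′ → J′ ⊆ J → {R : RootSystem n} → R ≅ J → summand R Φ⟨ J′ ⟩ ≅ J′
summand-≅ {n} {J} {J′} J′? J′⊆J {R} R≅J = record
  { Φ≐  = proj₂ , λ {v} v∈@(v∈B , supp) → proj₂ (Φ≐ R≅J) (v∈B , weaken v supp) , v∈
  ; Φ⁺≐ = (λ (v∈ , _ , supp) → proj₁ (proj₁ (Φ⁺≐ R≅J) v∈) , supp)
        , (λ {v} (v∈B , supp) → proj₂ (Φ⁺≐ R≅J) (v∈B , weaken v supp) , Φ⁺ᴮ⊆Φ v∈B , supp)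
  ; Δ≐  = Δ⇒ , ⇒Δ
  }
  where
  weaken : ∀ v → Supported J′ v → Supported J v
  weaken v = Supported-⊆ {J = J′} {J} J′⊆J {v}
  Δ⇒ : ∀ {δ} → δ ∈ (Δ R ∩ Φ⟨ J′ ⟩) → Simple J′ δ
  Δ⇒ (δ∈ , _ , supp) with proj₁ (Δ≐ R≅J) δ∈
  ... | k , _ , refl with J′? (toℕ k)
  ...   | yes k∈J′ = k , k∈J′ , refl
  ...   | no k∉J′  = ⊥-elim (ℚₚ.1≢0 (trans (sym (simple-coweight-same k)) (supp (toℕ k) k∉J′)))
  ⇒Δ : ∀ {δ} → Simple J′ δ → δ ∈ (Δ R ∩ Φ⟨ J′ ⟩)
  ⇒Δ (k , k∈J′ , refl) = proj₂ (Δ≐ R≅J) (k , J′⊆J k∈J′ , refl) , Φ⁺ᴮ⊆Φ (simple∈Φ⁺ k) , Supported-simple {J = J′} k∈J′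

Φᴮ≢0 : ∀ {n} {v : V n} → v ∈ Φ (B n) → ⟪ v , v ⟫ ≢ 0ℚ
Φᴮ≢0 {n} {v} v∈ v²≡0 with ⟪⟫-definite v v²≡0 | Φᴮ-± v∈
... | refl | inj₁ 0∈ = ℚₚ.<⇒≢ (0<height 0∈) (sym (⟪⟫-0ˡ (ρᴮ {n})))
... | refl | inj₂ 0∈ = ℚₚ.<⇒≢ (0<height 0∈) (sym (trans (⟪⟫-⊟ˡ (0v {n}) ρᴮ) (cong ℚ.-_ (⟪⟫-0ˡ (ρᴮ {n})))))

lookup-simple-same : ∀ {n} (j : Fin n) → lookup (simple j) j ≡ 1ℚ
lookup-simple-same {suc n} zero = lookup-e-same {suc n} zero
lookup-simple-same (suc j)      = lookup-simple-upper j

lookup-simple-above : ∀ {n} (j : Fin n) {i} → j < i → lookup (simple j) i ≡ 0ℚ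
lookup-simple-above {suc n} zero {suc i} _   = lookup-e-other {suc n} {zero} {suc i} λ ()
lookup-simple-above (suc j) {i}     j<i = lookup-simple-other j
  (λ eq → ℕₚ.<-irrefl (trans (sym (toℕ-inject₁ j)) (cong toℕ eq)) (ℕₚ.<-trans (ℕₚ.n<1+n _) j<i))
  (λ eq → ℕₚ.<-irrefl (cong toℕ eq) j<i)

⟪simple-suc,⟫ : ∀ {n} (k : Fin n) v → ⟪ simple (suc k) , v ⟫ ≡ ⟦ Sign.- ⟧ ℚ.* lookup v (inject₁ k) ℚ.+ ⟦ Sign.+ ⟧ ℚ.* lookup v (suc k)
⟪simple-suc,⟫ k = ⟪e⊞e,⟫ Sign.- (inject₁ k) Sign.+ (suc k)

-- The value is -1 also at the double bond, where the pairing is `⟪ e₂ − e₁ , e₁ ⟫`, so root lengths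
-- call for no case distinction.
simple-adjacent : ∀ {n} (k : Fin n) → ⟪ simple (suc k) , simple (inject₁ k) ⟫ ≡ ℚ.- 1ℚ
simple-adjacent k = trans (⟪simple-suc,⟫ k (simple (inject₁ k)))
  (cong₂ (λ a b → ⟦ Sign.- ⟧ ℚ.* a ℚ.+ ⟦ Sign.+ ⟧ ℚ.* b)
    (lookup-simple-same (inject₁ k)) (lookup-simple-above (inject₁ k) (inject₁<suc k)))

simple-distant : ∀ {n} (i j : Fin n) → suc (toℕ i) ℕ.< toℕ j → ⟪ simple i , simple j ⟫ ≡ 0ℚ
simple-distant i (suc k) (s≤s i<k) = trans (⟪⟫-comm (simple i) (simple (suc k))) (trans (⟪simple-suc,⟫ k (simple i))
  (cong₂ (λ a b → ⟦ Sign.- ⟧ ℚ.* a ℚ.+ ⟦ Sign.+ ⟧ ℚ.* b)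
    (lookup-simple-above i (subst (toℕ i ℕ.<_) (sym (toℕ-inject₁ k)) i<k))
    (lookup-simple-above i (ℕₚ.<-trans i<k (ℕₚ.n<1+n _)))))

-- The Dynkin diagram of an interval is connected.
simples-together : ∀ {n a b} {A C : Pred (V n) 0ℓ} → A ⟂ C → (∀ k → Interval a b (toℕ k) → simple k ∈ A ⊎ simple k ∈ C) →
  (∀ k → toℕ k ≡ a → simple k ∈ A) → ∀ k → a ≤ toℕ k → toℕ k ℕ.< b → simple k ∈ A
simples-together {suc n} {a} {b} {A} {C} A⟂C cover start = <-weakInduction _ (λ a≤0 _ → start zero (sym (ℕₚ.n≤0⇒n≡0 a≤0))) next
  where
  next : ∀ k → (a ≤ toℕ (inject₁ k) → toℕ (inject₁ k) ℕ.< b → simple (inject₁ k) ∈ A) →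
         a ≤ suc (toℕ k) → suc (toℕ k) ℕ.< b → simple (suc k) ∈ A
  next k ih a≤ k<b with ℕₚ.m≤n⇒m<n∨m≡n a≤
  ... | inj₂ a≡ = start (suc k) (sym a≡)
  ... | inj₁ (s≤s a≤k) with cover (suc k) (a≤ , k<b)
  ...   | inj₁ ∈A = ∈A
  ...   | inj₂ ∈C = ⊥-elim (contra (trans (sym (simple-adjacent k)) (trans (⟪⟫-comm (simple (suc k)) (simple (inject₁ k)))
            (A⟂C (ih (subst (a ≤_) (sym (toℕ-inject₁ k)) a≤k)
                     (subst (ℕ._< b) (sym (toℕ-inject₁ k)) (ℕₚ.<-trans (ℕₚ.n<1+n _) k<b))) ∈C))))
    where
    contra : ℚ.- 1ℚ ≢ 0ℚ
    contra ()

-- Of two orthogonal parts, the one containing the first simple root contains them all, by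
-- connectedness of the diagram. A root in the other part would be orthogonal to the simple roots
-- that span it, hence to itself.
interval-irreducible : ∀ {n a b} → a ℕ.< b → b ≤ n → {S : Pred (V n) 0ℓ} → S ≐ Φ⟨ Interval a b ⟩ → Irreducible S
interval-irreducible {n} {a} {b} a<b b≤n {S} (S⊆ , S⊇) = (simple a′ , simple∈S a′ a′∈) , no-split
  where
  a′ : Fin n
  a′ = fromℕ< (ℕₚ.<-≤-trans a<b b≤n)
  a′≡a : toℕ a′ ≡ a
  a′≡a = toℕ-fromℕ< _
  a′∈ : Interval a b (toℕ a′)
  a′∈ = subst (Interval a b) (sym a′≡a) (ℕₚ.≤-refl , a<b)
  simple∈S : ∀ k → Interval a b (toℕ k) → simple k ∈ S
  simple∈S k k∈ = S⊇ (Φ⁺ᴮ⊆Φ (simple∈Φ⁺ k) , Supported-simple {J = Interval a b} k∈)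
  absurd : ∀ {A C : Pred (V n) 0ℓ} → (S ⊆ (A ∪ C)) → C ⊆ S → A ⟂ C → simple a′ ∈ A → ∀ v → v ∈ C → ⊥
  absurd {A} {C} cover C⊆S A⟂C a′∈A v v∈C = Φᴮ≢0 v∈Φ (Span-⊥ v vanish (Φ-Span (interval? a b) v∈Φ supp))
    where
    v∈Φ = proj₁ (S⊆ (C⊆S v∈C))
    supp = proj₂ (S⊆ (C⊆S v∈C))
    vanish : ∀ {s} → Simple (Interval a b) s → ⟪ s , v ⟫ ≡ 0ℚ
    vanish (k , (a≤k , k<b) , refl) = A⟂C (simples-together {a = a} {b} {A} {C} A⟂C (λ k k∈ → cover (simple∈S k k∈))
      (λ k k≡a → subst (λ j → simple j ∈ A) (toℕ-injective {i = a′} {j = k} (trans a′≡a (sym k≡a))) a′∈A) k a≤k k<b) v∈C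
  no-split : ∀ A C → Satisfiable A → Satisfiable C → S ≐ (A ∪ C) → ¬ (A ⟂ C)
  no-split A C (u , u∈A) (v , v∈C) (S⊆A∪C , A∪C⊆S) A⟂C with S⊆A∪C (simple∈S a′ a′∈)
  ... | inj₁ ∈A = absurd {A} {C} S⊆A∪C (λ c∈ → A∪C⊆S (inj₂ c∈)) A⟂C ∈A v v∈C
  ... | inj₂ ∈C = absurd {C} {A} (λ s∈ → swap (S⊆A∪C s∈)) (λ c∈ → A∪C⊆S (inj₁ c∈))
                    (λ {α} {β} α∈ β∈ → trans (⟪⟫-comm α β) (A⟂C β∈ α∈)) ∈C u u∈A

⟦⟧≢0 : ∀ s → ⟦ s ⟧ ℚ.* 1ℚ ≢ 0ℚ
⟦⟧≢0 Sign.+ ()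
⟦⟧≢0 Sign.- ()

-- For a root on positions `i < j`, the coefficient at `k` is constant for `k ≤ i`, equals the sign
-- `t` for `i < k ≤ j` and is zero afterwards. A zero at `g` thus spreads to one whole side, and
-- after deleting `g` the root lives on one of the two remaining intervals.
root-support : ∀ {n} {v : V n} → v ∈ Φ (B n) → ∀ g → ⟪ v , coweight g ⟫ ≡ 0ℚ →
  (∀ k → k ≤ g → ⟪ v , coweight k ⟫ ≡ 0ℚ) ⊎ (∀ k → g ≤ k → ⟪ v , coweight k ⟫ ≡ 0ℚ)
root-support (inj₁ (s , i , refl)) g ≡0 with g ℕₚ.≤? toℕ i
... | yes g≤i = ⊥-elim (⟦⟧≢0 s (trans (sym (trans (⟪e,coweight⟫ s i g) (cong (⟦ s ⟧ ℚ.*_) (step-≤ g≤i)))) ≡0))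
... | no g≰i  = inj₂ λ k g≤k → trans (⟪e,coweight⟫ s i k)
    (trans (cong (⟦ s ⟧ ℚ.*_) (step-> (ℕₚ.<-≤-trans (ℕₚ.≰⇒> g≰i) g≤k))) (ℚₚ.*-zeroʳ ⟦ s ⟧))
root-support (inj₂ (i , j , i<j , s , t , refl)) g ≡0 with g ℕₚ.≤? toℕ i | g ℕₚ.≤? toℕ j
... | yes g≤i | _ = inj₁ λ k k≤g → trans (⟪e⊞e,coweight⟫ s i t j k)
    (trans (cong₂ (λ a b → ⟦ s ⟧ ℚ.* a ℚ.+ ⟦ t ⟧ ℚ.* b)
      (trans (step-≤ (ℕₚ.≤-trans k≤g g≤i)) (sym (step-≤ g≤i)))
      (trans (step-≤ (ℕₚ.≤-trans k≤g (ℕₚ.≤-trans g≤i (ℕₚ.<⇒≤ i<j)))) (sym (step-≤ (ℕₚ.≤-trans g≤i (ℕₚ.<⇒≤ i<j))))))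
      (trans (sym (⟪e⊞e,coweight⟫ s i t j g)) ≡0))
... | no g≰i | yes g≤j = ⊥-elim (⟦⟧≢0 t (trans (sym (trans (⟪e⊞e,coweight⟫ s i t j g)
      (trans (cong₂ (λ a b → ⟦ s ⟧ ℚ.* a ℚ.+ ⟦ t ⟧ ℚ.* b) (step-> (ℕₚ.≰⇒> g≰i)) (step-≤ g≤j))
        (trans (cong (ℚ._+ ⟦ t ⟧ ℚ.* 1ℚ) (ℚₚ.*-zeroʳ ⟦ s ⟧)) (ℚₚ.+-identityˡ (⟦ t ⟧ ℚ.* 1ℚ)))))) ≡0))
... | no g≰i | no g≰j = inj₂ λ k g≤k → trans (⟪e⊞e,coweight⟫ s i t j k)
    (trans (cong₂ (λ a b → ⟦ s ⟧ ℚ.* a ℚ.+ ⟦ t ⟧ ℚ.* b)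
      (step-> (ℕₚ.<-≤-trans (ℕₚ.≰⇒> g≰i) g≤k)) (step-> (ℕₚ.<-≤-trans (ℕₚ.≰⇒> g≰j) g≤k)))
      (cong₂ ℚ._+_ (ℚₚ.*-zeroʳ ⟦ s ⟧) (ℚₚ.*-zeroʳ ⟦ t ⟧)))

separable-restriction : ∀ {n J′} (R : RootSystem n) f x U Δ′ → Decidable J′ → Φ⁺ R ⊆ Φ R → subsystem R U Δ′ ≅ J′ →
  Generic x → InvertsAt R f x → (∀ f′ → InvertsAt (subsystem R U Δ′) f′ x → Separable (subsystem R U Δ′) f′) →
  ∃[ f′ ] (IsRestriction R f (subsystem R U Δ′) f′ × Separable (subsystem R U Δ′) f′)
separable-restriction R f x U Δ′ J′? Φ⁺⊆Φ R′≅ gen inv sep =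
  let (f′ , restr , inv′) = restriction {R = R} {f} {x} {U} {Δ′} J′? Φ⁺⊆Φ R′≅ gen inv in f′ , restr , sep f′ inv′

-- Quantified over `R` and `f` because the recursion reaches an interval through nested parabolic
-- subsystems and summands, which agree with each other only as sets of roots, and with whichever
-- map was constructed there.
SeparableOn : ∀ {n} → V n → ℕ → ℕ → Set₁
SeparableOn {n} x a b = ∀ (R : RootSystem n) f → R ≅ Interval a b → InvertsAt R f x → Separable R f

separable-empty : ∀ {n} (x : V n) a → SeparableOn x a a
separable-empty {n} x a R f R≅ _ = S0 λ v v∈ → let (v∈Φ , supp) = proj₁ (Φ≐ R≅) v∈ in
  Φᴮ≢0 v∈Φ (Span-⊥ v none (Φ-Span (interval? a a) v∈Φ supp))
  where
  none : ∀ {s v : V n} → Simple (Interval a a) s → ⟪ s , v ⟫ ≡ 0ℚ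
  none (k , (a≤k , k<a) , _) = ⊥-elim (ℕₚ.<-irrefl refl (ℕₚ.≤-<-trans a≤k k<a))

module _ {n a g b} (a≤g : a ≤ g) (g<b : g ℕ.< b) (b≤n : b ≤ n) where

  private
    hole left right : Pred ℕ 0ℓ
    hole  = Without (Interval a b) g
    left  = Interval a g
    right = Interval (suc g) b

    left⊆hole : left ⊆ hole
    left⊆hole (a≤k , k<g) = (a≤k , ℕₚ.<-trans k<g g<b) , ℕₚ.<⇒≢ k<g

    right⊆hole : right ⊆ hole
    right⊆hole (g<k , k<b) = (ℕₚ.≤-trans a≤g (ℕₚ.<⇒≤ g<k) , k<b) , ℕₚ.<⇒≢ g<k ∘ sym

    C : Fin 2 → Pred (V n) 0ℓ
    C zero       = Φ⟨ left ⟩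
    C (suc zero) = Φ⟨ right ⟩

    left⟂right : C zero ⟂ C (suc zero)
    left⟂right {α} {β} (α∈ , suppα) (β∈ , suppβ) = Span-⊥ β outer (Φ-Span (interval? a g) α∈ suppα)
      where
      outer : ∀ {s} → Simple left s → ⟪ s , β ⟫ ≡ 0ℚ
      outer (i , (_ , i<g) , refl) = trans (⟪⟫-comm (simple i) β)
          (Span-⊥ (simple i) inner (Φ-Span (interval? (suc g) b) β∈ suppβ))
        where
        inner : ∀ {t} → Simple right t → ⟪ t , simple i ⟫ ≡ 0ℚ
        inner (j , (g<j , _) , refl) = trans (⟪⟫-comm (simple j) (simple i)) (simple-distant i j (ℕₚ.≤-<-trans i<g g<j))

    components : ∀ {R : RootSystem n} → R ≅ hole → a ℕ.< g → suc g ℕ.< b → Components (Φ R) C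
    components {R} R≅ a<g g+1<b = record
      { irreducible = λ { zero       → interval-irreducible a<g (ℕₚ.≤-trans (ℕₚ.<⇒≤ g<b) b≤n) {C zero} ((λ v∈ → v∈) , (λ v∈ → v∈))
                        ; (suc zero) → interval-irreducible g+1<b b≤n {C (suc zero)} ((λ v∈ → v∈) , (λ v∈ → v∈)) }
      ; orthogonal  = orthogonal
      ; union       = (λ {v} → Φ⊆ v) , λ { {v} (zero , v∈B , supp)     → proj₂ (Φ≐ R≅) (v∈B , Supported-⊆ {J = left} {hole} left⊆hole {v} supp)
                                         ; {v} (suc zero , v∈B , supp) → proj₂ (Φ≐ R≅) (v∈B , Supported-⊆ {J = right} {hole} right⊆hole {v} supp) }
      }
      where
      orthogonal : ∀ {i j} → i ≢ j → C i ⟂ C j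
      orthogonal {zero}     {zero}     i≢j = ⊥-elim (i≢j refl)
      orthogonal {zero}     {suc zero} _   = left⟂right
      orthogonal {suc zero} {zero}     _   {α} {β} α∈ β∈ = trans (⟪⟫-comm α β) (left⟂right β∈ α∈)
      orthogonal {suc zero} {suc zero} i≢j = ⊥-elim (i≢j refl)
      Φ⊆ : ∀ v → v ∈ Φ R → v ∈ ⋃ (Fin 2) C
      Φ⊆ v v∈ with proj₁ (Φ≐ R≅) v∈
      ... | v∈B , supp with root-support v∈B g (supp g λ (_ , g≢g) → g≢g refl)
      ...   | inj₁ low = suc zero , v∈B , supported
        where
        supported : Supported right v
        supported k k∉ with k ℕₚ.≤? g
        ... | yes k≤g = low k k≤g
        ... | no k≰g  = supp k λ ((_ , k<b) , _) → k∉ (ℕₚ.≰⇒> k≰g , k<b)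
      ...   | inj₂ high = zero , v∈B , supported
        where
        supported : Supported left v
        supported k k∉ with g ℕₚ.≤? k
        ... | yes g≤k = high k g≤k
        ... | no g≰k  = supp k λ ((a≤k , _) , _) → k∉ (a≤k , ℕₚ.≰⇒> g≰k)

  -- S2 requires two components, and components are inhabited. When `g` is an end of the interval
  -- one side is empty, and the system is then treated as the other interval directly.
  separable-hole : {x : V n} → Generic x → SeparableOn x a g → SeparableOn x (suc g) b →
    ∀ (R : RootSystem n) f → R ≅ hole → InvertsAt R f x → Separable R f
  separable-hole {x} gen sepˡ sepʳ R f R≅ inv with ℕₚ.m≤n⇒m<n∨m≡n a≤g | ℕₚ.m≤n⇒m<n∨m≡n g<b
  ... | inj₂ refl | _ = sepʳ R f (≅-resp-≐ (hole⊆right , right⊆hole) R≅) inv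
    where
    hole⊆right : hole ⊆ right
    hole⊆right ((a≤k , k<b) , k≢g) = ℕₚ.≤∧≢⇒< a≤k (k≢g ∘ sym) , k<b
  ... | inj₁ _ | inj₂ refl = sepˡ R f (≅-resp-≐ (hole⊆left , left⊆hole) R≅) inv
    where
    hole⊆left : hole ⊆ left
    hole⊆left ((a≤k , s≤s k≤g) , k≢g) = a≤k , ℕₚ.≤∧≢⇒< k≤g k≢g
  ... | inj₁ a<g | inj₁ g+1<b = S2 C (s≤s (s≤s z≤n)) (components R≅ a<g g+1<b) parts
    where
    parts : ∀ i → ∃[ f′ ] (IsRestriction R f (summand R (C i)) f′ × Separable (summand R (C i)) f′)
    parts zero = separable-restriction R f x (C zero) (Δ R ∩ C zero) (interval? a g) (≅-Φ⁺⊆Φ R≅) R′≅ gen inv λ f′ → sepˡ (summand R (C zero)) f′ R′≅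
      where R′≅ = summand-≅ (interval? a g) left⊆hole R≅
    parts (suc zero) = separable-restriction R f x (C (suc zero)) (Δ R ∩ C (suc zero)) (interval? (suc g) b) (≅-Φ⁺⊆Φ R≅) R′≅ gen inv λ f′ → sepʳ (summand R (C (suc zero))) f′ R′≅
      where R′≅ = summand-≅ (interval? (suc g) b) right⊆hole R≅

-- Cuts in terms of coefficients and pairings

-- The last condition of S3 with both notions made numerical: lying above `simple g` becomes a
-- positive coefficient at `g`, and being inverted becomes a negative pairing with `x`.
CutAt : ∀ {n} → V n → ℕ → ℕ → ℕ → Set
CutAt {n} x a g b =
  (∀ β → β ∈ Φ⁺ (B n) → Supported (Interval a b) β → 0ℚ ℚ.< ⟪ β , coweight g ⟫ → ⟪ β , x ⟫ ℚ.< 0ℚ) ⊎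
  (∀ β → β ∈ Φ⁺ (B n) → Supported (Interval a b) β → 0ℚ ℚ.< ⟪ β , coweight g ⟫ → ¬ (⟪ β , x ⟫ ℚ.< 0ℚ))

above⇒0<coweight : ∀ {n J} {R : RootSystem n} → R ≅ J → ∀ g {β} → simple g ≤[ R ] β → 0ℚ ℚ.< ⟪ β , coweight (toℕ g) ⟫
above⇒0<coweight {R = R} R≅ g {β} g≤β =
  subst (λ v → 0ℚ ℚ.< ⟪ v , coweight (toℕ g) ⟫) (⊟-⊞-cancel β (simple g))
    (subst (0ℚ ℚ.<_) (sym (⟪⟫-⊞ˡ (β ⊟ simple g) (simple g) (coweight (toℕ g))))
      (ℚₚ.+-mono-≤-< (ℕSpan-nonneg (coweight (toℕ g)) nonneg g≤β)
        (subst (0ℚ ℚ.<_) (sym (simple-coweight-same g)) 0<1)))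
  where
  nonneg : ∀ {s} → s ∈ Δ R → 0ℚ ℚ.≤ ⟪ s , coweight (toℕ g) ⟫
  nonneg s∈ with proj₁ (Δ≐ R≅) s∈
  ... | j , _ , refl = simple-coweight-nonneg j (toℕ g)

separable-cut : ∀ {n a g b} → a ≤ g → g ℕ.< b → b ≤ n → {x : V n} → Generic x → CutAt x a g b →
  SeparableOn x a g → SeparableOn x (suc g) b → SeparableOn x a b
separable-cut {n} {a} {g} {b} a≤g g<b b≤n {x} gen cut sepˡ sepʳ R f R≅ inv =
  S3 (interval-irreducible (ℕₚ.≤-<-trans a≤g g<b) b≤n (Φ≐ R≅)) (simple g′)
     (proj₂ (Δ≐ R≅) (g′ , subst (Interval a b) (sym g′≡g) (a≤g , g<b) , refl))
     part cut′
  where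
  g′ : Fin n
  g′ = fromℕ< (ℕₚ.<-≤-trans g<b b≤n)
  g′≡g : toℕ g′ ≡ g
  g′≡g = toℕ-fromℕ< _
  R′ = parabolic R (simple g′)
  R′≅ : R′ ≅ Without (Interval a b) g
  R′≅ = subst (λ k → R′ ≅ Without (Interval a b) k) g′≡g (parabolic-≅ (interval? a b) R≅ g′)
  part : ∃[ f′ ] (IsRestriction R f R′ f′ × Separable R′ f′)
  part = separable-restriction R f x (Span (Δ-without R (simple g′))) (Δ-without R (simple g′))
    (without? (interval? a b) g) (≅-Φ⁺⊆Φ R≅) R′≅ gen inv λ f′ → separable-hole a≤g g<b b≤n {x} gen sepˡ sepʳ R′ f′ R′≅
  above : ∀ {β} → simple g′ ≤[ R ] β → 0ℚ ℚ.< ⟪ β , coweight g ⟫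
  above {β} g≤β = subst (λ k → 0ℚ ℚ.< ⟪ β , coweight k ⟫) g′≡g (above⇒0<coweight R≅ g′ {β} g≤β)
  cut′ : (↑ R (simple g′) ⊆ I R f) ⊎ IsEmpty (↑ R (simple g′) ∩ I R f)
  cut′ = [ (λ all → inj₁ λ {β} (β∈ , g≤β) → let (β∈B , supp) = proj₁ (Φ⁺≐ R≅) β∈ in
               β∈ , proj₂ (inv β β∈) (all β β∈B supp (above {β} g≤β)))
         , (λ none → inj₂ λ β ((β∈ , g≤β) , (_ , ⊟fβ∈)) → let (β∈B , supp) = proj₁ (Φ⁺≐ R≅) β∈ in
               none β β∈B supp (above {β} g≤β) (proj₁ (inv β β∈) ⊟fβ∈)) ]′ cut

-- Decomposing words that avoid 3142 and 2413

search : ∀ {P Q : ℕ → Set} lo hi → (∀ i → lo ≤ i → i ℕ.< hi → P i ⊎ Q i) →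
         (∀ i → lo ≤ i → i ℕ.< hi → P i) ⊎ (∃ λ i → lo ≤ i × i ℕ.< hi × Q i)
search lo zero    _      = inj₁ λ _ _ ()
search {P} lo (suc hi) decide with search lo hi (λ i lo≤i i<hi → decide i lo≤i (ℕₚ.m<n⇒m<1+n i<hi))
... | inj₂ (i , lo≤i , i<hi , q) = inj₂ (i , lo≤i , ℕₚ.m<n⇒m<1+n i<hi , q)
... | inj₁ all with lo ℕₚ.≤? hi
...   | no lo≰hi = inj₁ λ i lo≤i i<1+hi → ⊥-elim (lo≰hi (ℕₚ.≤-trans lo≤i (ℕₚ.≤-pred i<1+hi)))
...   | yes lo≤hi with decide hi lo≤hi ℕₚ.≤-refl
...     | inj₂ q = inj₂ (hi , lo≤hi , ℕₚ.≤-refl , q)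
...     | inj₁ p = inj₁ below
  where
  below : ∀ i → lo ≤ i → i ℕ.< suc hi → P i
  below i lo≤i (s≤s i≤hi) with ℕₚ.m≤n⇒m<n∨m≡n i≤hi
  ... | inj₁ i<hi = all i lo≤i i<hi
  ... | inj₂ refl = p

Cut : (ℕ → ℕ → Set) → ℕ → ℕ → ℕ → Set
Cut L p g q = ∀ i j → p ≤ i → i ℕ.< g → g ≤ j → j ℕ.< q → L i j

-- Direct and skew sums. The order `L` is kept abstract because `flip` exchanges these two, and
-- exchanges 3142 with 2413, so one extension argument covers both.
Decomposable : (ℕ → ℕ → Set) → ℕ → ℕ → Set
Decomposable L p q = ∃ λ g → p ℕ.< g × g ℕ.< q × (Cut L p g q ⊎ Cut (flip L) p g q)

-- No positions i < j < k < l in [p, q) are in relative order 3142 or 2413.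
Avoiding : (ℕ → ℕ → Set) → ℕ → ℕ → Set
Avoiding L p q = ∀ i j k l → p ≤ i → i ℕ.< j → j ℕ.< k → k ℕ.< l → l ℕ.< q →
  ¬ (L j l × L l i × L i k) × ¬ (L l j × L i l × L k i)

Trans : (ℕ → ℕ → Set) → Set
Trans L = ∀ i j k → L i j → L j k → L i k

TotalBelow : (ℕ → ℕ → Set) → ℕ → Set
TotalBelow L n = ∀ i j → i ℕ.< j → j ℕ.< n → L i j ⊎ L j i

-- Adding the last position m to a sequence with a cut at g. If m spoils the
-- cut, it lies below the part after g; a cut of the part before g then
-- either cuts everything, or together with m exhibits 3142.
extend-cut : ∀ {L n p m} → Trans L → TotalBelow L n → suc m ≤ n → Avoiding L p (suc m) →
  (∀ r → r ≤ m → suc p ℕ.< r → Decomposable L p r) →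
  ∀ N g → g ≤ N → p ℕ.< g → g ℕ.< m → Cut L p g m → Decomposable L p (suc m)
extend-cut _ _ _ _ _ zero zero _ () _ _
extend-cut {L} {n} {p} {m} L-trans total m<n avoid ih (suc N) g g≤N p<g g<m cut
  with search p g (λ i _ i<g → total i m (ℕₚ.<-trans i<g g<m) m<n)
... | inj₁ all = g , p<g , ℕₚ.m<n⇒m<1+n g<m , inj₁ cut′
  where
  cut′ : Cut L p g (suc m)
  cut′ i j p≤i i<g g≤j (s≤s j≤m) with ℕₚ.m≤n⇒m<n∨m≡n j≤m
  ... | inj₁ j<m  = cut i j p≤i i<g g≤j j<m
  ... | inj₂ refl = all i p≤i i<g
... | inj₂ (a , p≤a , a<g , m<a) = case-size (ℕₚ.m≤n⇒m<n∨m≡n p<g)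
  where
  p<m = ℕₚ.<-trans p<g g<m
  below-right : ∀ j → g ≤ j → j ℕ.< m → L m j
  below-right j g≤j j<m = L-trans m a j m<a (cut a j p≤a a<g g≤j j<m)
  below-all : (∀ i → p ≤ i → i ℕ.< g → L m i) → Decomposable L p (suc m)
  below-all below-left = m , p<m , ℕₚ.≤-refl , inj₂ cut′
    where
    cut′ : Cut (flip L) p m (suc m)
    cut′ i j p≤i i<m m≤j (s≤s j≤m) with ℕₚ.≤-antisym j≤m m≤j | i ℕₚ.<? g
    ... | refl | yes i<g = below-left i p≤i i<g
    ... | refl | no i≮g  = below-right i (ℕₚ.≮⇒≥ i≮g) i<m
  case-cut : ∀ g′ → p ℕ.< g′ → g′ ℕ.< g → Cut L p g′ g ⊎ Cut (flip L) p g′ g → Decomposable L p (suc m)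
  -- A direct cut of the left part combines with the cut at `g` into a direct cut of `[p, m)` at the
  -- smaller position `g′`; the bound `N` on the cut position makes this recursion structural.
  case-cut g′ p<g′ g′<g (inj₁ cut₁) =
    extend-cut {L} L-trans total m<n avoid ih N g′ (ℕₚ.≤-pred (ℕₚ.≤-trans g′<g g≤N)) p<g′ (ℕₚ.<-trans g′<g g<m) cut′
    where
    cut′ : Cut L p g′ m
    cut′ i j p≤i i<g′ g′≤j j<m with j ℕₚ.<? g
    ... | yes j<g = cut₁ i j p≤i i<g′ g′≤j j<g
    ... | no j≮g  = cut i j p≤i (ℕₚ.<-trans i<g′ g′<g) (ℕₚ.≮⇒≥ j≮g) j<m
  case-cut g′ p<g′ g′<g (inj₂ cut₁)
    with search {L m} {λ d → L d m} g′ g (λ d _ d<g → swap (total d m (ℕₚ.<-trans d<g g<m) m<n))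
  ... | inj₁ all = below-all below-left
    where
    below-left : ∀ i → p ≤ i → i ℕ.< g → L m i
    below-left i p≤i i<g with i ℕₚ.<? g′
    ... | yes i<g′ = L-trans m g′ i (all g′ ℕₚ.≤-refl g′<g) (cut₁ i g′ p≤i i<g′ ℕₚ.≤-refl g′<g)
    ... | no i≮g′  = all i (ℕₚ.≮⇒≥ i≮g′) i<g
  ... | inj₂ (d , g′≤d , d<g , d<m) = ⊥-elim (contradiction₃₁₄₂ (a ℕₚ.<? g′))
    where
    -- The positions `c < d < g < m` carry 3142: the values satisfy `d < m` by the search, `m < c`
    -- by assumption and `c < g` by the direct cut.
    occurrence : ∀ c → p ≤ c → c ℕ.< g′ → L m c → ⊥
    occurrence c p≤c c<g′ m<c =
      proj₁ (avoid c d g m p≤c (ℕₚ.<-≤-trans c<g′ g′≤d) d<g g<m ℕₚ.≤-refl)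
        (d<m , m<c , cut c g p≤c (ℕₚ.<-trans c<g′ g′<g) ℕₚ.≤-refl g<m)
    contradiction₃₁₄₂ : _ → ⊥
    contradiction₃₁₄₂ (yes a<g′) = occurrence a p≤a a<g′ m<a
    -- Here `a` lies in the second half of the skew cut, so the entry at `p` exceeds the one at `a`,
    -- and `p` can play the part of `c`.
    contradiction₃₁₄₂ (no a≮g′)  = occurrence p ℕₚ.≤-refl p<g′ (L-trans m a p m<a (cut₁ p a ℕₚ.≤-refl p<g′ (ℕₚ.≮⇒≥ a≮g′) a<g))
  case-size : suc p ℕ.< g ⊎ suc p ≡ g → Decomposable L p (suc m)
  case-size (inj₂ refl) = below-all λ { i p≤i (s≤s i≤p) → subst (L m) (trans (ℕₚ.≤-antisym (ℕₚ.≤-pred a<g) p≤a) (ℕₚ.≤-antisym p≤i i≤p)) m<a }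
  case-size (inj₁ p+1<g) = let (g′ , p<g′ , g′<g , c) = ih g (ℕₚ.<⇒≤ g<m) p+1<g in case-cut g′ p<g′ g′<g c

Avoiding-⊆ : ∀ {L p q p′ q′} → p ≤ p′ → q′ ≤ q → Avoiding L p q → Avoiding L p′ q′
Avoiding-⊆ p≤p′ q′≤q avoid i j k l p′≤i i<j j<k k<l l<q′ =
  avoid i j k l (ℕₚ.≤-trans p≤p′ p′≤i) i<j j<k k<l (ℕₚ.<-≤-trans l<q′ q′≤q)

Avoiding-flip : ∀ {L p q} → Avoiding L p q → Avoiding (flip L) p q
Avoiding-flip avoid i j k l p≤i i<j j<k k<l l<q = let (¬3142 , ¬2413) = avoid i j k l p≤i i<j j<k k<l l<q in ¬2413 , ¬3142

-- Induction on the length of the word, bounded by `N`: drop the last position, decompose the rest,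
-- and put the position back with `extend-cut`.
decompose : ∀ {n} N {L p} q → Trans L → TotalBelow L n → q ≤ p ℕ.+ N → suc p ℕ.< q → q ≤ n → Avoiding L p q → Decomposable L p q
decompose {n} zero {p = p} q _ _ q≤p p+1<q _ _ =
  ⊥-elim (ℕₚ.<⇒≱ (ℕₚ.<-trans (ℕₚ.n<1+n p) p+1<q) (subst (q ≤_) (ℕₚ.+-identityʳ p) q≤p))
decompose {n} (suc N) {L} {p} (suc m) L-trans total q≤p+N (s≤s p<m) m<n avoid with ℕₚ.m≤n⇒m<n∨m≡n p<m
... | inj₂ refl = suc p , ℕₚ.≤-refl , ℕₚ.≤-refl , [ (λ r → inj₁ (cut r)) , (λ r → inj₂ (cut r)) ]′ (total p (suc p) ℕₚ.≤-refl m<n)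
  where
  cut : ∀ {L} → L p (suc p) → Cut L p (suc p) (suc (suc p))
  cut {L} r i j p≤i (s≤s i≤p) p<j (s≤s j≤p+1) = subst₂ L (ℕₚ.≤-antisym p≤i i≤p) (ℕₚ.≤-antisym p<j j≤p+1) r
... | inj₁ p+1<m = result (smaller L-trans total avoid m ℕₚ.≤-refl p+1<m)
  where
  m≤p+N : m ≤ p ℕ.+ N
  m≤p+N = ℕₚ.≤-pred (subst (suc m ≤_) (ℕₚ.+-suc p N) q≤p+N)
  smaller : ∀ {L} → Trans L → TotalBelow L n → Avoiding L p (suc m) → ∀ r → r ≤ m → suc p ℕ.< r → Decomposable L p r
  smaller {L} t tot av r r≤m p+1<r = decompose N {L} r t tot (ℕₚ.≤-trans r≤m m≤p+N) p+1<r
    (ℕₚ.≤-trans r≤m (ℕₚ.<⇒≤ m<n)) (Avoiding-⊆ {L} ℕₚ.≤-refl (ℕₚ.m≤n⇒m≤1+n r≤m) av)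
  result : Decomposable L p m → Decomposable L p (suc m)
  result (g , p<g , g<m , inj₁ cut) =
    extend-cut {L} L-trans total m<n avoid (smaller L-trans total avoid) g g ℕₚ.≤-refl p<g g<m cut
  -- A skew cut is a direct cut for the reversed order, in which the two forbidden patterns trade
  -- places.
  result (g , p<g , g<m , inj₂ cut) =
    let (g′ , p<g′ , g′<q , c) = extend-cut {flip L} flip-trans flip-total m<n (Avoiding-flip {L} avoid)
          (smaller {flip L} flip-trans flip-total (Avoiding-flip {L} avoid)) g g ℕₚ.≤-refl p<g g<m cut
    in g′ , p<g′ , g′<q , swap c
    where
    flip-trans : Trans (flip L)
    flip-trans i j k a b = L-trans k j i b a
    flip-total : TotalBelow (flip L) n
    flip-total i j i<j j<n = swap (total i j i<j j<n)

-- Exhibiting pattern occurrences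

∣toℤ∣ : ∀ {n} (x : ±[ n ]) → ∣ toℤ x ∣ ≡ suc (toℕ (proj₂ x))
∣toℤ∣ (s , i) = ℤₚ.abs-◃ s (suc (toℕ i))

∣oneLine∣-injective : ∀ {n} (w : SignedPerm n) {i j} → ∣ oneLine w i ∣ ≡ ∣ oneLine w j ∣ → i ≡ j
∣oneLine∣-injective w {i} {j} eq = entry-injective w (toℕ-injective (ℕₚ.suc-injective
  (trans (sym (∣toℤ∣ (entry w i))) (trans eq (∣toℤ∣ (entry w j))))))

sign-toℤ : ∀ {n} (x : ±[ n ]) → ℤ.sign (toℤ x) ≡ proj₁ x
sign-toℤ (Sign.+ , i) = refl
sign-toℤ (Sign.- , i) = refl

sign≡-⇒<0 : ∀ {z} → ℤ.sign z ≡ Sign.- → z ℤ.< ℤ.0ℤ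
sign≡-⇒<0 { -[1+ _ ]} _ = ℤ.-<+

<0⇒sign≡- : ∀ {z} → z ℤ.< ℤ.0ℤ → ℤ.sign z ≡ Sign.-
<0⇒sign≡- ℤ.-<+ = refl

-- `c` lists the absolute values of `a` in increasing order, indexed by the letters of `u`. The
-- strict comparison in `IsSts` matches the weak one because distinct positions of `u` carry
-- distinct letters.
IsSts-intro : ∀ {m} (u : SignedPerm m) (a : Fin m → ℤ) (c : Fin m → ℕ) → (∀ {i j} → i < j → c i ℕ.< c j) →
  (∀ i → ℤ.sign (a i) ≡ proj₁ (entry u i)) → (∀ i → ∣ a i ∣ ≡ c (proj₂ (entry u i))) → IsSts a u
IsSts-intro u a c c-mono signs values = sign⇔ , abs⇔
  where
  sign⇔ : ∀ i → (oneLine u i ℤ.< ℤ.0ℤ) ⇔ (a i ℤ.< ℤ.0ℤ)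
  sign⇔ i = mk⇔ (λ u<0 → sign≡-⇒<0 (trans (signs i) (trans (sym (sign-toℤ (entry u i))) (<0⇒sign≡- u<0))))
                (λ a<0 → sign≡-⇒<0 (trans (sign-toℤ (entry u i)) (trans (sym (signs i)) (<0⇒sign≡- a<0))))
  abs⇔ : ∀ {i j} → i < j → (∣ oneLine u i ∣ ℕ.< ∣ oneLine u j ∣) ⇔ (∣ a i ∣ ≤ ∣ a j ∣)
  abs⇔ {i} {j} i<j rewrite ∣toℤ∣ (entry u i) | ∣toℤ∣ (entry u j) | values i | values j =
    mk⇔ (λ { (s≤s lt) → ℕₚ.<⇒≤ (c-mono lt) }) from
    where
    from : c (proj₂ (entry u i)) ≤ c (proj₂ (entry u j)) → suc (toℕ (proj₂ (entry u i))) ℕ.< suc (toℕ (proj₂ (entry u j)))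
    from ci≤cj with ℕₚ.<-cmp (toℕ (proj₂ (entry u i))) (toℕ (proj₂ (entry u j)))
    ... | tri< lt _ _ = s≤s lt
    ... | tri≈ _ eq _ = ⊥-elim (ℕₚ.<-irrefl (cong toℕ (entry-injective u (toℕ-injective eq))) i<j)
    ... | tri> _ _ gt = ⊥-elim (ℕₚ.<⇒≱ (c-mono gt) ci≤cj)

contains : ∀ {n m} (w : SignedPerm n) (u : SignedPerm m) (p : Vec (Fin n) m) (c : Vec ℕ m) →
  Linked (ℕ._<_ on toℕ) p → Linked ℕ._<_ c →
  (∀ i → ℤ.sign (oneLine w (lookup p i)) ≡ proj₁ (entry u i)) →
  (∀ i → ∣ oneLine w (lookup p i) ∣ ≡ lookup c (proj₂ (entry u i))) → w Contains u
contains w u p c p-inc c-inc signs values = lookup p , Linked.lookup⁺ (λ {a} {b} {c} → ℕₚ.<-trans) p-inc ,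
  IsSts-intro u (oneLine w ∘ lookup p) (lookup c) (Linked.lookup⁺ ℕₚ.<-trans c-inc) signs values

AvoidsAll : ∀ {n} → SignedPerm n → Set
AvoidsAll w = w Avoids [-2,1] × w Avoids [2,-1] ×
  w Avoids [3,1,4,2] × w Avoids [2,4,1,3] × w Avoids [-3,-1,-4,-2] × w Avoids [-2,-4,-1,-3]

-- Otherwise the two entries, of opposite sign with the larger absolute value first, form one of the
-- patterns of length 2.
signs-differ : ∀ {n} (w : SignedPerm n) → AvoidsAll w → ∀ {i j} → i < j →
  ℤ.sign (oneLine w i) ≢ ℤ.sign (oneLine w j) → ∣ oneLine w i ∣ ℕ.< ∣ oneLine w j ∣
signs-differ w (a₁ , a₂ , _) {i} {j} i<j signs≢ with ℕₚ.<-cmp ∣ oneLine w i ∣ ∣ oneLine w j ∣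
... | tri< lt _ _ = lt
... | tri≈ _ eq _ = ⊥-elim (ℕₚ.<-irrefl (cong toℕ (∣oneLine∣-injective w eq)) i<j)
... | tri> _ _ gt with ℤ.sign (oneLine w i) in si | ℤ.sign (oneLine w j) in sj
...   | Sign.+ | Sign.+ = ⊥-elim (signs≢ refl)
...   | Sign.- | Sign.- = ⊥-elim (signs≢ refl)
...   | Sign.- | Sign.+ = ⊥-elim (a₁ (contains w [-2,1] (i ∷ j ∷ []) (∣ oneLine w j ∣ ∷ ∣ oneLine w i ∣ ∷ [])
        (i<j ∷ [-]) (gt ∷ [-]) (λ { zero → si ; (suc zero) → sj }) (λ { zero → refl ; (suc zero) → refl })))
...   | Sign.+ | Sign.- = ⊥-elim (a₂ (contains w [2,-1] (i ∷ j ∷ []) (∣ oneLine w j ∣ ∷ ∣ oneLine w i ∣ ∷ [])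
        (i<j ∷ [-]) (gt ∷ [-]) (λ { zero → si ; (suc zero) → sj }) (λ { zero → refl ; (suc zero) → refl })))

<⇒∣<∣ : ∀ {a b} → ℤ.sign a ≡ Sign.+ → a ℤ.< b → ∣ a ∣ ℕ.< ∣ b ∣
<⇒∣<∣ {+ _} _ (ℤ.+<+ lt) = lt

<⇒∣>∣ : ∀ {a b} → ℤ.sign b ≡ Sign.- → a ℤ.< b → ∣ b ∣ ℕ.< ∣ a ∣
<⇒∣>∣ { -[1+ _ ]} { -[1+ _ ]} _ (ℤ.-<- lt) = s≤s lt
<⇒∣>∣ { -[1+ _ ]} {+ _} ()

-- Among negative entries the order of values reverses that of absolute values. Values in relative
-- order 3142 then have absolute values in order 2413, and conversely, which is why the negative
-- patterns appear crosswise.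
same-sign-avoiding : ∀ {n} (w : SignedPerm n) → AvoidsAll w → ∀ {i j k l} → i < j → j < k → k < l →
  ∀ s → (∀ h → h ∈ (λ h → h ≡ i ⊎ h ≡ j ⊎ h ≡ k ⊎ h ≡ l) → ℤ.sign (oneLine w h) ≡ s) →
  let _≺_ = λ a b → oneLine w a ℤ.< oneLine w b in ¬ (j ≺ l × l ≺ i × i ≺ k) × ¬ (l ≺ j × i ≺ l × k ≺ i)
same-sign-avoiding w (_ , _ , a3142 , a2413 , a-3142 , a-2413) {i} {j} {k} {l} i<j j<k k<l s signs = first s signs , second s signs
  where
  z = oneLine w
  p = i ∷ j ∷ k ∷ l ∷ []
  p-inc = i<j ∷ j<k ∷ k<l ∷ [-]
  at : ∀ {s} → (∀ h → h ≡ i ⊎ h ≡ j ⊎ h ≡ k ⊎ h ≡ l → ℤ.sign (z h) ≡ s) → ∀ m → ℤ.sign (z (lookup p m)) ≡ s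
  at signs zero                   = signs i (inj₁ refl)
  at signs (suc zero)             = signs j (inj₂ (inj₁ refl))
  at signs (suc (suc zero))       = signs k (inj₂ (inj₂ (inj₁ refl)))
  at signs (suc (suc (suc zero))) = signs l (inj₂ (inj₂ (inj₂ refl)))
  split₄ : ∀ {P : Fin 4 → Set} → P zero → P (suc zero) → P (suc (suc zero)) → P (suc (suc (suc zero))) → ∀ m → P m
  split₄ a b c d zero                   = a
  split₄ a b c d (suc zero)             = b
  split₄ a b c d (suc (suc zero))       = c
  split₄ a b c d (suc (suc (suc zero))) = d
  first : ∀ s → (∀ h → h ≡ i ⊎ h ≡ j ⊎ h ≡ k ⊎ h ≡ l → ℤ.sign (z h) ≡ s) → ¬ (z j ℤ.< z l × z l ℤ.< z i × z i ℤ.< z k)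
  first Sign.+ sg (j≺l , l≺i , i≺k) = a3142 (contains w [3,1,4,2] p (∣ z j ∣ ∷ ∣ z l ∣ ∷ ∣ z i ∣ ∷ ∣ z k ∣ ∷ []) p-inc
    (<⇒∣<∣ (at sg (suc zero)) j≺l ∷ <⇒∣<∣ (at sg (suc (suc (suc zero)))) l≺i ∷ <⇒∣<∣ (at sg zero) i≺k ∷ [-])
    (split₄ (at sg zero) (at sg (suc zero)) (at sg (suc (suc zero))) (at sg (suc (suc (suc zero))))) (split₄ refl refl refl refl))
  first Sign.- sg (j≺l , l≺i , i≺k) = a-2413 (contains w [-2,-4,-1,-3] p (∣ z k ∣ ∷ ∣ z i ∣ ∷ ∣ z l ∣ ∷ ∣ z j ∣ ∷ []) p-inc
    (<⇒∣>∣ (at sg (suc (suc zero))) i≺k ∷ <⇒∣>∣ (at sg zero) l≺i ∷ <⇒∣>∣ (at sg (suc (suc (suc zero)))) j≺l ∷ [-])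
    (split₄ (at sg zero) (at sg (suc zero)) (at sg (suc (suc zero))) (at sg (suc (suc (suc zero))))) (split₄ refl refl refl refl))
  second : ∀ s → (∀ h → h ≡ i ⊎ h ≡ j ⊎ h ≡ k ⊎ h ≡ l → ℤ.sign (z h) ≡ s) → ¬ (z l ℤ.< z j × z i ℤ.< z l × z k ℤ.< z i)
  second Sign.+ sg (l≺j , i≺l , k≺i) = a2413 (contains w [2,4,1,3] p (∣ z k ∣ ∷ ∣ z i ∣ ∷ ∣ z l ∣ ∷ ∣ z j ∣ ∷ []) p-inc
    (<⇒∣<∣ (at sg (suc (suc zero))) k≺i ∷ <⇒∣<∣ (at sg zero) i≺l ∷ <⇒∣<∣ (at sg (suc (suc (suc zero)))) l≺j ∷ [-])
    (split₄ (at sg zero) (at sg (suc zero)) (at sg (suc (suc zero))) (at sg (suc (suc (suc zero))))) (split₄ refl refl refl refl))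
  second Sign.- sg (l≺j , i≺l , k≺i) = a-3142 (contains w [-3,-1,-4,-2] p (∣ z j ∣ ∷ ∣ z l ∣ ∷ ∣ z i ∣ ∷ ∣ z k ∣ ∷ []) p-inc
    (<⇒∣>∣ (at sg (suc zero)) l≺j ∷ <⇒∣>∣ (at sg (suc (suc (suc zero)))) i≺l ∷ <⇒∣>∣ (at sg zero) k≺i ∷ [-])
    (split₄ (at sg zero) (at sg (suc zero)) (at sg (suc (suc zero))) (at sg (suc (suc (suc zero))))) (split₄ refl refl refl refl))

-- Pairing a positive root with (w₁ , … , wₙ) tells whether w inverts it.

values : ∀ {n} → SignedPerm n → V n
values w = tabulate (λ i → ι (oneLine w i))

⟪act,ρᴮ⟫ : ∀ {n} (w : SignedPerm n) β → ⟪ act w β , ρᴮ ⟫ ≡ ⟪ β , values w ⟫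
⟪act,ρᴮ⟫ w β = trans (act-adjoint w β ρᴮ) (cong (λ v → ⟪ β , v ⟫) (tabulate-cong λ i → ⟪e,ρᴮ⟫ (entry w i)))

⟪⊟act,ρᴮ⟫ : ∀ {n} (w : SignedPerm n) β → ⟪ ⊟ act w β , ρᴮ ⟫ ≡ ℚ.- ⟪ β , values w ⟫
⟪⊟act,ρᴮ⟫ w β = trans (⟪⟫-⊟ˡ (act w β) ρᴮ) (cong ℚ.-_ (⟪act,ρᴮ⟫ w β))

neg-cancel-≤ : ∀ {q} → 1ℚ ℚ.≤ ℚ.- q → q ℚ.≤ ℚ.- 1ℚ
neg-cancel-≤ {q} le = subst (ℚ._≤ ℚ.- 1ℚ) (neg-neg q) (ℚₚ.neg-antimono-≤ le)

neg-cancel-< : ∀ {q} → 0ℚ ℚ.< ℚ.- q → q ℚ.< 0ℚ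
neg-cancel-< {q} lt = subst (ℚ._< 0ℚ) (neg-neg q) (ℚₚ.neg-antimono-< lt)

-- The pairing is the height of the root `act w β`, and heights of positive roots are at least 1.
Generic-values : ∀ {n} (w : SignedPerm n) → Generic (values w)
Generic-values w {β} β∈ with Φᴮ-± (Signed.preserves-Φ (Signed-act w) β∈)
... | inj₁ pos = inj₂ (subst (1ℚ ℚ.≤_) (⟪act,ρᴮ⟫ w β) (1≤height pos))
... | inj₂ neg = inj₁ (neg-cancel-≤ (subst (1ℚ ℚ.≤_) (⟪⊟act,ρᴮ⟫ w β) (1≤height neg)))

InvertsAt-act : ∀ {n} (w : SignedPerm n) → InvertsAt (B n) (act w) (values w)
InvertsAt-act {n} w β β∈ = (λ neg → neg-cancel-< (subst (0ℚ ℚ.<_) (⟪⊟act,ρᴮ⟫ w β) (0<height neg))) , back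
  where
  back : ⟪ β , values w ⟫ ℚ.< 0ℚ → (⊟ act w β) ∈ Φ⁺ (B n)
  back β<0 with Φᴮ-± (Signed.preserves-Φ (Signed-act w) (Φ⁺ᴮ⊆Φ β∈))
  ... | inj₂ neg = neg
  ... | inj₁ pos = ⊥-elim (ℚₚ.<-asym β<0 (subst (0ℚ ℚ.<_) (⟪act,ρᴮ⟫ w β) (0<height pos)))

signed : Sign → ℤ → ℤ
signed Sign.+ z = z
signed Sign.- z = ℤ.- z

ι-signed : ∀ s z → ⟦ s ⟧ ℚ.* ι z ≡ ι (signed s z)
ι-signed Sign.+ z = ℚₚ.*-identityˡ (ι z)
ι-signed Sign.- z = trans (solve 1 (λ q → con (ℚ.- 1ℚ) :* q := :- q) refl (ι z)) (ι-neg z)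
  where
  ι-neg : ∀ z → ℚ.- ι z ≡ ι (ℤ.- z)
  ι-neg (+ zero)  = refl
  ι-neg (+ suc _) = refl
  ι-neg -[1+ _ ]  = refl

⟪e,values⟫ : ∀ {n} (w : SignedPerm n) i → ⟪ e (Sign.+ , i) , values w ⟫ ≡ ι (oneLine w i)
⟪e,values⟫ w i = trans (⟪e+,⟫ i (values w)) (lookup∘tabulate (λ i → ι (oneLine w i)) i)

⟪e⊞e,values⟫ : ∀ {n} (w : SignedPerm n) s i j →
  ⟪ e (s , i) ⊞ e (Sign.+ , j) , values w ⟫ ≡ ι (signed s (oneLine w i) ℤ.+ oneLine w j)
⟪e⊞e,values⟫ w s i j = trans (⟪e⊞e,⟫ s i Sign.+ j (values w))
  (trans (cong₂ (λ a b → ⟦ s ⟧ ℚ.* a ℚ.+ ⟦ Sign.+ ⟧ ℚ.* b) (lookup∘tabulate (λ i → ι (oneLine w i)) i) (lookup∘tabulate (λ i → ι (oneLine w i)) j))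
    (trans (cong₂ ℚ._+_ (ι-signed s (oneLine w i)) (ι-signed Sign.+ (oneLine w j)))
      (sym (ι-+ (signed s (oneLine w i)) (oneLine w j)))))

dominated-neg : ∀ {a b} → b ℤ.< ℤ.0ℤ → ∣ a ∣ ℕ.< ∣ b ∣ → a ℤ.+ b ℤ.< ℤ.0ℤ
dominated-neg {+ m}      { -[1+ n ]} _ lt = subst (ℤ._< ℤ.0ℤ) (sym (ℤₚ.⊖-< lt)) (0>- (ℕₚ.m<n⇒0<n∸m lt))
  where
  0>- : ∀ {k} → 0 ℕ.< k → ℤ.- (+ k) ℤ.< ℤ.0ℤ
  0>- {suc k} _ = ℤ.-<+
dominated-neg { -[1+ m ]} { -[1+ n ]} _ _ = ℤ.-<+
dominated-neg {b = + n} (ℤ.+<+ ())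

dominated-nonneg : ∀ {a b} → ¬ (b ℤ.< ℤ.0ℤ) → ∣ a ∣ ℕ.< ∣ b ∣ → ¬ (a ℤ.+ b ℤ.< ℤ.0ℤ)
dominated-nonneg {+ m}      {+ n} _ _ (ℤ.+<+ ())
dominated-nonneg { -[1+ m ]} {+ n} _ lt a+b<0 with subst (ℤ._< ℤ.0ℤ) (ℤₚ.⊖-≥ (ℕₚ.<⇒≤ lt)) a+b<0
... | ℤ.+<+ ()
dominated-nonneg {b = -[1+ n ]} b≮0 _ _ = b≮0 ℤ.-<+

<⇒diff-neg : ∀ {a b} → b ℤ.< a → ℤ.- a ℤ.+ b ℤ.< ℤ.0ℤ
<⇒diff-neg {a} {b} b<a = subst (ℤ.- a ℤ.+ b ℤ.<_) (ℤₚ.+-inverseˡ a) (ℤₚ.+-monoʳ-< (ℤ.- a) b<a)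

≤⇒diff-nonneg : ∀ {a b} → a ℤ.≤ b → ¬ (ℤ.- a ℤ.+ b ℤ.< ℤ.0ℤ)
≤⇒diff-nonneg {a} {b} a≤b lt = ℤₚ.<⇒≱ lt (subst (ℤ._≤ ℤ.- a ℤ.+ b) (ℤₚ.+-inverseˡ a) (ℤₚ.+-monoʳ-≤ (ℤ.- a) a≤b))

∣<∣⇒< : ∀ {a b} → ¬ (a ℤ.< ℤ.0ℤ) → ¬ (b ℤ.< ℤ.0ℤ) → ∣ a ∣ ℕ.< ∣ b ∣ → a ℤ.< b
∣<∣⇒< {+ _}      {+ _}      _ _ lt = ℤ.+<+ lt
∣<∣⇒< { -[1+ _ ]} a≮0 _   _ = ⊥-elim (a≮0 ℤ.-<+)
∣<∣⇒< {b = -[1+ _ ]} _ b≮0 _ = ⊥-elim (b≮0 ℤ.-<+)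

∣<∣⇒> : ∀ {a b} → a ℤ.< ℤ.0ℤ → b ℤ.< ℤ.0ℤ → ∣ a ∣ ℕ.< ∣ b ∣ → b ℤ.< a
∣<∣⇒> { -[1+ _ ]} { -[1+ _ ]} _ _ (s≤s lt) = ℤ.-<- lt
∣<∣⇒> {+ _} (ℤ.+<+ ())
∣<∣⇒> {b = + _} _ (ℤ.+<+ ())

-- Patterns obstruct separability

Mixed-I : ∀ {n} (w : SignedPerm n) {β γ y z} → β ∈ Φ⁺ (B n) → γ ∈ Φ⁺ (B n) →
  ⟪ β , values w ⟫ ≡ ι y → ⟪ γ , values w ⟫ ≡ ι z →
  (y ℤ.< ℤ.0ℤ × ¬ (z ℤ.< ℤ.0ℤ)) ⊎ (¬ (y ℤ.< ℤ.0ℤ) × z ℤ.< ℤ.0ℤ) → Mixed (I (B n) (act w)) β γ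
Mixed-I {n} w β∈ γ∈ β≡ γ≡ = [ (λ (y<0 , z≮0) → inj₁ (inverted β∈ β≡ y<0 , λ γ∈I → z≮0 (negative γ≡ γ∈I)))
                            , (λ (y≮0 , z<0) → inj₂ ((λ β∈I → y≮0 (negative β≡ β∈I)) , inverted γ∈ γ≡ z<0)) ]′
  where
  negative : ∀ {α x} → ⟪ α , values w ⟫ ≡ ι x → α ∈ I (B n) (act w) → x ℤ.< ℤ.0ℤ
  negative {α} {x} α≡ (α∈ , ⊟α∈) = ι-cancel-< {x} {+ 0} (subst (ℚ._< 0ℚ) α≡ (proj₁ (InvertsAt-act w α α∈) ⊟α∈))
  inverted : ∀ {α x} → α ∈ Φ⁺ (B n) → ⟪ α , values w ⟫ ≡ ι x → x ℤ.< ℤ.0ℤ → α ∈ I (B n) (act w)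
  inverted {α} {x} α∈ α≡ x<0 = α∈ , proj₂ (InvertsAt-act w α α∈) (subst (ℚ._< 0ℚ) (sym α≡) (ι-mono-< {x} {+ 0} x<0))

connected-to-zero : ∀ {m k} (c : Fin (suc m) → Fin k) → (∀ i → c i ≡ c zero) → ∀ i j → c i ≡ c j
connected-to-zero c to-zero i j = trans (to-zero i) (sym (to-zero j))

-1≢0 : ℚ.- 1ℚ ≢ 0ℚ
-1≢0 ()

module _ {n} (w : SignedPerm n) where
  private
    z : Fin n → ℤ
    z = oneLine w
    pos : Fin n → V n
    pos i = e (Sign.+ , i)
    diff sum : Fin n → Fin n → V n
    diff i j = e (Sign.- , i) ⊞ e (Sign.+ , j)
    sum i j = e (Sign.+ , i) ⊞ e (Sign.+ , j)

    pos∈ : ∀ i → pos i ∈ Φ⁺ (B n)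
    pos∈ i = inj₁ (i , refl)
    diff∈ : ∀ {i j} → i < j → diff i j ∈ Φ⁺ (B n)
    diff∈ {i} {j} i<j = inj₂ (i , j , i<j , Sign.- , refl)
    sum∈ : ∀ {i j} → i < j → sum i j ∈ Φ⁺ (B n)
    sum∈ {i} {j} i<j = inj₂ (i , j , i<j , Sign.+ , refl)

    <⇒≢ : ∀ {i j : Fin n} → i < j → i ≢ j
    <⇒≢ i<j i≡j = ℕₚ.<-irrefl (cong toℕ i≡j) i<j

    diff-telescope : ∀ i j k → diff i k ≡ diff i j ⊞ diff j k
    diff-telescope i j k = sym (trans (⊞-comm (diff i j) (diff j k)) (⊟⊞-telescope (pos j) (pos k) (pos i)))

    lookup-diff : ∀ i j k → lookup (diff i j) k ≡ ℚ.- lookup (pos i) k ℚ.+ lookup (pos j) k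
    lookup-diff i j k = trans (lookup-zipWith ℚ._+_ k (⊟ pos i) (pos j))
      (cong (ℚ._+ lookup (pos j) k) (lookup-map k (λ x → ℚ.- x) (pos i)))

    pos-diff : ∀ {i j} → i < j → ⟪ pos i , diff i j ⟫ ≡ ℚ.- 1ℚ
    pos-diff {i} {j} i<j = trans (⟪e+,⟫ i (diff i j)) (trans (lookup-diff i j i)
      (cong₂ (λ a b → ℚ.- a ℚ.+ b) (lookup-e-same i) (lookup-e-other (<⇒≢ i<j ∘ sym))))

    diff-diff : ∀ {i j k} → i < j → j < k → ⟪ diff i j , diff j k ⟫ ≡ ℚ.- 1ℚ
    diff-diff {i} {j} {k} i<j j<k = trans (⟪e⊞e,⟫ Sign.- i Sign.+ j (diff j k))
      (cong₂ (λ a b → ⟦ Sign.- ⟧ ℚ.* a ℚ.+ ⟦ Sign.+ ⟧ ℚ.* b)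
        (trans (lookup-diff j k i) (cong₂ (λ a b → ℚ.- a ℚ.+ b) (lookup-e-other (<⇒≢ i<j ∘ sym)) (lookup-e-other (<⇒≢ (ℕₚ.<-trans i<j j<k) ∘ sym))))
        (trans (lookup-diff j k j) (cong₂ (λ a b → ℚ.- a ℚ.+ b) (lookup-e-same j) (lookup-e-other (<⇒≢ j<k ∘ sym)))))

  Inv : Fin n → Fin n → Set
  Inv i j = ℤ.- z i ℤ.+ z j ℤ.< ℤ.0ℤ

  -- With `β₀ = eᵢ` and `β₁ = eⱼ − eᵢ`, the simple roots of the B₂ on positions `i` and `j`, the
  -- partners are `eⱼ = β₀ + β₁` and `eᵢ + eⱼ = β₁ + 2β₀`.
  obstruction-B₂ : ∀ {i j} → i < j →
    (z i ℤ.< ℤ.0ℤ × ¬ (z j ℤ.< ℤ.0ℤ)) ⊎ (¬ (z i ℤ.< ℤ.0ℤ) × z j ℤ.< ℤ.0ℤ) →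
    (Inv i j × ¬ (z i ℤ.+ z j ℤ.< ℤ.0ℤ)) ⊎ (¬ Inv i j × z i ℤ.+ z j ℤ.< ℤ.0ℤ) →
    Obstruction (B n) (act w)
  obstruction-B₂ {i} {j} i<j mixed₀ mixed₁ = record
    { size = 1 ; β = β ; γ = γ ; δ = δ
    ; β∈ = λ { zero → pos∈ i ; (suc zero) → diff∈ i<j }
    ; γ∈ = λ { zero → pos∈ j ; (suc zero) → sum∈ i<j }
    ; γ≡ = λ { zero → sym (trans (⊞-comm (pos i) (diff i j)) (⊟⊞-cancel (pos i) (pos j)))
             ; (suc zero) → sym (trans (sym (⊞-assoc (diff i j) (pos i) (pos i)))
                 (trans (cong (_⊞ pos i) (⊟⊞-cancel (pos i) (pos j))) (⊞-comm (pos j) (pos i)))) }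
    ; δ∈ = λ { zero → ℕSpan-generator (suc zero , refl)
             ; (suc zero) → ℕSpan-⊞ (ℕSpan-generator (zero , refl)) (ℕSpan-generator (zero , refl)) }
    ; mixed = λ { zero → Mixed-I w (pos∈ i) (pos∈ j) (⟪e,values⟫ w i) (⟪e,values⟫ w j) mixed₀
                ; (suc zero) → Mixed-I w (diff∈ i<j) (sum∈ i<j) (⟪e⊞e,values⟫ w Sign.- i j) (⟪e⊞e,values⟫ w Sign.+ i j) mixed₁ }
    ; connected = λ c link → connected-to-zero c
        λ { zero → refl ; (suc zero) → sym (link zero (suc zero) λ eq → -1≢0 (trans (sym (pos-diff i<j)) eq)) }
    }
    where
    β γ δ : Fin 2 → V n
    β zero       = pos i
    β (suc zero) = diff i j
    γ zero       = pos j
    γ (suc zero) = sum i j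
    δ zero       = diff i j
    δ (suc zero) = pos i ⊞ pos i

  -- Each outer simple root is compared with its sum with the middle one, and the middle one with
  -- the highest root. Both 3142 and 2413 alternate between ascents and descents at neighbouring
  -- positions, while the comparisons of `(i , k)`, `(i , l)` and `(j , l)` turn out the opposite
  -- way.
  obstruction-A₃ : ∀ {i j k l} → i < j → j < k → k < l →
    (Inv i j × ¬ Inv i k) ⊎ (¬ Inv i j × Inv i k) →
    (Inv j k × ¬ Inv i l) ⊎ (¬ Inv j k × Inv i l) →
    (Inv k l × ¬ Inv j l) ⊎ (¬ Inv k l × Inv j l) →
    Obstruction (B n) (act w)
  obstruction-A₃ {i} {j} {k} {l} i<j j<k k<l mixed₀ mixed₁ mixed₂ = record
    { size = 2 ; β = β ; γ = γ ; δ = δ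
    ; β∈ = λ { zero → diff∈ i<j ; (suc zero) → diff∈ j<k ; (suc (suc zero)) → diff∈ k<l }
    ; γ∈ = λ { zero → diff∈ i<k ; (suc zero) → diff∈ i<l ; (suc (suc zero)) → diff∈ j<l }
    ; γ≡ = λ { zero → diff-telescope i j k
             ; (suc zero) → trans (diff-telescope i j l) (trans (⊞-comm (diff i j) (diff j l))
                 (trans (cong (_⊞ diff i j) (diff-telescope j k l))
                   (trans (⊞-assoc (diff j k) (diff k l) (diff i j)) (cong (diff j k ⊞_) (⊞-comm (diff k l) (diff i j))))))
             ; (suc (suc zero)) → trans (diff-telescope j k l) (⊞-comm (diff j k) (diff k l)) }
    ; δ∈ = λ { zero → ℕSpan-generator (suc zero , refl)
             ; (suc zero) → ℕSpan-⊞ (ℕSpan-generator (zero , refl)) (ℕSpan-generator (suc (suc zero) , refl))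
             ; (suc (suc zero)) → ℕSpan-generator (suc zero , refl) }
    ; mixed = λ { zero → mixed-diff i<j i<k mixed₀ ; (suc zero) → mixed-diff j<k i<l mixed₁ ; (suc (suc zero)) → mixed-diff k<l j<l mixed₂ }
    ; connected = λ c link → let c₀≡c₁ = link zero (suc zero) λ eq → -1≢0 (trans (sym (diff-diff i<j j<k)) eq)
                                 c₁≡c₂ = link (suc zero) (suc (suc zero)) λ eq → -1≢0 (trans (sym (diff-diff j<k k<l)) eq) in
        connected-to-zero c λ { zero → refl ; (suc zero) → sym c₀≡c₁ ; (suc (suc zero)) → sym (trans c₀≡c₁ c₁≡c₂) }
    }
    where
    i<k = ℕₚ.<-trans i<j j<k
    j<l = ℕₚ.<-trans j<k k<l
    i<l = ℕₚ.<-trans i<j j<l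
    mixed-diff : ∀ {a b c d} → a < b → c < d → (Inv a b × ¬ Inv c d) ⊎ (¬ Inv a b × Inv c d) →
                 Mixed (I (B n) (act w)) (diff a b) (diff c d)
    mixed-diff {a} {b} {c} {d} a<b c<d = Mixed-I w (diff∈ a<b) (diff∈ c<d) (⟪e⊞e,values⟫ w Sign.- a b) (⟪e⊞e,values⟫ w Sign.- c d)
    β γ δ : Fin 3 → V n
    β zero             = diff i j
    β (suc zero)       = diff j k
    β (suc (suc zero)) = diff k l
    γ zero             = diff i k
    γ (suc zero)       = diff i l
    γ (suc (suc zero)) = diff j l
    δ zero             = diff j k
    δ (suc zero)       = diff i j ⊞ diff k l
    δ (suc (suc zero)) = diff j k

  obstruction-3142 : ∀ {i j k l} → i < j → j < k → k < l → z j ℤ.< z l → z l ℤ.< z i → z i ℤ.< z k → Obstruction (B n) (act w)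
  obstruction-3142 {i} {j} {k} {l} i<j j<k k<l j≺l l≺i i≺k = obstruction-A₃ i<j j<k k<l
    (inj₁ (<⇒diff-neg (ℤₚ.<-trans j≺l l≺i) , ≤⇒diff-nonneg (ℤₚ.<⇒≤ i≺k)))
    (inj₂ (≤⇒diff-nonneg (ℤₚ.<⇒≤ (ℤₚ.<-trans (ℤₚ.<-trans j≺l l≺i) i≺k)) , <⇒diff-neg l≺i))
    (inj₁ (<⇒diff-neg (ℤₚ.<-trans l≺i i≺k) , ≤⇒diff-nonneg (ℤₚ.<⇒≤ j≺l)))

  obstruction-2413 : ∀ {i j k l} → i < j → j < k → k < l → z k ℤ.< z i → z i ℤ.< z l → z l ℤ.< z j → Obstruction (B n) (act w)
  obstruction-2413 {i} {j} {k} {l} i<j j<k k<l k≺i i≺l l≺j = obstruction-A₃ i<j j<k k<l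
    (inj₂ (≤⇒diff-nonneg (ℤₚ.<⇒≤ (ℤₚ.<-trans i≺l l≺j)) , <⇒diff-neg k≺i))
    (inj₁ (<⇒diff-neg (ℤₚ.<-trans k≺i (ℤₚ.<-trans i≺l l≺j)) , ≤⇒diff-nonneg (ℤₚ.<⇒≤ i≺l)))
    (inj₂ (≤⇒diff-nonneg (ℤₚ.<⇒≤ (ℤₚ.<-trans k≺i i≺l)) , <⇒diff-neg l≺j))

  module _ {m} (u : SignedPerm m) (occ : w Contains u) where
    private
      p = proj₁ occ
      p-mono : ∀ {j k} → j < k → p j < p k
      p-mono = proj₁ (proj₂ occ)
      sts = proj₂ (proj₂ occ)

    occ-neg : ∀ i → oneLine u i ℤ.< ℤ.0ℤ → z (p i) ℤ.< ℤ.0ℤ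
    occ-neg i = Equivalence.to (proj₁ sts i)

    occ-nonneg : ∀ i → ¬ (oneLine u i ℤ.< ℤ.0ℤ) → ¬ (z (p i) ℤ.< ℤ.0ℤ)
    occ-nonneg i u≮0 z<0 = u≮0 (Equivalence.from (proj₁ sts i) z<0)

    -- `IsSts` speaks only of positions in increasing order. For `j < i` the claim is the
    -- contrapositive; for `i < j` equality is excluded because the entries of `w` have distinct
    -- absolute values.
    occ-abs : ∀ i j → ∣ oneLine u i ∣ ℕ.< ∣ oneLine u j ∣ → ∣ z (p i) ∣ ℕ.< ∣ z (p j) ∣
    occ-abs i j ui<uj with ℕₚ.<-cmp (toℕ i) (toℕ j)
    ... | tri< i<j _ _ = ℕₚ.≤∧≢⇒< (Equivalence.to (proj₂ sts i<j) ui<uj)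
                           λ eq → <⇒≢ (p-mono i<j) (∣oneLine∣-injective w eq)
    ... | tri≈ _ i≡j _ = ⊥-elim (ℕₚ.<-irrefl (cong (∣_∣ ∘ oneLine u) (toℕ-injective i≡j)) ui<uj)
    ... | tri> _ _ j<i = ℕₚ.≰⇒> λ le → ℕₚ.<-asym ui<uj (Equivalence.from (proj₂ sts j<i) le)

contained⇒obstructed : ∀ {n} (w : SignedPerm n) →
  w Contains [-2,1] ⊎ w Contains [2,-1] ⊎ w Contains [3,1,4,2] ⊎ w Contains [2,4,1,3] ⊎
  w Contains [-3,-1,-4,-2] ⊎ w Contains [-2,-4,-1,-3] → Obstruction (B n) (act w)
contained⇒obstructed w = go
  where
  z = oneLine w
  1<2ℕ : 1 ℕ.< 2
  1<2ℕ = s≤s (s≤s z≤n)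
  2<3ℕ : 2 ℕ.< 3
  2<3ℕ = s≤s 1<2ℕ
  3<4ℕ : 3 ℕ.< 4
  3<4ℕ = s≤s 2<3ℕ
  0<1F : _<_ {4} {4} 0F 1F
  0<1F = s≤s z≤n
  1<2 : _<_ {4} {4} 1F 2F
  1<2 = 1<2ℕ
  2<3 : _<_ {4} {4} 2F 3F
  2<3 = 2<3ℕ
  +≮0 : ∀ {k} → ¬ (+ k ℤ.< ℤ.0ℤ)
  +≮0 (ℤ.+<+ ())
  positive-<0 : ∀ {a} → a ℤ.< ℤ.0ℤ → ¬ (ℤ.- a ℤ.< ℤ.0ℤ)
  positive-<0 { -[1+ _ ]} _          (ℤ.+<+ ())
  positive-<0 {+ _}      (ℤ.+<+ ())
  negate-<0 : ∀ {a b} → ¬ (a ℤ.< ℤ.0ℤ) → ∣ b ∣ ℕ.< ∣ a ∣ → ℤ.- a ℤ.< ℤ.0ℤ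
  negate-<0 {+ suc _}   _   _ = ℤ.-<+
  negate-<0 { -[1+ _ ]} a≮0 _ = ⊥-elim (a≮0 ℤ.-<+)
  ∣-∣< : ∀ {a b} → ∣ b ∣ ℕ.< ∣ a ∣ → ∣ b ∣ ℕ.< ∣ ℤ.- a ∣
  ∣-∣< {a} {b} = subst (∣ b ∣ ℕ.<_) (sym (ℤₚ.∣-i∣≡∣i∣ a))
  positive : ∀ {m} (u : SignedPerm m) (occ : w Contains u) → (∀ i → ¬ (oneLine u i ℤ.< ℤ.0ℤ)) → ∀ i j →
    ∣ oneLine u i ∣ ℕ.< ∣ oneLine u j ∣ → z (proj₁ occ i) ℤ.< z (proj₁ occ j)
  positive u occ u≮0 i j lt = ∣<∣⇒< (occ-nonneg w u occ i (u≮0 i)) (occ-nonneg w u occ j (u≮0 j)) (occ-abs w u occ i j lt)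
  negative : ∀ {m} (u : SignedPerm m) (occ : w Contains u) → (∀ i → oneLine u i ℤ.< ℤ.0ℤ) → ∀ i j →
    ∣ oneLine u i ∣ ℕ.< ∣ oneLine u j ∣ → z (proj₁ occ j) ℤ.< z (proj₁ occ i)
  negative u occ u<0 i j lt = ∣<∣⇒> (occ-neg w u occ i (u<0 i)) (occ-neg w u occ j (u<0 j)) (occ-abs w u occ i j lt)
  go : _ → _
  -- As `∣ b ∣ < ∣ a ∣`, the sums `- a + b` and `a + b` take the signs of `- a` and `a`, which are
  -- opposite.
  go (inj₁ occ@(p , p-mono , _)) = obstruction-B₂ w (p-mono {zero} {suc zero} (s≤s z≤n)) (inj₁ (a<0 , b≮0))
      (inj₂ (subst (λ q → ¬ (q ℤ.< ℤ.0ℤ)) (ℤₚ.+-comm b (ℤ.- a)) (dominated-nonneg {b} {ℤ.- a} (positive-<0 a<0) (∣-∣< {a} {b} b<a))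
            , subst (ℤ._< ℤ.0ℤ) (ℤₚ.+-comm b a) (dominated-neg {b} {a} a<0 b<a)))
    where
    a = z (p zero)
    b = z (p (suc zero))
    a<0 = occ-neg w [-2,1] occ zero ℤ.-<+
    b≮0 = occ-nonneg w [-2,1] occ (suc zero) +≮0
    b<a : ∣ b ∣ ℕ.< ∣ a ∣
    b<a = occ-abs w [-2,1] occ (suc zero) zero (s≤s (s≤s z≤n))
  go (inj₂ (inj₁ occ@(p , p-mono , _))) = obstruction-B₂ w (p-mono {zero} {suc zero} (s≤s z≤n)) (inj₂ (a≮0 , b<0))
      (inj₁ (subst (ℤ._< ℤ.0ℤ) (ℤₚ.+-comm b (ℤ.- a)) (dominated-neg {b} {ℤ.- a} (negate-<0 {a} {b} a≮0 b<a) (∣-∣< {a} {b} b<a))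
            , subst (λ q → ¬ (q ℤ.< ℤ.0ℤ)) (ℤₚ.+-comm b a) (dominated-nonneg {b} {a} a≮0 b<a)))
    where
    a = z (p zero)
    b = z (p (suc zero))
    a≮0 = occ-nonneg w [2,-1] occ zero +≮0
    b<0 = occ-neg w [2,-1] occ (suc zero) ℤ.-<+
    b<a : ∣ b ∣ ℕ.< ∣ a ∣
    b<a = occ-abs w [2,-1] occ (suc zero) zero (s≤s (s≤s z≤n))
  go (inj₂ (inj₂ (inj₁ occ@(p , p-mono , _)))) = obstruction-3142 w (p-mono 0<1F) (p-mono 1<2) (p-mono 2<3)
      (lt 1F 3F 1<2ℕ) (lt 3F 0F 2<3ℕ) (lt 0F 2F 3<4ℕ)
    where lt = positive [3,1,4,2] occ λ { 0F → +≮0 ; 1F → +≮0 ; 2F → +≮0 ; 3F → +≮0 }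
  go (inj₂ (inj₂ (inj₂ (inj₁ occ@(p , p-mono , _))))) = obstruction-2413 w (p-mono 0<1F) (p-mono 1<2) (p-mono 2<3)
      (lt 2F 0F 1<2ℕ) (lt 0F 3F 2<3ℕ) (lt 3F 1F 3<4ℕ)
    where lt = positive [2,4,1,3] occ λ { 0F → +≮0 ; 1F → +≮0 ; 2F → +≮0 ; 3F → +≮0 }
  go (inj₂ (inj₂ (inj₂ (inj₂ (inj₁ occ@(p , p-mono , _)))))) = obstruction-2413 w (p-mono 0<1F) (p-mono 1<2) (p-mono 2<3)
      (lt 0F 2F 3<4ℕ) (lt 3F 0F 2<3ℕ) (lt 1F 3F 1<2ℕ)
    where lt = negative [-3,-1,-4,-2] occ λ { 0F → ℤ.-<+ ; 1F → ℤ.-<+ ; 2F → ℤ.-<+ ; 3F → ℤ.-<+ }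
  go (inj₂ (inj₂ (inj₂ (inj₂ (inj₂ occ@(p , p-mono , _)))))) = obstruction-3142 w (p-mono 0<1F) (p-mono 1<2) (p-mono 2<3)
      (lt 3F 1F 3<4ℕ) (lt 0F 3F 2<3ℕ) (lt 2F 0F 1<2ℕ)
    where lt = negative [-2,-4,-1,-3] occ λ { 0F → ℤ.-<+ ; 1F → ℤ.-<+ ; 2F → ℤ.-<+ ; 3F → ℤ.-<+ }

-- The last maximal block of constant sign starts at g; whatever precedes it
-- is smaller, by comparison with the entry just before the block.
last-block : ∀ {M : ℕ → ℕ → Set} (σ : ℕ → Sign) → Trans M → ∀ m →
  (∀ i j → i ℕ.< j → j ≤ m → σ i ≢ σ j → M i j) →
  ∃ λ g → g ≤ m × (∀ j → g ≤ j → j ≤ m → σ j ≡ σ m) × (∀ i j → i ℕ.< g → g ≤ j → j ≤ m → M i j)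
last-block {M} σ M-trans m differ = find m ℕₚ.≤-refl λ j m≤j j≤m → cong σ (ℕₚ.≤-antisym j≤m m≤j)
  where
  find : ∀ g → g ≤ m → (∀ j → g ≤ j → j ≤ m → σ j ≡ σ m) →
    ∃ λ g → g ≤ m × (∀ j → g ≤ j → j ≤ m → σ j ≡ σ m) × (∀ i j → i ℕ.< g → g ≤ j → j ≤ m → M i j)
  find zero    g≤m const = zero , z≤n , const , λ _ _ ()
  find (suc g) g<m const with σ g Sign.≟ σ m
  ... | yes same = find g (ℕₚ.<⇒≤ g<m) const′
    where
    const′ : ∀ j → g ≤ j → j ≤ m → σ j ≡ σ m
    const′ j g≤j j≤m with ℕₚ.m≤n⇒m<n∨m≡n g≤j
    ... | inj₁ g<j  = const j g<j j≤m
    ... | inj₂ refl = same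
  ... | no diff = suc g , g<m , const , before
    where
    before : ∀ i j → i ℕ.< suc g → suc g ≤ j → j ≤ m → M i j
    before i j (s≤s i≤g) g<j j≤m with σ i Sign.≟ σ m
    ... | no σi≢ = differ i j (ℕₚ.≤-<-trans i≤g g<j) j≤m λ eq → σi≢ (trans eq (const j g<j j≤m))
    ... | yes σi≡ = M-trans i g j
      (differ i g (ℕₚ.≤∧≢⇒< i≤g λ { refl → diff σi≡ }) (ℕₚ.<⇒≤ g<m) λ eq → diff (trans (sym eq) σi≡))
      (differ g j g<j j≤m λ eq → diff (trans eq (const j g<j j≤m)))

-- Sign blocks, cuts, and separability from avoidance

-- Bundled with its equation so that matching on `refl` turns a natural number position into `toℕ`
-- of an index.
fin : ∀ {n k} → k ℕ.< n → ∃ λ (i : Fin n) → toℕ i ≡ k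
fin k<n = fromℕ< k<n , toℕ-fromℕ< k<n

-- The junk value 0 for k ≥ n never matters.
valueAt : ∀ {n} → SignedPerm n → ℕ → ℤ
valueAt {n} w k with k ℕₚ.<? n
... | yes k<n = oneLine w (fromℕ< k<n)
... | no _    = ℤ.0ℤ

valueAt-toℕ : ∀ {n} (w : SignedPerm n) i → valueAt w (toℕ i) ≡ oneLine w i
valueAt-toℕ {n} w i with toℕ i ℕₚ.<? n
... | yes i<n = cong (oneLine w) (fromℕ<-toℕ i i<n)
... | no i≮n  = ⊥-elim (i≮n (toℕ<n i))

e-coweight-1 : ∀ {n} (i : Fin n) {k} → k ≤ toℕ i → ⟪ e (Sign.+ , i) , coweight k ⟫ ≡ 1ℚ
e-coweight-1 i {k} k≤i = trans (⟪e,coweight⟫ Sign.+ i k) (cong (1ℚ ℚ.*_) (step-≤ k≤i))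

e⊞e-coweight-1 : ∀ {n} s {i j : Fin n} {k} → toℕ i ℕ.< k → k ≤ toℕ j → ⟪ e (s , i) ⊞ e (Sign.+ , j) , coweight k ⟫ ≡ 1ℚ
e⊞e-coweight-1 s {i} {j} {k} i<k k≤j = trans (⟪e⊞e,coweight⟫ s i Sign.+ j k)
  (trans (cong₂ (λ a b → ⟦ s ⟧ ℚ.* a ℚ.+ ⟦ Sign.+ ⟧ ℚ.* b) (step-> i<k) (step-≤ k≤j)) (trans (cong (ℚ._+ 1ℚ) (ℚₚ.*-zeroʳ ⟦ s ⟧)) refl))

e⊞e-coweight-0 : ∀ {n} s {i j : Fin n} {k} → toℕ i ℕ.< k → toℕ j ℕ.< k → ⟪ e (s , i) ⊞ e (Sign.+ , j) , coweight k ⟫ ≡ 0ℚ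
e⊞e-coweight-0 s {i} {j} {k} i<k j<k = trans (⟪e⊞e,coweight⟫ s i Sign.+ j k)
  (trans (cong₂ (λ a b → ⟦ s ⟧ ℚ.* a ℚ.+ ⟦ Sign.+ ⟧ ℚ.* b) (step-> i<k) (step-> j<k)) (trans (cong (ℚ._+ 0ℚ) (ℚₚ.*-zeroʳ ⟦ s ⟧)) refl))

e⊞e-coweight-both : ∀ {n} s {i j : Fin n} {k} → k ≤ toℕ i → k ≤ toℕ j → ⟪ e (s , i) ⊞ e (Sign.+ , j) , coweight k ⟫ ≡ ⟦ s ⟧ ℚ.* 1ℚ ℚ.+ 1ℚ
e⊞e-coweight-both s {i} {j} {k} k≤i k≤j = trans (⟪e⊞e,coweight⟫ s i Sign.+ j k)
  (cong₂ (λ a b → ⟦ s ⟧ ℚ.* a ℚ.+ ⟦ Sign.+ ⟧ ℚ.* b) (step-≤ k≤i) (step-≤ k≤j))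

coefficient-1⇒∈ : ∀ {n} {J : Pred ℕ 0ℓ} → Decidable J → ∀ (β : V n) k → Supported J β → ⟪ β , coweight k ⟫ ≡ 1ℚ → J k
coefficient-1⇒∈ J? β k supp ≡1 with J? k
... | yes k∈J = k∈J
... | no k∉J  = ⊥-elim (ℚₚ.1≢0 (trans (sym ≡1) (supp k k∉J)))

∣signed∣ : ∀ s z → ∣ signed s z ∣ ≡ ∣ z ∣
∣signed∣ Sign.+ z = refl
∣signed∣ Sign.- z = ℤₚ.∣-i∣≡∣i∣ z

sign≡+⇒≮0 : ∀ {z} → ℤ.sign z ≡ Sign.+ → ¬ (z ℤ.< ℤ.0ℤ)
sign≡+⇒≮0 {+ _} _ (ℤ.+<+ ())

+-neg : ∀ {a b} → a ℤ.< ℤ.0ℤ → b ℤ.< ℤ.0ℤ → a ℤ.+ b ℤ.< ℤ.0ℤ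
+-neg = ℤₚ.+-mono-<

+-nonneg : ∀ {a b} → ¬ (a ℤ.< ℤ.0ℤ) → ¬ (b ℤ.< ℤ.0ℤ) → ¬ (a ℤ.+ b ℤ.< ℤ.0ℤ)
+-nonneg a≮0 b≮0 = ℤₚ.≤⇒≯ (ℤₚ.+-mono-≤ (ℤₚ.≮⇒≥ a≮0) (ℤₚ.≮⇒≥ b≮0))

HasSign : Sign → ℤ → Set
HasSign Sign.+ z = ¬ (z ℤ.< ℤ.0ℤ)
HasSign Sign.- z = z ℤ.< ℤ.0ℤ

hasSign : ∀ {s z} → ℤ.sign z ≡ s → HasSign s z
hasSign {Sign.+} = sign≡+⇒≮0
hasSign {Sign.-} = sign≡-⇒<0

HasSign-+ : ∀ s {a b} → HasSign s a → HasSign s b → HasSign s (a ℤ.+ b)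
HasSign-+ Sign.+ = +-nonneg
HasSign-+ Sign.- = +-neg

HasSign-dominated : ∀ s {a b} → HasSign s b → ∣ a ∣ ℕ.< ∣ b ∣ → HasSign s (a ℤ.+ b)
HasSign-dominated Sign.+ {a} = dominated-nonneg {a}
HasSign-dominated Sign.- {a} = dominated-neg {a}

module _ {n} (w : SignedPerm n) where
  private
    z : Fin n → ℤ
    z = oneLine w
    x : V n
    x = values w

  -- Both alternatives of `CutAt` at once, `+` standing for nonnegative. The pairing is exposed as
  -- an integer so that its sign can be computed from the entries of `w`.
  CutSign : Sign → ℕ → ℕ → ℕ → Set
  CutSign s a g b = ∀ β → β ∈ Φ⁺ (B n) → Supported (Interval a b) β → 0ℚ ℚ.< ⟪ β , coweight g ⟫ →
    ∃ λ y → ⟪ β , x ⟫ ≡ ι y × HasSign s y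

  CutSign⇒CutAt : ∀ s {a g b} → CutSign s a g b → CutAt x a g b
  CutSign⇒CutAt Sign.+ cut = inj₂ λ β β∈ supp 0<g β<0 → let (y , β≡ , y≮0) = cut β β∈ supp 0<g in
    y≮0 (ι-cancel-< {y} {+ 0} (subst (ℚ._< 0ℚ) β≡ β<0))
  CutSign⇒CutAt Sign.- cut = inj₁ λ β β∈ supp 0<g → let (y , β≡ , y<0) = cut β β∈ supp 0<g in
    subst (ℚ._< 0ℚ) (sym β≡) (ι-mono-< {y} {+ 0} y<0)

  -- A positive coefficient at `g` forces the larger position into the block from `g` on. If the
  -- smaller position lies before `g`, the block entry outweighs it and decides the sign; otherwise
  -- both entries have the sign `s`.
  cut-B : ∀ s g b → (∀ j → g ≤ toℕ j → toℕ j ℕ.< b → ℤ.sign (z j) ≡ s) →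
    (∀ i j → toℕ i ℕ.< g → g ≤ toℕ j → toℕ j ℕ.< b → ∣ z i ∣ ℕ.< ∣ z j ∣) → CutSign s 0 g b
  cut-B s g b signs dominates _ (inj₁ (i , refl)) supp 0<g = z i , ⟪e,values⟫ w i , hasSign (signs i g≤i i<b)
    where
    g≤i : g ≤ toℕ i
    g≤i with g ℕₚ.≤? toℕ i
    ... | yes g≤i = g≤i
    ... | no g≰i  = ⊥-elim (ℚₚ.<⇒≢ 0<g (sym (trans (⟪e,coweight⟫ Sign.+ i g) (cong (1ℚ ℚ.*_) (step-> (ℕₚ.≰⇒> g≰i))))))
    i<b : toℕ i ℕ.< b
    i<b = proj₂ (coefficient-1⇒∈ (interval? 0 b) (e (Sign.+ , i)) (toℕ i) supp (e-coweight-1 i ℕₚ.≤-refl))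
  cut-B s g b signs dominates _ (inj₂ (i , j , i<j , t , refl)) supp 0<g =
    signed t (z i) ℤ.+ z j , ⟪e⊞e,values⟫ w t i j , sum-sign
    where
    β = e (t , i) ⊞ e (Sign.+ , j)
    g≤j : g ≤ toℕ j
    g≤j with g ℕₚ.≤? toℕ j
    ... | yes g≤j = g≤j
    ... | no g≰j  = ⊥-elim (ℚₚ.<⇒≢ 0<g (sym (e⊞e-coweight-0 t (ℕₚ.<-trans i<j (ℕₚ.≰⇒> g≰j)) (ℕₚ.≰⇒> g≰j))))
    j<b : toℕ j ℕ.< b
    j<b = proj₂ (coefficient-1⇒∈ (interval? 0 b) β (toℕ j) supp (e⊞e-coweight-1 t i<j ℕₚ.≤-refl))
    -- With both positions in the block the coefficient at `g` is `t + 1`, so a difference has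
    -- coefficient 0 and is ruled out.
    t≡+ : g ≤ toℕ i → t ≡ Sign.+
    t≡+ g≤i = go t (subst (0ℚ ℚ.<_) (e⊞e-coweight-both t g≤i g≤j) 0<g)
      where
      go : ∀ t → 0ℚ ℚ.< ⟦ t ⟧ ℚ.* 1ℚ ℚ.+ 1ℚ → t ≡ Sign.+
      go Sign.+ _  = refl
      go Sign.- lt = ⊥-elim (ℚₚ.<-irrefl refl lt)
    sum-sign : HasSign s (signed t (z i) ℤ.+ z j)
    sum-sign with g ℕₚ.≤? toℕ i
    ... | no g≰i = HasSign-dominated s {signed t (z i)} (hasSign (signs j g≤j j<b))
                     (subst (ℕ._< ∣ z j ∣) (sym (∣signed∣ t (z i))) (dominates i j (ℕₚ.≰⇒> g≰i) g≤j j<b))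
    ... | yes g≤i with t≡+ g≤i
    ...   | refl = HasSign-+ s (hasSign (signs i g≤i (ℕₚ.<-trans i<j j<b))) (hasSign (signs j g≤j j<b))

  -- The interval omits index 0, at which `eᵢ` has coefficient 1 and `eᵢ + eⱼ` has coefficient 2, so
  -- only differences `eⱼ − eᵢ` are supported. For these a positive coefficient at `g` means
  -- `i < g ≤ j`.
  cut-A : ∀ s p g b → p ℕ.< g → (∀ i j → p ≤ toℕ i → toℕ i ℕ.< g → g ≤ toℕ j → toℕ j ℕ.< b → HasSign s (ℤ.- z i ℤ.+ z j)) →
    CutSign s (suc p) g b
  cut-A s p g b p<g signs _ (inj₁ (i , refl)) supp 0<g
    with coefficient-1⇒∈ (interval? (suc p) b) (e (Sign.+ , i)) 0 supp (e-coweight-1 i z≤n)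
  ... | () , _
  cut-A s p g b p<g signs _ (inj₂ (i , j , i<j , Sign.+ , refl)) supp 0<g =
    ⊥-elim (2≢0 (trans (sym (e⊞e-coweight-both Sign.+ {i} {j} z≤n z≤n)) (supp 0 λ { (() , _) })))
    where
    2≢0 : ⟦ Sign.+ ⟧ ℚ.* 1ℚ ℚ.+ 1ℚ ≢ 0ℚ
    2≢0 ()
  cut-A s p g b p<g signs _ (inj₂ (i , j , i<j , Sign.- , refl)) supp 0<g =
    ℤ.- z i ℤ.+ z j , ⟪e⊞e,values⟫ w Sign.- i j , signs i j p≤i i<g g≤j j<b
    where
    β = e (Sign.- , i) ⊞ e (Sign.+ , j)
    p≤i : p ≤ toℕ i
    p≤i = ℕₚ.≤-pred (proj₁ (coefficient-1⇒∈ (interval? (suc p) b) β (suc (toℕ i)) supp (e⊞e-coweight-1 Sign.- ℕₚ.≤-refl i<j)))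
    j<b : toℕ j ℕ.< b
    j<b = proj₂ (coefficient-1⇒∈ (interval? (suc p) b) β (toℕ j) supp (e⊞e-coweight-1 Sign.- i<j ℕₚ.≤-refl))
    i<g : toℕ i ℕ.< g
    i<g with g ℕₚ.≤? toℕ i
    ... | no g≰i  = ℕₚ.≰⇒> g≰i
    ... | yes g≤i = ⊥-elim (ℚₚ.<⇒≢ 0<g (sym (e⊞e-coweight-both Sign.- g≤i (ℕₚ.≤-trans g≤i (ℕₚ.<⇒≤ i<j)))))
    g≤j : g ≤ toℕ j
    g≤j with g ℕₚ.≤? toℕ j
    ... | yes g≤j = g≤j
    ... | no g≰j  = ⊥-elim (ℚₚ.<⇒≢ 0<g (sym (e⊞e-coweight-0 Sign.- i<g (ℕₚ.≰⇒> g≰j))))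

  _≺_ : ℕ → ℕ → Set
  i ≺ j = valueAt w i ℤ.< valueAt w j

  ≺⇒< : ∀ {i j} → toℕ i ≺ toℕ j → z i ℤ.< z j
  ≺⇒< {i} {j} = subst₂ ℤ._<_ (valueAt-toℕ w i) (valueAt-toℕ w j)

  ≺-trans : Trans _≺_
  ≺-trans i j k = ℤₚ.<-trans

  ≺-total : TotalBelow _≺_ n
  ≺-total i j i<j j<n with fin (ℕₚ.<-trans i<j j<n) | fin j<n
  ... | i′ , refl | j′ , refl with ℤₚ.<-cmp (valueAt w (toℕ i′)) (valueAt w (toℕ j′))
  ...   | tri< lt _ _ = inj₁ lt
  ...   | tri> _ _ gt = inj₂ gt
  ...   | tri≈ _ eq _ = ⊥-elim (ℕₚ.<-irrefl (cong toℕ (∣oneLine∣-injective w {i′} {j′}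
            (cong ∣_∣ (trans (sym (valueAt-toℕ w i′)) (trans eq (valueAt-toℕ w j′)))))) i<j)

  -- The positions from `p` to `q - 1` are joined by the simple roots with indices from `p + 1` to
  -- `q - 1`, hence the `suc p`. Cutting the word before position `g` deletes the simple root with
  -- index `g` and leaves the words on `[p, g)` and `[g, q)`.
  separable-A : ∀ N p q → q ≤ p ℕ.+ N → p ℕ.< q → q ≤ n → Avoiding _≺_ p q → SeparableOn x (suc p) q
  separable-A N p q q≤p+N p<q q≤n avoid with ℕₚ.m≤n⇒m<n∨m≡n p<q
  ... | inj₂ refl = separable-empty x (suc p)
  separable-A zero p q q≤p+N p<q q≤n avoid | inj₁ _ =
    ⊥-elim (ℕₚ.<⇒≱ p<q (subst (q ≤_) (ℕₚ.+-identityʳ p) q≤p+N))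
  separable-A (suc N) p q q≤p+N p<q q≤n avoid | inj₁ p+1<q
    with decompose (suc N) {_≺_} q ≺-trans ≺-total q≤p+N p+1<q q≤n avoid
  ... | g , p<g , g<q , cut = separable-cut p<g g<q q≤n {x} (Generic-values w) (cutAt cut)
      (separable-A N p g (ℕₚ.≤-pred (ℕₚ.<-≤-trans g<q q≤1+p+N)) p<g (ℕₚ.≤-trans (ℕₚ.<⇒≤ g<q) q≤n)
        (Avoiding-⊆ {_≺_} ℕₚ.≤-refl (ℕₚ.<⇒≤ g<q) avoid))
      (separable-A N g q (ℕₚ.≤-trans q≤1+p+N (ℕₚ.+-monoˡ-≤ N p<g)) g<q q≤n
        (Avoiding-⊆ {_≺_} (ℕₚ.<⇒≤ p<g) ℕₚ.≤-refl avoid))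
    where
    q≤1+p+N : q ≤ suc (p ℕ.+ N)
    q≤1+p+N = subst (q ≤_) (ℕₚ.+-suc p N) q≤p+N
    cutAt : Cut _≺_ p g q ⊎ Cut (flip _≺_) p g q → CutAt x (suc p) g q
    cutAt (inj₁ c) = CutSign⇒CutAt Sign.+ {suc p} {g} {q} (cut-A Sign.+ p g q p<g λ i j p≤i i<g g≤j j<q →
      ≤⇒diff-nonneg (ℤₚ.<⇒≤ (≺⇒< {i} {j} (c (toℕ i) (toℕ j) p≤i i<g g≤j j<q))))
    cutAt (inj₂ c) = CutSign⇒CutAt Sign.- {suc p} {g} {q} (cut-A Sign.- p g q p<g λ i j p≤i i<g g≤j j<q →
      <⇒diff-neg (≺⇒< {j} {i} (c (toℕ i) (toℕ j) p≤i i<g g≤j j<q)))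

  module _ (avoids : AvoidsAll w) where
    private
      σ : ℕ → Sign
      σ k = ℤ.sign (valueAt w k)

      _⊏_ : ℕ → ℕ → Set
      i ⊏ j = ∣ valueAt w i ∣ ℕ.< ∣ valueAt w j ∣

      differ : ∀ i j → i ℕ.< j → j ℕ.< n → σ i ≢ σ j → i ⊏ j
      differ i j i<j j<n σ≢ with fin (ℕₚ.<-trans i<j j<n) | fin j<n
      ... | i′ , refl | j′ , refl = subst₂ (λ a b → ∣ a ∣ ℕ.< ∣ b ∣) (sym (valueAt-toℕ w i′)) (sym (valueAt-toℕ w j′))
        (signs-differ w avoids i<j λ eq → σ≢ (trans (cong ℤ.sign (valueAt-toℕ w i′)) (trans eq (cong ℤ.sign (sym (valueAt-toℕ w j′))))))

      constant⇒avoiding : ∀ s p q → q ≤ n → (∀ (j : Fin n) → p ≤ toℕ j → toℕ j ℕ.< q → ℤ.sign (z j) ≡ s) → Avoiding _≺_ p q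
      constant⇒avoiding s p q q≤n signs i j k l p≤i i<j j<k k<l l<q
        with fin (ℕₚ.<-trans i<j (ℕₚ.<-trans j<k (ℕₚ.<-trans k<l (ℕₚ.<-≤-trans l<q q≤n))))
           | fin (ℕₚ.<-trans j<k (ℕₚ.<-trans k<l (ℕₚ.<-≤-trans l<q q≤n)))
           | fin (ℕₚ.<-trans k<l (ℕₚ.<-≤-trans l<q q≤n)) | fin (ℕₚ.<-≤-trans l<q q≤n)
      ... | i′ , refl | j′ , refl | k′ , refl | l′ , refl =
          (λ (a , b , c) → proj₁ avoid₄ (≺⇒< {j′} {l′} a , ≺⇒< {l′} {i′} b , ≺⇒< {i′} {k′} c)) ,
          (λ (a , b , c) → proj₂ avoid₄ (≺⇒< {l′} {j′} a , ≺⇒< {i′} {l′} b , ≺⇒< {k′} {i′} c))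
        where
        within : ∀ h → h ≡ i′ ⊎ h ≡ j′ ⊎ h ≡ k′ ⊎ h ≡ l′ → ℤ.sign (z h) ≡ s
        within h (inj₁ refl)               = signs h p≤i (ℕₚ.<-trans i<j (ℕₚ.<-trans j<k (ℕₚ.<-trans k<l l<q)))
        within h (inj₂ (inj₁ refl))        = signs h (ℕₚ.≤-trans p≤i (ℕₚ.<⇒≤ i<j)) (ℕₚ.<-trans j<k (ℕₚ.<-trans k<l l<q))
        within h (inj₂ (inj₂ (inj₁ refl))) = signs h (ℕₚ.≤-trans p≤i (ℕₚ.<⇒≤ (ℕₚ.<-trans i<j j<k))) (ℕₚ.<-trans k<l l<q)
        within h (inj₂ (inj₂ (inj₂ refl))) = signs h (ℕₚ.≤-trans p≤i (ℕₚ.<⇒≤ (ℕₚ.<-trans i<j (ℕₚ.<-trans j<k k<l)))) l<q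
        avoid₄ = same-sign-avoiding w avoids {i′} {j′} {k′} {l′} i<j j<k k<l s within

    -- The recursive call concerns the first `g` entries, and `g` is not a subterm of `b`; `N`
    -- supplies the descent.
    separable-B : ∀ N b → b ≤ N → b ≤ n → SeparableOn x 0 b
    separable-B _       zero    _         _   = separable-empty x 0
    separable-B (suc N) (suc m) (s≤s m≤N) m<n
      with last-block {_⊏_} σ (λ i j k → ℕₚ.<-trans) m (λ i j i<j j≤m → differ i j i<j (ℕₚ.≤-<-trans j≤m m<n))
    ... | g , g≤m , constant , dominates = separable-cut z≤n (s≤s g≤m) m<n {x} (Generic-values w)
        (CutSign⇒CutAt (σ m) {0} {g} {suc m} (cut-B (σ m) g (suc m) signs λ i j i<g g≤j j<b →
          subst₂ (λ a b → ∣ a ∣ ℕ.< ∣ b ∣) (valueAt-toℕ w i) (valueAt-toℕ w j) (dominates (toℕ i) (toℕ j) i<g g≤j (ℕₚ.≤-pred j<b))))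
        (separable-B N g (ℕₚ.≤-trans g≤m m≤N) (ℕₚ.≤-trans g≤m (ℕₚ.<⇒≤ m<n)))
        (separable-A (suc m) g (suc m) (ℕₚ.m≤n+m (suc m) g) (s≤s g≤m) m<n (constant⇒avoiding (σ m) g (suc m) m<n signs))
      where
      signs : ∀ j → g ≤ toℕ j → toℕ j ℕ.< suc m → ℤ.sign (z j) ≡ σ m
      signs j g≤j j<b = trans (cong ℤ.sign (sym (valueAt-toℕ w j))) (constant (toℕ j) g≤j (ℕₚ.≤-pred j<b))

B-≅ : ∀ n → B n ≅ Interval 0 n
B-≅ n = record
  { Φ≐  = (λ {v} v∈ → v∈ , supported v v∈) , proj₁
  ; Φ⁺≐ = (λ {v} v∈ → v∈ , supported⁺ v v∈) , proj₁
  ; Δ≐  = (λ δ∈ → let (k , δ≡) = Δ⇒simple δ∈ in k , (z≤n , toℕ<n k) , δ≡) , λ { (k , _ , refl) → simple∈Δ k }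
  }
  where
  supported⁺ : ∀ (v : V n) → v ∈ Φ⁺ (B n) → Supported (Interval 0 n) v
  supported⁺ v v∈ k k∉ = ℕSpan-⊥ (coweight k) vanish (Φ⁺ᴮ⊆ℕΔ v∈)
    where
    vanish : ∀ {s} → s ∈ Δ (B n) → ⟪ s , coweight k ⟫ ≡ 0ℚ
    vanish s∈ with Δ⇒simple s∈
    ... | j , refl = simple-coweight-other j {k} λ { refl → k∉ (z≤n , toℕ<n j) }
  supported : ∀ (v : V n) → v ∈ Φ (B n) → Supported (Interval 0 n) v
  supported v v∈ with Φᴮ-± v∈
  ... | inj₁ v∈⁺ = supported⁺ v v∈⁺
  ... | inj₂ v∈⁻ = subst (Supported (Interval 0 n)) (⊟-involutive v) (Supported-⊟ {v = ⊟ v} (supported⁺ (⊟ v) v∈⁻))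

avoids⇒separable : ∀ {n} (w : SignedPerm n) → AvoidsAll w → IsSeparable w
avoids⇒separable {n} w avoids =
  separable-B w avoids n n ℕₚ.≤-refl ℕₚ.≤-refl (B n) (act w) (B-≅ n) (InvertsAt-act w)

separable⇒avoids : ∀ {n} (w : SignedPerm n) → IsSeparable w → AvoidsAll w
separable⇒avoids {n} w sep =
  absurd ∘ inj₁ , absurd ∘ inj₂ ∘ inj₁ , absurd ∘ inj₂ ∘ inj₂ ∘ inj₁ , absurd ∘ inj₂ ∘ inj₂ ∘ inj₂ ∘ inj₁ ,
  absurd ∘ inj₂ ∘ inj₂ ∘ inj₂ ∘ inj₂ ∘ inj₁ , absurd ∘ inj₂ ∘ inj₂ ∘ inj₂ ∘ inj₂ ∘ inj₂
  where
  absurd : _ → ⊥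
  absurd occurrence = separable⇒unobstructed (Good-B n) sep (contained⇒obstructed w occurrence)

lemma3p5 : (n : ℕ) → 2 ≤ n → (w : SignedPerm n) →
    IsSeparable w ⇔
    (w Avoids [-2,1] × w Avoids [2,-1] ×
    w Avoids [3,1,4,2] × w Avoids [2,4,1,3] ×
    w Avoids [-3,-1,-4,-2] × w Avoids [-2,-4,-1,-3])
lemma3p5 n _ w = mk⇔ (separable⇒avoids w) (avoids⇒separable w)
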